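{- For every $\star\in\{\mathrm{vvv},\mathrm{ev},\mathrm{ee}\}$ we have $\Lambda_\star^{\mathrm{pal}}\subseteq\Pi^{(3)}_{\star,\infty}$. That is, for every palette $\mathscr{P}$ there is a family $\mathcal{F}$ of $3$-graphs with $\pi_\star(\mathcal{F})=\Lambda^\star_{\mathscr{P}}$.
   Context: A $3$-graph $H=(V,E)$ consists of a finite vertex set $V$ and an edge set $E\subseteq V^{(3)}$, where $V^{(k)}=\{e\subseteq V : |e|=k\}$; we write $xy$, $xyz$ for $\{x,y\}$, $\{x,y,z\}$. A family of $3$-graphs is a (possibly infinite) set of $3$-graphs; $H$ is $\mathcal{F}$-free if it contains no member of $\mathcal{F}$ as a (not necessarily induced) subhypergraph. Densities. Let $H=(V,E)$ be a $3$-graph, $d\in[0,1]$, $\eta>0$. For $X,Y,Z\subseteq V$ and $P,Q\subseteq V^{(2)}$ let - $e_{\mathrm{vvv}}(X,Y,Z)=|\{(x,y,z)\in X\times Y\times Z : xyz\in E\}|$; - $e_{\mathrm{ev}}(X,P)=|\{(x,yz) : x\in X,\ yz\in P,\ xyz\in E\}|$, where each unordered pair $yz\in P$ is counted once; - $K_{\mathrm{ee}}(P,Q)=\{(x,y,z)\in V^3 : xy\in P,\ yz\in Q\}$ and $e_{\mathrm{ee}}(P,Q)=|\{(x,y,z)\in K_{\mathrm{ee}}(P,Q) : xyz\in E\}|$. $H$ is $(d,\eta,\mathrm{vvv})$-dense if $e_{\mathrm{vvv}}(X,Y,Z)\geq d|X||Y||Z|-\eta|V|^3$ for all $X,Y,Z\subseteq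 V$; it is $(d,\eta,\mathrm{ev})$-dense if $e_{\mathrm{ev}}(X,P)\geq d|X||P|-\eta|V|^3$ for all $X\subseteq V$, $P\subseteq V^{(2)}$; it is $(d,\eta,\mathrm{ee})$-dense if $e_{\mathrm{ee}}(P,Q)\geq d|K_{\mathrm{ee}}(P,Q)|-\eta|V|^3$ for all $P,Q\subseteq V^{(2)}$. For $\star\in\{\mathrm{vvv},\mathrm{ev},\mathrm{ee}\}$ and a family $\mathcal{F}$ of $3$-graphs, $\pi_\star(\mathcal{F})$ is the supremum of all $d\in[0,1]$ such that for all $\eta>0$ and $n\in\mathbb{N}$ there is an $\mathcal{F}$-free, $(d,\eta,\star)$-dense $3$-graph on at least $n$ vertices. Set $\Pi^{(3)}_{\star,\infty}=\{\pi_\star(\mathcal{F}) : \mathcal{F}\text{ is a family of }3\text{ -graphs}\}$. Palettes. A palette is a nonempty finite set $\mathscr{P}$ of ordered triples of elements of $\mathbb{N}$ (entries may coincide). Its set of colours $\Phi(\mathscr{P})$ is the set of all entries of triples in $\mathscr{P}$. Let $\mathbb{S}_{|\Phi(\mathscr{P})|}$ be the set of vectors $\mathbf{x}=(x_a)_{a\in\Phi(\mathscr{P})}\in[0,1]^{\Phi(\mathscr{P})}$ with $\sum_a x_a=1$. For such $\mathbf{x}$ and $a,b\in\Phi(\mathscr{P})$ (not necessarily distinct) define $$\lambda^{\mathrm{vvv}}_{\mathscr{P}}(\mathbf{x})=\sum_{(a,b,c)\in\mathscr{P}}x_ax_bx_c,$$ $$\lambda^{a}_{\mathscr{P}}(\mathbf{x})=\min\Big\{\sum_{(a,c,d)\in\mathscr{P}}x_cx_d,\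 \sum_{(c,a,d)\in\mathscr{P}}x_cx_d,\ \sum_{(c,d,a)\in\mathscr{P}}x_cx_d\Big\},$$ $$\lambda^{a,b}_{\mathscr{P}}(\mathbf{x})=\min\Big\{\sum_{(a,b,c)\in\mathscr{P}}x_c,\ \sum_{(b,a,c)\in\mathscr{P}}x_c,\ \sum_{(a,c,b)\in\mathscr{P}}x_c,\ \sum_{(b,c,a)\in\mathscr{P}}x_c,\ \sum_{(c,a,b)\in\mathscr{P}}x_c,\ \sum_{(c,b,a)\in\mathscr{P}}x_c\Big\},$$ where in the last two displays $a$ (respectively $a,b$) is fixed and the sums run over the remaining colours. Put $$\lambda^{\mathrm{ev}}_{\mathscr{P}}(\mathbf{x})=\min_{a\in\Phi(\mathscr{P}):\,x_a>0}\lambda^a_{\mathscr{P}}(\mathbf{x}),\qquad \lambda^{\mathrm{ee}}_{\mathscr{P}}(\mathbf{x})=\min_{a,b\in\Phi(\mathscr{P}):\,x_ax_b>0}\lambda^{a,b}_{\mathscr{P}}(\mathbf{x}),$$ and for $\star\in\{\mathrm{vvv},\mathrm{ev},\mathrm{ee}\}$ let $\Lambda^\star_{\mathscr{P}}=\max_{\mathbf{x}\in\mathbb{S}_{|\Phi(\mathscr{P})|}}\lambda^\star_{\mathscr{P}}(\mathbf{x})$ be the $\star$-Lagrangian of $\mathscr{P}$. Set $\Lambda^{\mathrm{pal}}_\star=\{\Lambda^\star_{\mathscr{P}} : \mathscr{P}\text{ is a palette}\}$. -}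

module Defs where

open import Algebra.Bundles using (CommutativeRing)
import Algebra.Construct.NaturalChoice.Min as NaturalMin
import Algebra.Definitions.RawMonoid as Mult
open import Data.Bool.Base using (Bool; T)
open import Data.Bool.Properties using (T?)
open import Data.Fin.Base using (Fin)
import Data.Fin.Base as Fin
import Data.Fin.Properties as Fin
open import Data.Fin.Subset using (Subset; ⁅_⁆; _∪_; ∣_∣)
import Data.Fin.Subset as Sub
open import Data.Fin.Subset.Properties using (_∈?_)
open import Data.List.Base
  using (List; []; _∷_; length; filter; foldr; map; concatMap; cartesianProduct; allFin; deduplicate)
open import Data.List.Membership.Propositional using (_∈_)
open import Data.List.Relation.Unary.Unique.Propositional using (Unique)
open import Data.Nat.Base using (ℕ)
import Data.Nat.Base as ℕ
import Data.Nat.Properties as ℕ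
open import Data.Product.Base using (Σ; ∃; ∃-syntax; _×_; _,_)
open import Function.Definitions using (Injective)
open import Level using (0ℓ; suc)
open import Relation.Binary.Bundles using (TotalOrder)
open import Relation.Binary.Core using (Rel)
import Relation.Binary.Construct.NonStrictToStrict as Strict
open import Relation.Binary.PropositionalEquality.Core using (_≡_; _≢_)
open import Relation.Binary.Structures using (IsTotalOrder)
open import Relation.Nullary.Decidable.Core using (_×-dec_)
open import Relation.Nullary.Negation.Core using (¬_)
open import Relation.Unary using (Pred; Decidable)

------------------------------------------------------------------------
-- Real numbers

module _ {A : Set} (_≤_ : Rel A 0ℓ) where

  IsUpperBound : Pred A 0ℓ → A → Set
  IsUpperBound S u = ∀ x → S x → x ≤ u

  IsSupremum : Pred A 0ℓ → A → Set
  IsSupremum S s = IsUpperBound S s × (∀ u → IsUpperBound S u → s ≤ u)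

  IsMaximum : Pred A 0ℓ → A → Set
  IsMaximum S m = S m × (∀ x → S x → x ≤ m)

  IsMinimum : Pred A 0ℓ → A → Set
  IsMinimum S m = S m × (∀ x → S x → m ≤ x)

-- The library has no real numbers.  We use their axiomatic
-- characterisation (unique up to isomorphism): a totally ordered field in
-- which every inhabited set that is bounded above has a supremum.
record CompleteOrderedField : Set (suc 0ℓ) where
  field
    commutativeRing : CommutativeRing 0ℓ 0ℓ

  open CommutativeRing commutativeRing public
    using (Carrier; _≈_; _+_; _*_; -_; _-_; 0#; 1#; +-rawMonoid)

  infix 4 _≤_ _<_
  field
    1≉0          : ¬ (1# ≈ 0#)
    inverse      : ∀ x → ¬ (x ≈ 0#) → ∃[ y ] (x * y ≈ 1#)
    _≤_          : Rel Carrier 0ℓ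
    isTotalOrder : IsTotalOrder _≈_ _≤_
    +-monoˡ-≤    : ∀ z {x y} → x ≤ y → (x + z) ≤ (y + z)
    *-nonNeg     : ∀ {x y} → 0# ≤ x → 0# ≤ y → 0# ≤ (x * y)
    complete     : (S : Pred Carrier 0ℓ) → ∃ S → ∃ (IsUpperBound _≤_ S) → ∃ (IsSupremum _≤_ S)

  _<_ : Rel Carrier 0ℓ
  _<_ = Strict._<_ _≈_ _≤_

  totalOrder : TotalOrder 0ℓ 0ℓ 0ℓ
  totalOrder = record { isTotalOrder = isTotalOrder }

  open NaturalMin totalOrder public using (_⊓_)

  fromℕ : ℕ → Carrier
  fromℕ n = Mult._×_ +-rawMonoid n 1#

  ∑[_] : {I : Set} → List I → (I → Carrier) → Carrier
  ∑[ is ] f = foldr _+_ 0# (map f is)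

------------------------------------------------------------------------
-- Hypergraphs

-- A set of k-element subsets of Fin n.
record UniformSet (k n : ℕ) : Set where
  field
    member  : Subset n → Bool
    uniform : ∀ e → T (member e) → ∣ e ∣ ≡ k

open UniformSet public

_∋_ : ∀ {k n} → UniformSet k n → Subset n → Set
S ∋ e = T (member S e)

_∋?_ : ∀ {k n} (S : UniformSet k n) → Decidable (S ∋_)
S ∋? e = T? (member S e)

pair : ∀ {n} → Fin n → Fin n → Subset n
pair x y = ⁅ x ⁆ ∪ ⁅ y ⁆

triple : ∀ {n} → Fin n → Fin n → Fin n → Subset n
triple x y z = ⁅ x ⁆ ∪ ⁅ y ⁆ ∪ ⁅ z ⁆

record 3Graph : Set where
  field
    order : ℕ
    edges : UniformSet 3 order

open 3Graph public

_⊑_ : 3Graph → 3Graph → Set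
F ⊑ H = Σ (Fin (order F) → Fin (order H)) λ f →
  Injective _≡_ _≡_ f ×
  (∀ x y z → edges F ∋ triple x y z → edges H ∋ triple (f x) (f y) (f z))

Family : Set (suc 0ℓ)
Family = Pred 3Graph 0ℓ

_FreeOf_ : 3Graph → Family → Set
H FreeOf 𝓕 = ∀ F → 𝓕 F → ¬ (F ⊑ H)

------------------------------------------------------------------------
-- Counting

#[_] : {A : Set} → List A → {P : Pred A 0ℓ} → Decidable P → ℕ
#[ as ] P? = length (filter P? as)

pairs : ∀ n → List (Fin n × Fin n)
pairs n = cartesianProduct (allFin n) (allFin n)

triples : ∀ n → List (Fin n × Fin n × Fin n)
triples n = cartesianProduct (allFin n) (pairs n)

-- Unordered pairs {y , z} are counted once, through their listing with y < z.
∣_∣₂ : ∀ {n} → UniformSet 2 n → ℕ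
∣_∣₂ {n} P = #[ pairs n ] λ (y , z) → (y Fin.<? z) ×-dec (P ∋? pair y z)

∣Kee∣ : ∀ {n} → UniformSet 2 n → UniformSet 2 n → ℕ
∣Kee∣ {n} P Q = #[ triples n ] λ (x , y , z) → (P ∋? pair x y) ×-dec (Q ∋? pair y z)

module _ (H : 3Graph) where
  private
    n = order H
    E = edges H

  e-vvv : Subset n → Subset n → Subset n → ℕ
  e-vvv X Y Z = #[ triples n ] λ (x , y , z) →
    (x ∈? X) ×-dec (y ∈? Y) ×-dec (z ∈? Z) ×-dec (E ∋? triple x y z)

  e-ev : Subset n → UniformSet 2 n → ℕ
  e-ev X P = #[ triples n ] λ (x , y , z) →
    (x ∈? X) ×-dec (y Fin.<? z) ×-dec (P ∋? pair y z) ×-dec (E ∋? triple x y z)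

  e-ee : UniformSet 2 n → UniformSet 2 n → ℕ
  e-ee P Q = #[ triples n ] λ (x , y , z) →
    (P ∋? pair x y) ×-dec (Q ∋? pair y z) ×-dec (E ∋? triple x y z)

data Mode : Set where
  vvv ev ee : Mode

------------------------------------------------------------------------
-- Palettes

Triple : Set
Triple = ℕ × ℕ × ℕ

record Palette : Set where
  field
    patterns : List Triple
    unique   : Unique patterns
    nonempty : patterns ≢ []

open Palette public

Φ : Palette → List ℕ
Φ 𝓟 = deduplicate ℕ._≟_ (concatMap (λ (a , b , c) → a ∷ b ∷ c ∷ []) (patterns 𝓟))

------------------------------------------------------------------------

module _ (ℝ : CompleteOrderedField) where
  open CompleteOrderedField ℝ

  Dense : Mode → Carrier → Carrier → 3Graph → Set
  Dense vvv d η H = ∀ X Y Z →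
    (d * fromℕ (∣ X ∣ ℕ.* ∣ Y ∣ ℕ.* ∣ Z ∣)) - (η * fromℕ (order H ℕ.^ 3)) ≤ fromℕ (e-vvv H X Y Z)
  Dense ev d η H = ∀ X P →
    (d * fromℕ (∣ X ∣ ℕ.* ∣ P ∣₂)) - (η * fromℕ (order H ℕ.^ 3)) ≤ fromℕ (e-ev H X P)
  Dense ee d η H = ∀ P Q →
    (d * fromℕ (∣Kee∣ P Q)) - (η * fromℕ (order H ℕ.^ 3)) ≤ fromℕ (e-ee H P Q)

  -- IsTuránDensity ⋆ 𝓕 r says π⋆(𝓕) = r.
  IsTuránDensity : Mode → Family → Carrier → Set
  IsTuránDensity ⋆ 𝓕 = IsSupremum _≤_ λ d →
    0# ≤ d × d ≤ 1# ×
    (∀ η → 0# < η → ∀ n → ∃[ H ] (H FreeOf 𝓕 × n ℕ.≤ order H × Dense ⋆ d η H))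

  module _ (𝓟 : Palette) where

    -- A vector indexed by Φ 𝓟 is represented by a function on all of ℕ;
    -- its values outside Φ 𝓟 are unconstrained and never used.
    Simplex : Pred (ℕ → Carrier) 0ℓ
    Simplex x = (∀ a → a ∈ Φ 𝓟 → 0# ≤ x a × x a ≤ 1#) × ∑[ Φ 𝓟 ] x ≈ 1#

    ∑𝓟 : {C : Pred Triple 0ℓ} → Decidable C → (Triple → Carrier) → Carrier
    ∑𝓟 C? = ∑[ filter C? (patterns 𝓟) ]

    λ-vvv : (ℕ → Carrier) → Carrier
    λ-vvv x = ∑[ patterns 𝓟 ] λ (a , b , c) → x a * x b * x c

    λ¹ : (ℕ → Carrier) → ℕ → Carrier
    λ¹ x a =
      ∑𝓟 (λ (p , q , r) → p ℕ.≟ a) (λ (p , q , r) → x q * x r) ⊓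
      ∑𝓟 (λ (p , q , r) → q ℕ.≟ a) (λ (p , q , r) → x p * x r) ⊓
      ∑𝓟 (λ (p , q , r) → r ℕ.≟ a) (λ (p , q , r) → x p * x q)

    λ² : (ℕ → Carrier) → ℕ → ℕ → Carrier
    λ² x a b =
      ∑𝓟 (λ (p , q , r) → (p ℕ.≟ a) ×-dec (q ℕ.≟ b)) (λ (p , q , r) → x r) ⊓
      ∑𝓟 (λ (p , q , r) → (p ℕ.≟ b) ×-dec (q ℕ.≟ a)) (λ (p , q , r) → x r) ⊓
      ∑𝓟 (λ (p , q , r) → (p ℕ.≟ a) ×-dec (r ℕ.≟ b)) (λ (p , q , r) → x q) ⊓
      ∑𝓟 (λ (p , q , r) → (p ℕ.≟ b) ×-dec (r ℕ.≟ a)) (λ (p , q , r) → x q) ⊓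
      ∑𝓟 (λ (p , q , r) → (q ℕ.≟ a) ×-dec (r ℕ.≟ b)) (λ (p , q , r) → x p) ⊓
      ∑𝓟 (λ (p , q , r) → (q ℕ.≟ b) ×-dec (r ℕ.≟ a)) (λ (p , q , r) → x p)

    -- Isλ ⋆ x v says λ⋆(x) = v.  It is a relation because the colours over
    -- which the minimum is taken depend on the undecidable condition x a > 0.
    Isλ : Mode → (ℕ → Carrier) → Carrier → Set
    Isλ vvv x v = v ≈ λ-vvv x
    Isλ ev  x   = IsMinimum _≤_ λ v →
      ∃[ a ] (a ∈ Φ 𝓟 × 0# < x a × v ≈ λ¹ x a)
    Isλ ee  x   = IsMinimum _≤_ λ v →
      ∃[ a ] ∃[ b ] (a ∈ Φ 𝓟 × b ∈ Φ 𝓟 × 0# < x a * x b × v ≈ λ² x a b)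

  -- IsLagrangian ⋆ 𝓟 r says Λ⋆(𝓟) = r.
  IsLagrangian : Mode → Palette → Carrier → Set
  IsLagrangian ⋆ 𝓟 = IsMaximum _≤_ λ v → ∃[ x ] (Simplex 𝓟 x × Isλ 𝓟 ⋆ x v)

{-# OPTIONS --safe #-}
-- The family 𝓕 consists of the 3-graphs that cannot be ordered and pair-coloured so that every edge
-- x < y < z carries a pattern (φ xy , φ xz , φ yz) of 𝓟; being 𝓕-free then means being colourable.
--
-- Lower bound.  For a maximiser x of the Lagrangian, colour the pairs of n vertices so that every colour c has
-- density x c in all rectangles up to o(n²), and take all triples whose pattern lies in 𝓟.  Such a colouring is
-- chosen greedily, keeping the sum of the squared correlations of the columns of the matrices 1[φ = c] - x c
-- at O(n³); by Cauchy-Schwarz their cut norm is o(n²).  Closeness in cut norm allows one to replace, in sums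
-- over triples, the colour of a pair by its average whenever the test set is a rectangle in this pair: three,
-- two or one times for the modes vvv, ev and ee.
--
-- Upper bound.  A coloured dense graph is cut into many intervals of its order.  Density increments make all
-- pairs of intervals regular in every colour, after passing to subsets of positive proportion, and Ramsey's
-- theorem gives three parts X < Y < Z whose pairs have nearly the same colour densities x.  Testing the density
-- hypothesis on X, Y, Z and on the colour classes between them shows that x is almost as good as the density
-- demands; compactness of the simplex removes the error.
module Submission where

open import Defs
open import Axiom.ExcludedMiddle using (ExcludedMiddle)
open import Level using (0ℓ)
open import Algebra.Bundles using (CommutativeRing)
import Algebra.Construct.NaturalChoice.Min as NaturalMin
import Algebra.Construct.NaturalChoice.MinOp as MinOp
import Algebra.Properties.Ring as RingProperties
import Algebra.Properties.Semiring.Mult as SemiringMult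
import Algebra.Properties.Semiring.Mult.TCOptimised as SemiringMult′
import Algebra.Solver.Ring as RingSolver
open import Algebra.Solver.Ring.AlmostCommutativeRing using (fromCommutativeRing; _-Raw-AlmostCommutative⟶_)
open import Data.Bool.Base using (Bool; true; false; _∧_)
import Data.Fin.Base as Fin
open import Data.Fin.Base using (Fin)
import Data.Fin.Properties as Fin
import Data.Fin.Subset as Sub
open import Data.Fin.Subset using (Subset; ⁅_⁆; _∪_; ∣_∣; _∉_)
open import Data.Fin.Subset.Properties using (_∈?_; x∈⁅x⁆; x∈⁅y⁆⇒x≡y; x∈p∪q⁻; x∈p∪q⁺; ∪-comm; ∪-assoc; ∣⁅x⁆∣≡1; ∪-identityˡ; drop-there)
import Data.Integer.Base as ℤ
open import Data.Integer.Base using (ℤ; +_; -[1+_])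
import Data.Integer.Properties as ℤ
open import Data.List.Base using (List; []; _∷_; _++_; length; filter; map; cartesianProduct; allFin; upTo; cartesianProductWith)
open import Data.List.Membership.Propositional using (_∈_)
open import Data.List.Membership.Propositional.Properties using (∈-deduplicate⁺; ∈-cartesianProduct⁺; ∈-concatMap⁺; ∈-cartesianProduct⁻; ∈-filter⁻; ∈-filter⁺; ∈-upTo⁺; ∈-cartesianProductWith⁺; ∈-allFin)
import Data.List.Properties as List
import Data.List.Relation.Unary.All as All
open import Data.List.Relation.Unary.AllPairs using (AllPairs; []; _∷_)
import Data.List.Relation.Unary.AllPairs.Properties as AllPairs
import Data.List.Relation.Unary.Any as Any
open import Data.List.Relation.Unary.Any using (here; there)
open import Data.List.Relation.Unary.Unique.Propositional using (Unique)
open import Data.List.Relation.Unary.Unique.Propositional.Properties using (cartesianProduct⁺; allFin⁺)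
open import Data.Maybe.Base using (Maybe; just; nothing)
import Data.Nat.Base as ℕ
open import Data.Nat.Base using (ℕ; zero; suc)
import Data.Nat.DivMod as ℕ
import Data.Nat.Properties as ℕ
open import Data.Product.Base using (∃; ∃-syntax; _×_; _,_; proj₁; proj₂; Σ-syntax)
open import Data.Sum.Base using (_⊎_; inj₁; inj₂)
import Data.Vec.Base as Vec
open import Data.Vec.Base using ([]; _∷_)
import Data.Vec.Properties as Vec
open import Function.Base using (_∘_; id)
open import Relation.Binary.Bundles using (TotalOrder)
open import Relation.Binary.Definitions using (Tri; tri<; tri≈; tri>)
import Relation.Binary.Properties.TotalOrder as TotalOrderProperties
open import Relation.Binary.PropositionalEquality as ≡ using (_≡_; _≢_)
import Relation.Binary.Reasoning.PartialOrder as PosetReasoning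
open import Relation.Nullary.Decidable.Core using (Dec; yes; no; does; _×-dec_; ⌊_⌋; toWitness; fromWitness; ¬?)
open import Relation.Nullary.Negation.Core using (¬_; contradiction)
open import Relation.Unary using (Pred; Decidable)
open import Data.List.Relation.Unary.Unique.DecPropositional.Properties ℕ._≟_ using (deduplicate-!)

-- For `ev` and `ee` the Lagrangian maximises a minimum over the support of x, and the support
-- jumps. Both bounds therefore use the inequality d ≤ `deg x m` for all `m` of positive weight;
-- multiplied by the weight it is a closed condition, so the maximum exists and errors may tend to
-- 0. Only the colouring knows an order of the vertices; the density conditions ignore it. In the
-- lower bound every test is split by the six orders of a triple, and the factor saying u < v is
-- part of the kernel whose cut norm is controlled. In the upper bound disjoint ordered parts turn a
-- class of ordered pairs into a legal set of unordered pairs. The Lagrangian uses one vector in all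
-- three slots, while three pairs of parts may have three density vectors; Ramsey's theorem for the
-- rounded vectors repairs this. The density condition holds only up to η n³, so the triad must fill
-- a share of all triples that is known beforehand: the number of parts and their shrinking depend
-- on the palette and the accuracy alone, and η is chosen last.

module _ (em : ExcludedMiddle 0ℓ) (ℝ : CompleteOrderedField) where

  -- Arithmetic in a complete ordered field

  module OrderedField where

    open CompleteOrderedField ℝ public
    open CommutativeRing commutativeRing public
      using (semiring; ring; +-cong; +-congˡ; +-congʳ; *-cong; *-congˡ; *-congʳ; -‿cong;
             +-comm; +-assoc; +-identityˡ; +-identityʳ; *-comm; *-assoc; *-identityˡ; *-identityʳ;
             distribˡ; distribʳ; zeroˡ; zeroʳ; -‿inverseʳ; -‿inverseˡ)
      renaming (refl to ≈-refl; sym to ≈-sym; trans to ≈-trans; reflexive to ≈-reflexive)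
    open TotalOrder totalOrder public
      using (total; poset)
      renaming (refl to ≤-refl; reflexive to ≤-reflexive; trans to ≤-trans; antisym to ≤-antisym;
                ≤-respˡ-≈ to ≤-respˡ; ≤-respʳ-≈ to ≤-respʳ)
    open TotalOrderProperties totalOrder public
      using (≰⇒>; ≰⇒≥; <-respʳ-≈)
    open RingProperties ring public
      using (-‿distribˡ-*; -‿distribʳ-*; -‿involutive; -0#≈0#; -‿+-comm)
    module ≤R = PosetReasoning poset

    private
      module M = SemiringMult semiring
      module M′ = SemiringMult′ semiring

      -- Integer coefficients let the ring solver cancel terms although equality of reals is
      -- undecidable. With the optimised multiples its constants 1, 2, 3 evaluate to `1#`, `2#`,
      -- `3#` definitionally.
      ⟦_⟧ℤ : ℤ → Carrier
      ⟦ + n ⟧ℤ      = n M′.× 1#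
      ⟦ -[1+ n ] ⟧ℤ = - (suc n M′.× 1#)

      ⟦-⟧ℤ : ∀ i → ⟦ ℤ.- i ⟧ℤ ≈ - ⟦ i ⟧ℤ
      ⟦-⟧ℤ (+ zero)  = ≈-sym -0#≈0#
      ⟦-⟧ℤ (+ suc n) = ≈-refl
      ⟦-⟧ℤ -[1+ n ]  = ≈-sym (-‿involutive _)

      cancel-1+ : ∀ x y → x - y ≈ (1# + x) - (1# + y)
      cancel-1+ x y = ≈-sym (≈-trans (+-cong (+-comm 1# x) (≈-trans (-‿cong (+-comm 1# y)) (≈-sym (-‿+-comm y 1#))))
        (≈-trans (+-assoc x 1# _) (+-congˡ (≈-trans (+-congˡ (+-comm (- y) (- 1#)))
        (≈-trans (≈-sym (+-assoc 1# (- 1#) (- y))) (≈-trans (+-congʳ (-‿inverseʳ 1#)) (+-identityˡ (- y))))))))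

      ⟦⊖⟧ℤ : ∀ m n → ⟦ m ℤ.⊖ n ⟧ℤ ≈ (m M′.× 1#) - (n M′.× 1#)
      ⟦⊖⟧ℤ m zero = ≈-sym (≈-trans (+-congˡ -0#≈0#) (+-identityʳ _))
      ⟦⊖⟧ℤ zero (suc n) = ≈-sym (+-identityˡ _)
      ⟦⊖⟧ℤ (suc m) (suc n) rewrite ℤ.[1+m]⊖[1+n]≡m⊖n m n =
        ≈-trans (⟦⊖⟧ℤ m n) (≈-trans (cancel-1+ _ _) (+-cong (≈-sym (M′.1+× m 1#)) (-‿cong (≈-sym (M′.1+× n 1#)))))

      ⟦+⟧ℤ : ∀ i j → ⟦ i ℤ.+ j ⟧ℤ ≈ ⟦ i ⟧ℤ + ⟦ j ⟧ℤ
      ⟦+⟧ℤ (+ m) (+ n) = M′.×-homo-+ 1# m n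
      ⟦+⟧ℤ (+ m) -[1+ n ] = ⟦⊖⟧ℤ m (suc n)
      ⟦+⟧ℤ -[1+ m ] (+ n) = ≈-trans (⟦⊖⟧ℤ n (suc m)) (+-comm _ _)
      ⟦+⟧ℤ -[1+ m ] -[1+ n ] = ≈-trans
        (-‿cong (≈-trans (≈-reflexive (≡.cong (λ k → suc k M′.× 1#) (≡.sym (ℕ.+-suc m n)))) (M′.×-homo-+ 1# (suc m) (suc n))))
        (≈-sym (-‿+-comm _ _))

      ⟦*⟧ℤ : ∀ i j → ⟦ i ℤ.* j ⟧ℤ ≈ ⟦ i ⟧ℤ * ⟦ j ⟧ℤ
      ⟦*⟧ℤ (+ m) (+ n) rewrite ≡.sym (ℤ.pos-* m n) = M′.×1-homo-* m n
      ⟦*⟧ℤ (+ m) -[1+ n ] rewrite ≡.sym (ℤ.neg-distribʳ-* (+ m) (+ suc n)) | ≡.sym (ℤ.pos-* m (suc n)) =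
        ≈-trans (⟦-⟧ℤ (+ (m ℕ.* suc n))) (≈-trans (-‿cong (M′.×1-homo-* m (suc n))) (-‿distribʳ-* _ _))
      ⟦*⟧ℤ -[1+ m ] (+ n) rewrite ≡.sym (ℤ.neg-distribˡ-* (+ suc m) (+ n)) | ≡.sym (ℤ.pos-* (suc m) n) =
        ≈-trans (⟦-⟧ℤ (+ (suc m ℕ.* n))) (≈-trans (-‿cong (M′.×1-homo-* (suc m) n)) (-‿distribˡ-* _ _))
      ⟦*⟧ℤ -[1+ m ] -[1+ n ] = ≈-trans (M′.×1-homo-* (suc m) (suc n))
        (≈-trans (≈-sym (-‿involutive _)) (≈-trans (-‿cong (-‿distribʳ-* _ _)) (-‿distribˡ-* _ _)))

      ℤ⟶ℝ : ℤ.+-*-rawRing -Raw-AlmostCommutative⟶ fromCommutativeRing commutativeRing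
      ℤ⟶ℝ = record { ⟦_⟧ = ⟦_⟧ℤ ; +-homo = ⟦+⟧ℤ ; *-homo = ⟦*⟧ℤ ; -‿homo = ⟦-⟧ℤ ; 0-homo = ≈-refl ; 1-homo = ≈-refl }

      ℤ-weak≟ : ∀ i j → Maybe (⟦ i ⟧ℤ ≈ ⟦ j ⟧ℤ)
      ℤ-weak≟ i j with i ℤ.≟ j
      ... | yes ≡.refl = just ≈-refl
      ... | no _ = nothing

    open RingSolver ℤ.+-*-rawRing (fromCommutativeRing commutativeRing) ℤ⟶ℝ ℤ-weak≟ public
      using (solve; _:=_; _:+_; _:*_; _:-_; :-_; con; Polynomial)

    :0 :1 :2 :3 : ∀ {n} → Polynomial n
    :0 = con (+ 0)
    :1 = con (+ 1)
    :2 = con (+ 2)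
    :3 = con (+ 3)

    2# 3# : Carrier
    2# = 1# + 1#
    3# = 1# + 1# + 1#

    private
      variable
        a b c d x y z w ε : Carrier

    abstract
      <⇒≤ : x < y → x ≤ y
      <⇒≤ = proj₁

      ≮⇒≥ : ¬ (x < y) → y ≤ x
      ≮⇒≥ {x} {y} x≮y with total x y
      ... | inj₂ y≤x = y≤x
      ... | inj₁ x≤y with em {x ≈ y}
      ...   | yes eq = ≤-reflexive (≈-sym eq)
      ...   | no ne = contradiction (x≤y , ne) x≮y

      ≤-or-> : ∀ x y → x ≤ y ⊎ y < x
      ≤-or-> x y with em {x ≤ y}
      ... | yes p = inj₁ p
      ... | no p = inj₂ (≰⇒> p)

      +-mono-≤ : x ≤ y → z ≤ w → x + z ≤ y + w
      +-mono-≤ {x} {y} {z} {w} p q = ≤-trans (+-monoˡ-≤ z p)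
        (≤-respˡ (+-comm z y) (≤-respʳ (+-comm w y) (+-monoˡ-≤ y q)))

      +-monoʳ-≤ : ∀ z → x ≤ y → z + x ≤ z + y
      +-monoʳ-≤ z p = +-mono-≤ ≤-refl p

      0≤-+ : 0# ≤ x → 0# ≤ y → 0# ≤ x + y
      0≤-+ p q = ≤-respˡ (+-identityˡ 0#) (+-mono-≤ p q)

      -- Certificates for linear arithmetic: the equation is left to the ring solver.
      ≤-by : 0# ≤ z → y ≈ x + z → x ≤ y
      ≤-by {z} {y} {x} p eq = ≤-respʳ (≈-sym eq) (≤-respˡ (+-identityʳ x) (+-monoʳ-≤ x p))

      ≤-by-eq : 0# ≤ z → a ≈ b → y ≈ x + z + (a - b) → x ≤ y
      ≤-by-eq {z} {a} {b} {y} {x} p a≈b eq = ≤-by p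
        (≈-trans eq (≈-trans (+-congˡ (≈-trans (+-congʳ a≈b) (-‿inverseʳ b))) (+-identityʳ (x + z))))

      x≤y⇒0≤y-x : x ≤ y → 0# ≤ y - x
      x≤y⇒0≤y-x {x} {y} p = ≤-respˡ (-‿inverseʳ x) (+-monoˡ-≤ (- x) p)

      0≤y-x⇒x≤y : 0# ≤ y - x → x ≤ y
      0≤y-x⇒x≤y {y} {x} p = ≤-by p (solve 2 (λ x y → y := x :+ (y :- x)) ≈-refl x y)

      -‿anti-≤ : x ≤ y → - y ≤ - x
      -‿anti-≤ {x} {y} p = ≤-by (x≤y⇒0≤y-x p) (solve 2 (λ x y → :- x := :- y :+ (y :- x)) ≈-refl x y)

      ≤0⇒0≤- : x ≤ 0# → 0# ≤ - x
      ≤0⇒0≤- p = ≤-respˡ -0#≈0# (-‿anti-≤ p)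

      *-monoˡ-≤ : 0# ≤ z → x ≤ y → z * x ≤ z * y
      *-monoˡ-≤ {z} {x} {y} p q = ≤-by (*-nonNeg p (x≤y⇒0≤y-x q))
        (solve 3 (λ x y z → z :* y := z :* x :+ z :* (y :- x)) ≈-refl x y z)

      *-monoʳ-≤ : 0# ≤ z → x ≤ y → x * z ≤ y * z
      *-monoʳ-≤ p q = ≤-respˡ (*-comm _ _) (≤-respʳ (*-comm _ _) (*-monoˡ-≤ p q))

      *-mono-≤ : 0# ≤ z → 0# ≤ x → x ≤ y → z ≤ w → x * z ≤ y * w
      *-mono-≤ 0≤z 0≤x p q = ≤-trans (*-monoʳ-≤ 0≤z p) (*-monoˡ-≤ (≤-trans 0≤x p) q)

      0≤x² : ∀ x → 0# ≤ x * x
      0≤x² x with total 0# x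
      ... | inj₁ p = *-nonNeg p p
      ... | inj₂ p = ≤-respʳ (solve 1 (λ x → :- x :* :- x := x :* x) ≈-refl x) (*-nonNeg (≤0⇒0≤- p) (≤0⇒0≤- p))

      0≤1 : 0# ≤ 1#
      0≤1 = ≤-respʳ (*-identityʳ 1#) (0≤x² 1#)

      0<1 : 0# < 1#
      0<1 = 0≤1 , λ eq → 1≉0 (≈-sym eq)

      0≤2 : 0# ≤ 2#
      0≤2 = 0≤-+ 0≤1 0≤1

      0≤3 : 0# ≤ 3#
      0≤3 = 0≤-+ 0≤2 0≤1

      <-≤-trans : x < y → y ≤ z → x < z
      <-≤-trans (p , ne) q = ≤-trans p q , λ eq → ne (≤-antisym p (≤-respʳ (≈-sym eq) q))

      <⇒≉0 : 0# < x → ¬ (x ≈ 0#)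
      <⇒≉0 (_ , ne) eq = ne (≈-sym eq)

      0<-+ˡ : 0# < x → 0# ≤ y → 0# < x + y
      0<-+ˡ {x} {y} p q = <-≤-trans p (≤-by q ≈-refl)

      *-zero-product : x * y ≈ 0# → ¬ (x ≈ 0#) → y ≈ 0#
      *-zero-product {x} {y} eq ne with inverse x ne
      ... | i , xi≈1 = ≈-trans (≈-sym (*-identityˡ y)) (≈-trans (*-congʳ (≈-sym xi≈1))
        (≈-trans (solve 3 (λ x y i → x :* i :* y := i :* (x :* y)) ≈-refl x y i) (≈-trans (*-congˡ eq) (zeroʳ i))))

      0<-* : 0# < x → 0# < y → 0# < x * y
      0<-* (p , np) (q , nq) = *-nonNeg p q , λ eq → nq (≈-sym (*-zero-product (≈-sym eq) (λ e → np (≈-sym e))))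

      0<2 : 0# < 2#
      0<2 = 0<-+ˡ 0<1 0≤1

      0<3 : 0# < 3#
      0<3 = 0<-+ˡ 0<2 0≤1

      *-cancel-≤ : 0# < z → z * x ≤ z * y → x ≤ y
      *-cancel-≤ {z} {x} {y} p q with total x y
      ... | inj₁ r = r
      ... | inj₂ y≤x = ≤-reflexive (≈-sym (0-diff (*-zero-product zd (<⇒≉0 p))))
        where
        zd : z * (x - y) ≈ 0#
        zd = ≤-antisym (≤-by (x≤y⇒0≤y-x q) (solve 3 (λ x y z → :0 := z :* (x :- y) :+ (z :* y :- z :* x)) ≈-refl x y z))
                       (*-nonNeg (<⇒≤ p) (x≤y⇒0≤y-x y≤x))
        0-diff : x - y ≈ 0# → y ≈ x
        0-diff e = ≈-trans (≈-sym (+-identityˡ y)) (≈-trans (+-congʳ (≈-sym e)) (solve 2 (λ x y → x :- y :+ y := x) ≈-refl x y))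

      inverse>0 : 0# < x → ∃[ y ] (x * y ≈ 1# × 0# < y)
      inverse>0 {x} p with inverse x (<⇒≉0 p)
      ... | y , eq = y , eq , pos , λ e → 1≉0 (≈-trans (≈-sym eq) (≈-trans (*-congˡ (≈-sym e)) (zeroʳ x)))
        where
        pos : 0# ≤ y
        pos = *-cancel-≤ p (≤-respˡ (≈-sym (zeroʳ x)) (≤-respʳ (≈-sym eq) 0≤1))

      shrink : 0# < x → 0# < ε → ∃[ δ ] (0# < δ × x * δ ≈ ε)
      shrink {x} {ε} p q with inverse>0 p
      ... | y , eq , y>0 = y * ε , 0<-* y>0 q , ≈-trans (≈-sym (*-assoc x y ε)) (≈-trans (*-congʳ eq) (*-identityˡ ε))

      x²-mono⁻ : 0# ≤ y → x * x ≤ y * y → x ≤ y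
      x²-mono⁻ {y} {x} 0≤y p with ≤-or-> x y
      ... | inj₁ r = r
      ... | inj₂ (y≤x , ne) with em {x ≈ 0#}
      ...   | yes x≈0 = ≤-respˡ (≈-sym x≈0) 0≤y
      ...   | no x≉0 = *-cancel-≤ (0≤x , λ e → x≉0 (≈-sym e)) (≤-trans p (*-monoʳ-≤ 0≤y y≤x))
        where
        0≤x : 0# ≤ x
        0≤x = ≤-trans 0≤y y≤x

      x<y⇒0<y-x : x < y → 0# < y - x
      x<y⇒0<y-x {x} {y} (p , ne) = x≤y⇒0≤y-x p , λ e → ne (≈-trans (≈-sym (+-identityˡ x))
        (≈-trans (+-congʳ e) (solve 2 (λ x y → y :- x :+ x := y) ≈-refl x y)))

      private
        half-gap : x ≤ y + d → 2# * d ≈ x - y → d ≤ 0#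
        half-gap {x} {y} {d} h eq = ≤-by-eq (x≤y⇒0≤y-x h) (≈-sym eq)
          (solve 3 (λ x y δ → :0 := δ :+ (y :+ δ :- x) :+ (x :- y :- :2 :* δ)) ≈-refl x y d)

      ≤-ε : (∀ ε → 0# < ε → x ≤ y + ε) → x ≤ y
      ≤-ε {x} {y} h with ≤-or-> x y
      ... | inj₁ r = r
      ... | inj₂ y<x = let δ , δ>0 , eq = shrink 0<2 (x<y⇒0<y-x y<x) in
        contradiction (≤-antisym (<⇒≤ δ>0) (half-gap (h δ δ>0) eq)) (proj₂ δ>0)

      fromℕ-+ : ∀ m n → fromℕ (m ℕ.+ n) ≈ fromℕ m + fromℕ n
      fromℕ-+ = M.×-homo-+ 1#

      fromℕ-* : ∀ m n → fromℕ (m ℕ.* n) ≈ fromℕ m * fromℕ n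
      fromℕ-* = M.×1-homo-*

      0≤fromℕ : ∀ n → 0# ≤ fromℕ n
      0≤fromℕ zero = ≤-refl
      0≤fromℕ (suc n) = 0≤-+ 0≤1 (0≤fromℕ n)

      fromℕ-mono : ∀ {m n} → m ℕ.≤ n → fromℕ m ≤ fromℕ n
      fromℕ-mono {n = n} ℕ.z≤n = 0≤fromℕ n
      fromℕ-mono (ℕ.s≤s p) = +-monoʳ-≤ 1# (fromℕ-mono p)

      -- If the naturals were bounded, their supremum s could be lowered: n + 1 ≤ s for all n makes
      -- s - 1 an upper bound as well.
      archimedean : ∀ x → ∃[ n ] x ≤ fromℕ n
      archimedean x with em {∃[ n ] x ≤ fromℕ n}
      ... | yes p = p
      ... | no none with complete (λ y → ∃[ n ] y ≈ fromℕ n) (0# , 0 , ≈-refl)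
                           (x , λ { y (n , eq) → ≤-respˡ (≈-sym eq) (<⇒≤ (≰⇒> (λ q → none (n , q)))) })
      ...   | s , ub , lub = contradiction
        (≤-antisym 0≤1 (≤-by (x≤y⇒0≤y-x (lub (s - 1#) below)) (solve 1 (λ s → :0 := :1 :+ ((s :- :1) :- s)) ≈-refl s)))
        (proj₂ 0<1)
        where
        below : ∀ y → (∃[ n ] y ≈ fromℕ n) → y ≤ s - 1#
        below y (n , eq) = ≤-by (x≤y⇒0≤y-x (ub (fromℕ (suc n)) (suc n , ≈-refl)))
          (≈-trans (solve 2 (λ s f → s :- :1 := f :+ (s :- (:1 :+ f))) ≈-refl s (fromℕ n)) (+-congʳ (≈-sym eq)))

  open OrderedField

  -- Finite sums and indicators

  module FiniteSums where

    private
      variable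
        A B I J : Set
        x y z : Carrier
        f g h : I → Carrier
        is : List I

    ι : Bool → Carrier
    ι true  = 1#
    ι false = 0#

    𝟙 : {P : Set} → Dec P → Carrier
    𝟙 d = ι (does d)

    -- Being 0 or 1 is stated for reals up to `≈`, so that products and complements of indicators
    -- are again indicators without any reference to a decided proposition.
    Ind : Carrier → Set
    Ind x = x ≈ 0# ⊎ x ≈ 1#

    ∑ᵥ : ∀ {n} → (Fin n → Carrier) → Carrier
    ∑ᵥ {n} = ∑[ allFin n ]

    abstract

      ι-ind : ∀ b → Ind (ι b)
      ι-ind true = inj₂ ≈-refl
      ι-ind false = inj₁ ≈-refl

      ι-∧ : ∀ a b → ι (a ∧ b) ≈ ι a * ι b
      ι-∧ true b = ≈-sym (*-identityˡ _)
      ι-∧ false b = ≈-sym (zeroˡ _)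

      𝟙-× : {P Q : Set} (p : Dec P) (q : Dec Q) → 𝟙 (p ×-dec q) ≈ 𝟙 p * 𝟙 q
      𝟙-× p q = ι-∧ (does p) (does q)

      𝟙-ind : {P : Set} (p : Dec P) → Ind (𝟙 p)
      𝟙-ind p = ι-ind (does p)

      𝟙-yes : {P : Set} (p : Dec P) → P → 𝟙 p ≈ 1#
      𝟙-yes (yes _) _ = ≈-refl
      𝟙-yes (no ¬p) p = contradiction p ¬p

      𝟙-no : {P : Set} (p : Dec P) → ¬ P → 𝟙 p ≈ 0#
      𝟙-no (yes p) ¬p = contradiction p ¬p
      𝟙-no (no _) _ = ≈-refl

      𝟙-cong : {P Q : Set} (p : Dec P) (q : Dec Q) → (P → Q) → (Q → P) → 𝟙 p ≈ 𝟙 q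
      𝟙-cong (yes p) q P⇒Q Q⇒P = ≈-sym (𝟙-yes q (P⇒Q p))
      𝟙-cong (no ¬p) q P⇒Q Q⇒P = ≈-sym (𝟙-no q (λ r → ¬p (Q⇒P r)))

      𝟙-mono : {P Q : Set} (p : Dec P) (q : Dec Q) → (P → Q) → 𝟙 p ≤ 𝟙 q
      𝟙-mono (yes p) q P⇒Q = ≤-reflexive (≈-sym (𝟙-yes q (P⇒Q p)))
      𝟙-mono (no ¬p) (yes q) P⇒Q = 0≤1
      𝟙-mono (no ¬p) (no q) P⇒Q = ≤-refl

      ind-≥0 : Ind x → 0# ≤ x
      ind-≥0 (inj₁ e) = ≤-reflexive (≈-sym e)
      ind-≥0 (inj₂ e) = ≤-respʳ (≈-sym e) 0≤1

      ind-≤1 : Ind x → x ≤ 1#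
      ind-≤1 (inj₁ e) = ≤-respˡ (≈-sym e) 0≤1
      ind-≤1 (inj₂ e) = ≤-reflexive e

      ind-1 : Ind 1#
      ind-1 = inj₂ ≈-refl

      ind-* : Ind x → Ind y → Ind (x * y)
      ind-* (inj₁ e) q = inj₁ (≈-trans (*-congʳ e) (zeroˡ _))
      ind-* (inj₂ e) (inj₁ f) = inj₁ (≈-trans (*-congˡ f) (zeroʳ _))
      ind-* (inj₂ e) (inj₂ f) = inj₂ (≈-trans (*-cong e f) (*-identityˡ _))

      ind-not : Ind x → Ind (1# - x)
      ind-not (inj₁ e) = inj₂ (≈-trans (+-congˡ (-‿cong e)) (solve 0 (:1 :- :0 := :1) ≈-refl))
      ind-not (inj₂ e) = inj₁ (≈-trans (+-congˡ (-‿cong e)) (-‿inverseʳ 1#))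

      ind-idem : Ind x → x * x ≈ x
      ind-idem (inj₁ e) = ≈-trans (*-cong e e) (≈-trans (zeroˡ 0#) (≈-sym e))
      ind-idem (inj₂ e) = ≈-trans (*-cong e e) (≈-trans (*-identityˡ 1#) (≈-sym e))

      ind-cong : x ≈ y → Ind x → Ind y
      ind-cong e (inj₁ p) = inj₁ (≈-trans (≈-sym e) p)
      ind-cong e (inj₂ p) = inj₂ (≈-trans (≈-sym e) p)

      ∑-cong-∈ : (is : List I) → (∀ i → i ∈ is → f i ≈ g i) → ∑[ is ] f ≈ ∑[ is ] g
      ∑-cong-∈ [] e = ≈-refl
      ∑-cong-∈ (i ∷ is) e = +-cong (e i (here ≡.refl)) (∑-cong-∈ is (λ j p → e j (there p)))

      ∑-cong : (is : List I) → (∀ i → f i ≈ g i) → ∑[ is ] f ≈ ∑[ is ] g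
      ∑-cong is e = ∑-cong-∈ is (λ i _ → e i)

      ∑-mono-∈ : (is : List I) → (∀ i → i ∈ is → f i ≤ g i) → ∑[ is ] f ≤ ∑[ is ] g
      ∑-mono-∈ [] e = ≤-refl
      ∑-mono-∈ (i ∷ is) e = +-mono-≤ (e i (here ≡.refl)) (∑-mono-∈ is (λ j p → e j (there p)))

      ∑-mono : (is : List I) → (∀ i → f i ≤ g i) → ∑[ is ] f ≤ ∑[ is ] g
      ∑-mono is e = ∑-mono-∈ is (λ i _ → e i)

      ∑-zero : (is : List I) → ∑[ is ] (λ _ → 0#) ≈ 0#
      ∑-zero [] = ≈-refl
      ∑-zero (i ∷ is) = ≈-trans (+-identityˡ _) (∑-zero is)

      ∑-≥0-∈ : (is : List I) → (∀ i → i ∈ is → 0# ≤ f i) → 0# ≤ ∑[ is ] f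
      ∑-≥0-∈ is p = ≤-respˡ (∑-zero is) (∑-mono-∈ is p)

      ∑-≥0 : (is : List I) → (∀ i → 0# ≤ f i) → 0# ≤ ∑[ is ] f
      ∑-≥0 is p = ∑-≥0-∈ is (λ i _ → p i)

      ∑-+ : (is : List I) (f g : I → Carrier) → ∑[ is ] (λ i → f i + g i) ≈ ∑[ is ] f + ∑[ is ] g
      ∑-+ [] f g = ≈-sym (+-identityˡ 0#)
      ∑-+ (i ∷ is) f g = ≈-trans (+-congˡ (∑-+ is f g))
        (solve 4 (λ a b c d → a :+ b :+ (c :+ d) := a :+ c :+ (b :+ d)) ≈-refl (f i) (g i) _ _)

      ∑-neg : (is : List I) (f : I → Carrier) → ∑[ is ] (λ i → - f i) ≈ - ∑[ is ] f
      ∑-neg [] f = ≈-sym -0#≈0#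
      ∑-neg (i ∷ is) f = ≈-trans (+-congˡ (∑-neg is f)) (-‿+-comm _ _)

      ∑-- : (is : List I) (f g : I → Carrier) → ∑[ is ] (λ i → f i - g i) ≈ ∑[ is ] f - ∑[ is ] g
      ∑-- is f g = ≈-trans (∑-+ is f (λ i → - g i)) (+-congˡ (∑-neg is g))

      ∑-*ˡ : (is : List I) (c : Carrier) (f : I → Carrier) → ∑[ is ] (λ i → c * f i) ≈ c * ∑[ is ] f
      ∑-*ˡ [] c f = ≈-sym (zeroʳ c)
      ∑-*ˡ (i ∷ is) c f = ≈-trans (+-congˡ (∑-*ˡ is c f)) (≈-sym (distribˡ c _ _))

      ∑-*ʳ : (is : List I) (c : Carrier) (f : I → Carrier) → ∑[ is ] (λ i → f i * c) ≈ ∑[ is ] f * c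
      ∑-*ʳ is c f = ≈-trans (∑-cong is (λ i → *-comm (f i) c)) (≈-trans (∑-*ˡ is c f) (*-comm c _))

      ∑-const : (is : List I) (c : Carrier) → ∑[ is ] (λ _ → c) ≈ fromℕ (length is) * c
      ∑-const [] c = ≈-sym (zeroˡ c)
      ∑-const (i ∷ is) c = ≈-trans (+-congˡ (∑-const is c))
        (solve 2 (λ n c → c :+ n :* c := (:1 :+ n) :* c) ≈-refl (fromℕ (length is)) c)

      ∑-≤const : (is : List I) (c : Carrier) → (∀ i → f i ≤ c) → ∑[ is ] f ≤ fromℕ (length is) * c
      ∑-≤const is c p = ≤-respʳ (∑-const is c) (∑-mono is p)

      ∑-comm : (is : List I) (js : List J) (f : I → J → Carrier) →
        ∑[ is ] (λ i → ∑[ js ] (f i)) ≈ ∑[ js ] (λ j → ∑[ is ] (λ i → f i j))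
      ∑-comm [] js f = ≈-sym (∑-zero js)
      ∑-comm (i ∷ is) js f = ≈-trans (+-congˡ (∑-comm is js f)) (≈-sym (∑-+ js (f i) _))

      ∑-++ : (is js : List I) (f : I → Carrier) → ∑[ is ++ js ] f ≈ ∑[ is ] f + ∑[ js ] f
      ∑-++ [] js f = ≈-sym (+-identityˡ _)
      ∑-++ (i ∷ is) js f = ≈-trans (+-congˡ (∑-++ is js f)) (≈-sym (+-assoc _ _ _))

      ∑-map : (k : J → I) (js : List J) (f : I → Carrier) → ∑[ map k js ] f ≈ ∑[ js ] (f ∘ k)
      ∑-map k [] f = ≈-refl
      ∑-map k (j ∷ js) f = +-congˡ (∑-map k js f)

      ∑-cartesianProduct : (is : List I) (js : List J) (f : I × J → Carrier) →
        ∑[ cartesianProduct is js ] f ≈ ∑[ is ] (λ i → ∑[ js ] (λ j → f (i , j)))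
      ∑-cartesianProduct [] js f = ≈-refl
      ∑-cartesianProduct (i ∷ is) js f = ≈-trans (∑-++ (map (i ,_) js) _ f)
        (+-cong (∑-map (i ,_) js f) (∑-cartesianProduct is js f))

      ∑-filter : {P : Pred I 0ℓ} (P? : Decidable P) (is : List I) (f : I → Carrier) →
        ∑[ filter P? is ] f ≈ ∑[ is ] (λ i → 𝟙 (P? i) * f i)
      ∑-filter P? [] f = ≈-refl
      ∑-filter P? (i ∷ is) f with does (P? i)
      ... | true = +-cong (≈-sym (*-identityˡ _)) (∑-filter P? is f)
      ... | false = ≈-trans (∑-filter P? is f) (≈-sym (≈-trans (+-congʳ (zeroˡ _)) (+-identityˡ _)))

      fromℕ-count : {P : Pred I 0ℓ} (P? : Decidable P) (is : List I) →
        fromℕ (#[ is ] P?) ≈ ∑[ is ] (λ i → 𝟙 (P? i))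
      fromℕ-count P? [] = ≈-refl
      fromℕ-count P? (i ∷ is) with does (P? i)
      ... | true = +-congˡ (fromℕ-count P? is)
      ... | false = ≈-trans (fromℕ-count P? is) (≈-sym (+-identityˡ _))

      ∑-term-≤ : (is : List I) → (∀ i → 0# ≤ f i) → ∀ {i} → i ∈ is → f i ≤ ∑[ is ] f
      ∑-term-≤ (i ∷ is) p (here ≡.refl) = ≤-by (∑-≥0 is p) ≈-refl
      ∑-term-≤ (j ∷ is) p (there q) = ≤-trans (∑-term-≤ is p q) (≤-by (p j) (+-comm _ _))

      ∑-dirac-∉ : (d : ∀ (i j : I) → Dec (i ≡ j)) (is : List I) (f : I → Carrier) {a : I} →
        All.All (a ≢_) is → ∑[ is ] (λ i → 𝟙 (d i a) * f i) ≈ 0#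
      ∑-dirac-∉ d [] f p = ≈-refl
      ∑-dirac-∉ d (i ∷ is) f (p All.∷ ps) = ≈-trans
        (+-cong (≈-trans (*-congʳ (𝟙-no (d i _) (λ e → p (≡.sym e)))) (zeroˡ _)) (∑-dirac-∉ d is f ps)) (+-identityˡ 0#)

      ∑-dirac : (d : ∀ (i j : I) → Dec (i ≡ j)) {is : List I} (f : I → Carrier) {a : I} →
        Unique is → a ∈ is → ∑[ is ] (λ i → 𝟙 (d i a) * f i) ≈ f a
      ∑-dirac d f (p ∷ u) (here ≡.refl) = ≈-trans
        (+-cong (≈-trans (*-congʳ (𝟙-yes (d _ _) ≡.refl)) (*-identityˡ _)) (∑-dirac-∉ d _ f p)) (+-identityʳ _)
      ∑-dirac d {i ∷ is} f {a} (p ∷ u) (there q) = ≈-trans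
        (+-cong (≈-trans (*-congʳ (𝟙-no (d _ _) (λ { ≡.refl → All.lookup p q ≡.refl }))) (zeroˡ _)) (∑-dirac d f u q))
          (+-identityˡ _)

      ∑-dirac-≤1 : (d : ∀ (i j : I) → Dec (i ≡ j)) {is : List I} (a : I) → Unique is → ∑[ is ] (λ i → 𝟙 (d i a)) ≤ 1#
      ∑-dirac-≤1 d {[]} a [] = 0≤1
      ∑-dirac-≤1 d {i ∷ is} a (p ∷ u) with d i a
      ... | yes ≡.refl = ≤-reflexive (≈-trans (+-congˡ (≈-trans
              (∑-cong is (λ j → ≈-sym (*-identityʳ _))) (∑-dirac-∉ d is (λ _ → 1#) p))) (+-identityʳ _))
      ... | no _ = ≤-respˡ (≈-sym (+-identityˡ _)) (∑-dirac-≤1 d a u)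

      -- Each f i is written as a Dirac sum over `js`. After the sums are exchanged, every j is hit
      -- at most once because `is` has no repetitions, and the terms are nonnegative.
      ∑-sub-unique : (d : ∀ (i j : I) → Dec (i ≡ j)) {is js : List I} (f : I → Carrier) → (∀ i → 0# ≤ f i) →
        Unique is → Unique js → (∀ {i} → i ∈ is → i ∈ js) → ∑[ is ] f ≤ ∑[ js ] f
      ∑-sub-unique d {is} {js} f f≥0 u v sub = begin
        ∑[ is ] f                                        ≈⟨ ∑-cong-∈ is (λ i p → ≈-sym (∑-dirac d f v (sub p))) ⟩
        ∑[ is ] (λ i → ∑[ js ] (λ j → 𝟙 (d j i) * f j)) ≈⟨ ∑-comm is js _ ⟩
        ∑[ js ] (λ j → ∑[ is ] (λ i → 𝟙 (d j i) * f j)) ≈⟨ ∑-cong js (λ j → ∑-*ʳ is (f j) _) ⟩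
        ∑[ js ] (λ j → ∑[ is ] (λ i → 𝟙 (d j i)) * f j) ≤⟨ ∑-mono js (λ j → ≤-respʳ (*-identityˡ (f j)) (*-monoʳ-≤ (f≥0 j)
            (≤-respˡ (∑-cong is (λ i → 𝟙-cong (d i j) (d j i) ≡.sym ≡.sym)) (∑-dirac-≤1 d j u)))) ⟩
        ∑[ js ] f                                        ∎
        where open ≤R

      ∑ᵥ-suc : ∀ {n} (f : Fin (suc n) → Carrier) → ∑ᵥ f ≈ f Fin.zero + ∑ᵥ (f ∘ Fin.suc)
      ∑ᵥ-suc {n} f = +-congˡ (≈-trans (≈-reflexive (≡.cong (λ l → ∑[ l ] f) (≡.sym (List.map-tabulate id Fin.suc))))
        (∑-map Fin.suc (allFin n) f))

      length-allFin : ∀ n → length (allFin n) ≡ n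
      length-allFin n = List.length-tabulate id

      ∑-double : (is : List I) (js : List J) (f : I → Carrier) (g : J → Carrier) →
        ∑[ is ] f * ∑[ js ] g ≈ ∑[ is ] (λ i → ∑[ js ] (λ j → f i * g j))
      ∑-double is js f g = ≈-trans (≈-sym (∑-*ʳ is _ f)) (∑-cong is (λ i → ≈-sym (∑-*ˡ js (f i) g)))

      -- The sum of (f i - f j)² over all ordered pairs is nonnegative and equals twice the
      -- difference of the two sides.
      ∑-cauchy-schwarz : (is : List I) (f : I → Carrier) → ∑[ is ] f * ∑[ is ] f ≤ fromℕ (length is) * ∑[ is ] (λ i → f i * f i)
      ∑-cauchy-schwarz is f = *-cancel-≤ 0<2 (0≤y-x⇒x≤y (≤-respʳ eq (∑-≥0 is (λ i → ∑-≥0 is (λ j → 0≤x² (f i - f j))))))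
        where
        N F Q : Carrier
        N = fromℕ (length is)
        F = ∑[ is ] f
        Q = ∑[ is ] (λ i → f i * f i)
        inner : ∀ i → ∑[ is ] (λ j → (f i - f j) * (f i - f j)) ≈ N * (f i * f i) - 2# * F * f i + Q
        inner i = ≈-trans (∑-cong is (λ j → solve 2
          (λ a b → (a :- b) :* (a :- b) := a :* a :+ :- (:2 :* a) :* b :+ b :* b) ≈-refl (f i) (f j)))
          (≈-trans (∑-+ is _ _) (+-congʳ (≈-trans (∑-+ is _ _)
            (+-cong (∑-const is (f i * f i)) (≈-trans (∑-*ˡ is (- (2# * f i)) f)
              (solve 2 (λ a F → :- (:2 :* a) :* F := :- (:2 :* F :* a)) ≈-refl (f i) F))))))
        eq : ∑[ is ] (λ i → ∑[ is ] (λ j → (f i - f j) * (f i - f j))) ≈ 2# * (N * Q) - 2# * (F * F)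
        eq = ≈-trans (∑-cong is inner) (≈-trans (∑-+ is _ _) (≈-trans
          (+-cong (≈-trans (∑-- is _ _) (+-cong (∑-*ˡ is N _) (-‿cong (∑-*ˡ is (2# * F) f)))) (∑-const is Q))
          (solve 3 (λ N Q F → N :* Q :- :2 :* F :* F :+ N :* Q := :2 :* (N :* Q) :- :2 :* (F :* F)) ≈-refl N Q F)))

  open FiniteSums

  -- Compactness of the unit cube and Lipschitz functions

  module Compactness where

    private
      variable
        I : Set
        x y z ε δ : Carrier

    -- Two one-sided inequalities take the place of an absolute value; this keeps every estimate
    -- within linear arithmetic.
    record Near (ε x t : Carrier) : Set where
      constructor _&_
      field
        below : x ≤ t + ε
        above : t ≤ x + ε

    open Near public

    abstract
      ≤+ : 0# ≤ ε → x ≤ x + ε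
      ≤+ p = ≤-by p ≈-refl

      near-mono : ε ≤ δ → Near ε x y → Near δ x y
      near-mono p (q & r) = ≤-trans q (+-monoʳ-≤ _ p) & ≤-trans r (+-monoʳ-≤ _ p)

      ⊓-pos : 0# < x → 0# < y → ∃[ z ] (0# < z × z ≤ x × z ≤ y)
      ⊓-pos {x} {y} p q with total x y
      ... | inj₁ r = x , p , ≤-refl , r
      ... | inj₂ r = y , q , r , ≤-refl

      private
        x-ε<x : 0# < ε → ¬ (x ≤ x - ε)
        x-ε<x {ε} {x} p q = proj₂ p (≤-antisym (<⇒≤ p)
          (≤-by (x≤y⇒0≤y-x q) (solve 2 (λ x ε → :0 := ε :+ (x :- ε :- x)) ≈-refl x ε)))

        ≤x-ε : x - ε ≤ y → x ≤ y + ε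
        ≤x-ε {x} {ε} {y} p = ≤-by (x≤y⇒0≤y-x p) (solve 3 (λ x y ε → y :+ ε := x :+ (y :- (x :- ε))) ≈-refl x y ε)

      not-all-pos : {P : Carrier → Set} → ¬ (∀ ε → 0# < ε → P ε) → ∃[ ε ] (0# < ε × ¬ P ε)
      not-all-pos {P} h with em {∃[ ε ] (0# < ε × ¬ P ε)}
      ... | yes p = p
      ... | no none = contradiction (λ ε p → helper ε p em) h
        where
        helper : ∀ ε → 0# < ε → Dec (P ε) → P ε
        helper ε p (yes q) = q
        helper ε p (no q) = contradiction (ε , p , q) none

      -- The limit is an upper limit: `s` is the supremum of those u that are reached by some point
      -- of `Q ε` for every ε. A value just below `s` is always reached, a value above `s` fails at
      -- some accuracy.
      cluster-coordinate : (Q : Carrier → (ℕ → Carrier) → Set) (a : ℕ) →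
        (∀ ε δ f → ε ≤ δ → Q ε f → Q δ f) → (∀ ε f → Q ε f → 0# ≤ f a × f a ≤ 1#) →
        (∀ ε → 0# < ε → ∃[ f ] Q ε f) →
        ∃[ s ] (∀ ε → 0# < ε → ∃[ f ] (Q ε f × Near ε (f a) s))
      cluster-coordinate Q a mono box ne = s , near
        where
        S : Carrier → Set
        S u = ∀ ε → 0# < ε → ∃[ f ] (Q ε f × u ≤ f a)
        sup : ∃ (IsSupremum _≤_ S)
        sup = complete S (0# , λ ε p → let f , q = ne ε p in f , q , proj₁ (box ε f q))
          (1# , λ u h → let f , q , r = h 1# 0<1 in ≤-trans r (proj₂ (box 1# f q)))
        s : Carrier
        s = proj₁ sup
        approach : ∀ ε → 0# < ε → ∃[ u ] (S u × s - ε ≤ u)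
        approach ε p with em {∃[ u ] (S u × s - ε ≤ u)}
        ... | yes q = q
        ... | no none = contradiction (proj₂ (proj₂ sup) (s - ε) (λ u h → <⇒≤ (≰⇒> (λ r → none (u , h , r))))) (x-ε<x p)
        near : ∀ ε → 0# < ε → ∃[ f ] (Q ε f × Near ε (f a) s)
        -- The value s + ε is out of reach from some accuracy ε₀ on; a point finer than both ε and
        -- ε₀ that reaches s - ε is therefore within ε of `s`.
        near ε p =
          let u , Su , su = approach ε p
              ε₀ , ε₀>0 , none = not-all-pos {λ δ → ∃[ f ] (Q δ f × s + ε ≤ f a)}
                (λ h → x-ε<x p (exceed (proj₁ (proj₂ sup) (s + ε) h)))
              ε₁ , ε₁>0 , ε₁≤ε , ε₁≤ε₀ = ⊓-pos p ε₀>0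
              f , q , r = Su ε₁ ε₁>0
          in f , mono ε₁ ε f ε₁≤ε q , <⇒≤ (≰⇒> (λ v → none (f , mono ε₁ ε₀ f ε₁≤ε₀ q , v))) & ≤x-ε (≤-trans su r)
          where
          exceed : s + ε ≤ s → s ≤ s - ε
          exceed h = ≤-by (x≤y⇒0≤y-x h) (solve 2 (λ s ε → s :- ε := s :+ (s :- (s :+ ε))) ≈-refl s ε)

      extend : ℕ → Carrier → (ℕ → Carrier) → ℕ → Carrier
      extend a s t b with b ℕ.≟ a
      ... | yes _ = s
      ... | no _ = t b

      extend-near : ∀ a L s (t f : ℕ → Carrier) ε → Near ε (f a) s → (∀ b → b ∈ L → Near ε (f b) (t b)) →
        ∀ b → b ∈ a ∷ L → Near ε (f b) (extend a s t b)
      extend-near a L s t f ε r v b p with b ℕ.≟ a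
      extend-near a L s t f ε r v b p | yes ≡.refl = r
      extend-near a L s t f ε r v b (here e) | no ne = contradiction e ne
      extend-near a L s t f ε r v b (there p) | no ne = v b p

      -- Bolzano-Weierstrass one coordinate at a time. Closeness to the limits already found becomes
      -- part of the predicate for the remaining coordinates, which avoids subsequences.
      cluster-point : (L : List ℕ) (Q : Carrier → (ℕ → Carrier) → Set) →
        (∀ ε δ f → ε ≤ δ → Q ε f → Q δ f) → (∀ ε f → Q ε f → ∀ a → a ∈ L → 0# ≤ f a × f a ≤ 1#) →
        (∀ ε → 0# < ε → ∃[ f ] Q ε f) →
        Σ[ t ∈ (ℕ → Carrier) ] (∀ ε → 0# < ε → ∃[ f ] (Q ε f × (∀ a → a ∈ L → Near ε (f a) (t a))))
      cluster-point [] Q mono box ne = (λ _ → 0#) , λ ε p → proj₁ (ne ε p) , proj₂ (ne ε p) , λ a ()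
      cluster-point (a ∷ L) Q mono box ne =
        extend a s t , λ ε p → pack ε (proj₂ rest ε p)
        where
        first : ∃[ s ] (∀ ε → 0# < ε → ∃[ f ] (Q ε f × Near ε (f a) s))
        first = cluster-coordinate Q a mono (λ ε f q → box ε f q a (here ≡.refl)) ne
        Q′ : Carrier → (ℕ → Carrier) → Set
        Q′ ε f = Q ε f × Near ε (f a) (proj₁ first)
        s : Carrier
        s = proj₁ first
        rest : Σ[ t ∈ (ℕ → Carrier) ] (∀ ε → 0# < ε → ∃[ f ] (Q′ ε f × (∀ b → b ∈ L → Near ε (f b) (t b))))
        rest = cluster-point L Q′ (λ ε δ f p (q , r) → mono ε δ f p q , near-mono p r)
          (λ ε f (q , _) b p → box ε f q b (there p)) (proj₂ first)
        t : ℕ → Carrier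
        t = proj₁ rest
        pack : ∀ ε → ∃[ f ] (Q′ ε f × (∀ b → b ∈ L → Near ε (f b) (t b))) →
          ∃[ f ] (Q ε f × (∀ b → b ∈ a ∷ L → Near ε (f b) (extend a s t b)))
        pack ε (f , (q , r) , v) = f , q , extend-near a L s t f ε r v

    Boxed : List ℕ → (ℕ → Carrier) → Set
    Boxed L x = ∀ a → a ∈ L → 0# ≤ x a × x a ≤ 1#

    -- One constant is both a bound and a Lipschitz constant. Carrying both facts makes the class
    -- closed under products, so it contains the polynomials `weight` and `deg`.
    record Lipschitz (L : List ℕ) (f : (ℕ → Carrier) → Carrier) : Set where
      field
        slope     : Carrier
        f≥0       : ∀ {x} → Boxed L x → 0# ≤ f x
        f≤slope       : ∀ {x} → Boxed L x → f x ≤ slope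
        lipschitz : ∀ {x t δ} → Boxed L x → Boxed L t → 0# ≤ δ → (∀ a → a ∈ L → Near δ (x a) (t a)) → f x ≤ f t + slope * δ

    open Lipschitz public

    abstract
      boxed-sym : ∀ {L} {x t : ℕ → Carrier} → (∀ a → a ∈ L → Near δ (x a) (t a)) → (∀ a → a ∈ L → Near δ (t a) (x a))
      boxed-sym h a p = above (h a p) & below (h a p)

      zero-lip : ∀ {L} → Lipschitz L (λ _ → 0#)
      zero-lip .slope = 0#
      zero-lip .f≥0 _ = ≤-refl
      zero-lip .f≤slope _ = ≤-refl
      zero-lip .lipschitz _ _ _ _ = ≤-reflexive (≈-sym (≈-trans (+-identityˡ _) (zeroˡ _)))

      ind-lip : ∀ {L} → Ind x → Lipschitz L (λ _ → x)
      ind-lip i .slope = 1#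
      ind-lip i .f≥0 _ = ind-≥0 i
      ind-lip i .f≤slope _ = ind-≤1 i
      ind-lip i .lipschitz _ _ p _ = ≤+ (≤-respʳ (≈-sym (*-identityˡ _)) p)

      coordinate-lip : ∀ {L a} → a ∈ L → Lipschitz L (λ x → x a)
      coordinate-lip p .slope = 1#
      coordinate-lip p .f≥0 b = proj₁ (b _ p)
      coordinate-lip p .f≤slope b = proj₂ (b _ p)
      coordinate-lip p .lipschitz _ _ _ n = ≤-respʳ (+-congˡ (≈-sym (*-identityˡ _))) (below (n _ p))

      +-lip : ∀ {L f g} → Lipschitz L f → Lipschitz L g → Lipschitz L (λ x → f x + g x)
      +-lip F G .slope = F .slope + G .slope
      +-lip F G .f≥0 b = 0≤-+ (F .f≥0 b) (G .f≥0 b)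
      +-lip F G .f≤slope b = +-mono-≤ (F .f≤slope b) (G .f≤slope b)
      +-lip {f = f} {g} F G .lipschitz {x} {t} {δ} b b′ p n = ≤-respʳ
        (solve 5 (λ f g K L δ → f :+ K :* δ :+ (g :+ L :* δ) := f :+ g :+ (K :+ L) :* δ) ≈-refl (f t) (g t) (F .slope)
          (G .slope) δ)
        (+-mono-≤ (F .lipschitz b b′ p n) (G .lipschitz b b′ p n))

      -- The factors are moved one after the other; each move costs the slope of one factor times
      -- the bound of the other, which explains the 2 in the slope.
      *-lip : ∀ {L f g} → Lipschitz L f → Lipschitz L g → Lipschitz L (λ x → f x * g x)
      *-lip F G .slope = 2# * (F .slope * G .slope)
      *-lip F G .f≥0 b = *-nonNeg (F .f≥0 b) (G .f≥0 b)
      *-lip {f = f} {g} F G .f≤slope {x} b = ≤-trans (*-mono-≤ (G .f≥0 b) (F .f≥0 b) (F .f≤slope b) (G .f≤slope b))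
        (≤-by (*-nonNeg (≤-trans (F .f≥0 b) (F .f≤slope b)) (≤-trans (G .f≥0 b) (G .f≤slope b)))
          (solve 1 (λ a → :2 :* a := a :+ a) ≈-refl _))
      *-lip {f = f} {g} F G .lipschitz {x} {t} {δ} b b′ p n = begin
        f x * g x                                  ≤⟨ *-monoʳ-≤ (G .f≥0 b) (F .lipschitz b b′ p n) ⟩
        (f t + F .slope * δ) * g x                     ≈⟨ distribʳ _ _ _ ⟩
        f t * g x + F .slope * δ * g x                 ≤⟨ +-mono-≤ (*-monoˡ-≤ (F .f≥0 b′) (G .lipschitz b b′ p n))
          (*-monoˡ-≤ Kδ≥0 (G .f≤slope b)) ⟩
        f t * (g t + G .slope * δ) + F .slope * δ * G .slope   ≈⟨ solve 5
          (λ f g K L δ → f :* (g :+ L :* δ) :+ K :* δ :* L := f :* g :+ (f :* (L :* δ) :+ K :* (L :* δ))) ≈-refl (f t)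
          (g t) (F .slope) (G .slope) δ ⟩
        f t * g t + (f t * (G .slope * δ) + F .slope * (G .slope * δ)) ≤⟨ +-monoʳ-≤ _
          (+-mono-≤ (*-monoʳ-≤ Lδ≥0 (F .f≤slope b′)) ≤-refl) ⟩
        f t * g t + (F .slope * (G .slope * δ) + F .slope * (G .slope * δ)) ≈⟨ solve 4
          (λ a K L δ → a :+ (K :* (L :* δ) :+ K :* (L :* δ)) := a :+ :2 :* (K :* L) :* δ) ≈-refl _ (F .slope) (G .slope) δ ⟩
        f t * g t + 2# * (F .slope * G .slope) * δ         ∎
        where
        open ≤R
        Kδ≥0 : 0# ≤ F .slope * δ
        Kδ≥0 = *-nonNeg (≤-trans (F .f≥0 b) (F .f≤slope b)) p
        Lδ≥0 : 0# ≤ G .slope * δ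
        Lδ≥0 = *-nonNeg (≤-trans (G .f≥0 b) (G .f≤slope b)) p

      ∑-lip : ∀ {L} (is : List I) {F : I → (ℕ → Carrier) → Carrier} →
        (∀ i → i ∈ is → Lipschitz L (F i)) → Lipschitz L (λ x → ∑[ is ] (λ i → F i x))
      ∑-lip [] h = zero-lip
      ∑-lip (i ∷ is) h = +-lip (h i (here ≡.refl)) (∑-lip is (λ j p → h j (there p)))

      slope-≥0 : ∀ {L f} (F : Lipschitz L f) → ∃ (Boxed L) → 0# ≤ F .slope
      slope-≥0 F (x , b) = ≤-trans (F .f≥0 b) (F .f≤slope b)

  open Compactness

  -- Degrees of patterns in a palette

  module Palettes where

    open MinOp (NaturalMin.minOperator totalOrder) public
      using (x⊓y≤x; x⊓y≤y; ⊓-glb)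

    -- The slots of a pattern ⟨ m₁ , m₂ , m₃ ⟩ stand for the pairs xy, xz, yz of a triple x < y < z.  Pinning
    -- one or two of them to colours turns degree into the sums whose minimum is λ¹ or λ².
    Slot : Set
    Slot = Maybe ℕ

    σ : (ℕ → Carrier) → Slot → ℕ → Carrier
    σ x nothing  p = x p
    σ x (just c) p = 𝟙 (p ℕ.≟ c)

    ω : (ℕ → Carrier) → Slot → Carrier
    ω x nothing  = 1#
    ω x (just c) = x c

    data Pattern : Set where
      ⟨_,_,_⟩ : Slot → Slot → Slot → Pattern

    degree : List Triple → (ℕ → Carrier) → Pattern → Carrier
    degree ps x ⟨ m₁ , m₂ , m₃ ⟩ = ∑[ ps ] λ (p , q , r) → σ x m₁ p * σ x m₂ q * σ x m₃ r

    weight : (ℕ → Carrier) → Pattern → Carrier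
    weight x ⟨ m₁ , m₂ , m₃ ⟩ = ω x m₁ * ω x m₂ * ω x m₃

    module _ (𝓟 : Palette) where

      -- One constructor for each shape of sum in the definition of λ. The six sums of `λ²` come
      -- from three shapes, since `a` and `b` may be exchanged.
      data Admissible : Mode → Pattern → Set where
        vvv₀ : Admissible vvv ⟨ nothing , nothing , nothing ⟩
        ev₁  : ∀ {a} → a ∈ Φ 𝓟 → Admissible ev ⟨ just a , nothing , nothing ⟩
        ev₂  : ∀ {a} → a ∈ Φ 𝓟 → Admissible ev ⟨ nothing , just a , nothing ⟩
        ev₃  : ∀ {a} → a ∈ Φ 𝓟 → Admissible ev ⟨ nothing , nothing , just a ⟩
        ee₁₂ : ∀ {a b} → a ∈ Φ 𝓟 → b ∈ Φ 𝓟 → Admissible ee ⟨ just a , just b , nothing ⟩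
        ee₁₃ : ∀ {a b} → a ∈ Φ 𝓟 → b ∈ Φ 𝓟 → Admissible ee ⟨ just a , nothing , just b ⟩
        ee₂₃ : ∀ {a b} → a ∈ Φ 𝓟 → b ∈ Φ 𝓟 → Admissible ee ⟨ nothing , just a , just b ⟩

      data Coloured : Slot → Set where
        free   : Coloured nothing
        pinned : ∀ {a} → a ∈ Φ 𝓟 → Coloured (just a)

      deg : (ℕ → Carrier) → Pattern → Carrier
      deg = degree (patterns 𝓟)

      -- A common lower bound for all degrees stands in for their minimum. The positivity hypothesis
      -- reproduces the restriction of that minimum to colours in the support.
      Good : Mode → Carrier → (ℕ → Carrier) → Set
      Good ⋆ d x = ∀ m → Admissible ⋆ m → 0# < weight x m → d ≤ deg x m

      -- The product with the weight replaces the open condition `0# < weight x m` by an inequality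
      -- that survives limits. It is also the form in which counting edges between three parts
      -- delivers it.
      record AlmostGood (⋆ : Mode) (d ε : Carrier) (x : ℕ → Carrier) : Set where
        field
          boxed     : Boxed (Φ 𝓟) x
          total-≈1  : Near ε (∑[ Φ 𝓟 ] x) 1#
          good      : ∀ m → Admissible ⋆ m → d * weight x m ≤ weight x m * deg x m + ε

      Feasible : Mode → Carrier → Set
      Feasible ⋆ d = ∃[ x ] (Simplex ℝ 𝓟 x × Good ⋆ d x)

      abstract
        Φ-unique : Unique (Φ 𝓟)
        Φ-unique = deduplicate-! _

        patterns⊆Φ : ∀ {p q r} → (p , q , r) ∈ patterns 𝓟 → p ∈ Φ 𝓟 × q ∈ Φ 𝓟 × r ∈ Φ 𝓟
        patterns⊆Φ {p} {q} {r} t = go (here ≡.refl) , go (there (here ≡.refl)) , go (there (there (here ≡.refl)))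
          where
          go : ∀ {a} → a ∈ p ∷ q ∷ r ∷ [] → a ∈ Φ 𝓟
          go i = ∈-deduplicate⁺ ℕ._≟_ (∈-concatMap⁺ (λ (a , b , c) → a ∷ b ∷ c ∷ []) (Any.map (λ { ≡.refl → i }) t))

        some-pattern : ∃[ t ] t ∈ patterns 𝓟
        some-pattern = pick (patterns 𝓟) (nonempty 𝓟)
          where
          pick : (ps : List Triple) → ps ≢ [] → ∃[ t ] t ∈ ps
          pick [] ne = contradiction ≡.refl ne
          pick (t ∷ _) _ = t , here ≡.refl

        some-colour : ∃[ a ] a ∈ Φ 𝓟
        some-colour = _ , proj₁ (patterns⊆Φ (proj₂ some-pattern))

        simplex-boxed : ∀ {x} → Simplex ℝ 𝓟 x → Boxed (Φ 𝓟) x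
        simplex-boxed (b , _) = b

        simplex-support : ∀ {x} → Simplex ℝ 𝓟 x → ∃[ a ] (a ∈ Φ 𝓟 × 0# < x a)
        simplex-support {x} (b , sum) with em {∃[ a ] (a ∈ Φ 𝓟 × 0# < x a)}
        ... | yes p = p
        ... | no none = contradiction (≤-antisym 0≤1 (≤-respˡ sum (≤-respʳ (∑-zero (Φ 𝓟))
          (∑-mono-∈ (Φ 𝓟) (λ a p → ≮⇒≥ (λ q → none (a , p , q))))))) (proj₂ 0<1)

        point-mass : ∃[ x ] Simplex ℝ 𝓟 x
        point-mass = (λ b → 𝟙 (b ℕ.≟ proj₁ some-colour)) ,
          (λ a _ → ind-≥0 (𝟙-ind (a ℕ.≟ _)) , ind-≤1 (𝟙-ind (a ℕ.≟ _))) ,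
          ≈-trans (∑-cong (Φ 𝓟) (λ i → ≈-sym (*-identityʳ _))) (∑-dirac ℕ._≟_ (λ _ → 1#) Φ-unique (proj₂ some-colour))

        σ-≥0 : ∀ {x} → Boxed (Φ 𝓟) x → ∀ m {p} → p ∈ Φ 𝓟 → 0# ≤ σ x m p
        σ-≥0 b nothing i = proj₁ (b _ i)
        σ-≥0 b (just c) {p} i = ind-≥0 (𝟙-ind (p ℕ.≟ c))

        σ-sum-≤1 : ∀ {x} → Simplex ℝ 𝓟 x → ∀ m → ∑[ Φ 𝓟 ] (σ x m) ≤ 1#
        σ-sum-≤1 (_ , sum) nothing = ≤-reflexive sum
        σ-sum-≤1 s (just c) = ∑-dirac-≤1 ℕ._≟_ c Φ-unique

        -- The patterns are distinct triples of colours, so the degree is at most the same sum over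
        -- the whole cube of colours, which factors into three sums that are each at most 1.
        deg-≤1 : ∀ {x} → Simplex ℝ 𝓟 x → ∀ m → deg x m ≤ 1#
        deg-≤1 {x} s ⟨ m₁ , m₂ , m₃ ⟩ = begin
          deg x ⟨ m₁ , m₂ , m₃ ⟩                     ≈⟨ ∑-cong-∈ (patterns 𝓟) (λ (p , q , r) t → let i , j , k = patterns⊆Φ t in
             ≈-sym (*-cong (*-cong (cut-∈ m₁ i) (cut-∈ m₂ j)) (cut-∈ m₃ k))) ⟩
          ∑[ patterns 𝓟 ] F                          ≤⟨ ∑-sub-unique (λ i j → em) F F≥0 (unique 𝓟) cube-unique
             (λ t → let i , j , k = patterns⊆Φ t in ∈-cartesianProduct⁺ i (∈-cartesianProduct⁺ j k)) ⟩
          ∑[ cube ] F                                ≈⟨ ≈-trans (∑-cartesianProduct L (cartesianProduct L L) F)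
                                                       (∑-cong L (λ p → ∑-cartesianProduct L L (λ (q , r) → F (p , q , r)))) ⟩
          ∑[ L ] (λ p → ∑[ L ] λ q → ∑[ L ] λ r → s₁ p * s₂ q * s₃ r) ≈⟨ ∑-cong L
            (λ p → ≈-trans (∑-cong L (λ q → ∑-*ˡ L _ s₃)) (≈-trans (∑-*ʳ L _ _) (*-congʳ (∑-*ˡ L _ s₂)))) ⟩
          ∑[ L ] (λ p → s₁ p * S₂ * S₃)              ≈⟨ ≈-trans (∑-*ʳ L S₃ (λ p → s₁ p * S₂)) (*-congʳ (∑-*ʳ L S₂ s₁)) ⟩
          S₁ * S₂ * S₃                               ≤⟨ *-mono-≤ (S≥0 m₃) (*-nonNeg (S≥0 m₁) (S≥0 m₂))
            (*-mono-≤ (S≥0 m₂) (S≥0 m₁) (S≤1 m₁) (S≤1 m₂)) (S≤1 m₃) ⟩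
          1# * 1# * 1#                               ≈⟨ ≈-trans (*-identityʳ _) (*-identityʳ _) ⟩
          1#                                         ∎
          where
          open ≤R
          L : List ℕ
          L = Φ 𝓟
          -- Outside Φ 𝓟 the values of x are unconstrained, so they are cut off to keep the sums nonnegative.
          cut : Slot → ℕ → Carrier
          cut m p = 𝟙 (em {p ∈ L}) * σ x m p
          cut-∈ : ∀ m {p} → p ∈ L → cut m p ≈ σ x m p
          cut-∈ m i = ≈-trans (*-congʳ (𝟙-yes em i)) (*-identityˡ _)
          cut-≥0 : ∀ m p → 0# ≤ cut m p
          cut-≥0 m p with em {p ∈ L}
          ... | yes i = ≤-respʳ (≈-sym (*-identityˡ _)) (σ-≥0 (simplex-boxed s) m i)
          ... | no _ = ≤-reflexive (≈-sym (zeroˡ _))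
          s₁ s₂ s₃ : ℕ → Carrier
          s₁ = cut m₁
          s₂ = cut m₂
          s₃ = cut m₃
          S₁ S₂ S₃ : Carrier
          S₁ = ∑[ L ] s₁
          S₂ = ∑[ L ] s₂
          S₃ = ∑[ L ] s₃
          F : Triple → Carrier
          F (p , q , r) = s₁ p * s₂ q * s₃ r
          F≥0 : ∀ t → 0# ≤ F t
          F≥0 (p , q , r) = *-nonNeg (*-nonNeg (cut-≥0 m₁ p) (cut-≥0 m₂ q)) (cut-≥0 m₃ r)
          cube : List Triple
          cube = cartesianProduct L (cartesianProduct L L)
          cube-unique : Unique cube
          cube-unique = cartesianProduct⁺ Φ-unique (cartesianProduct⁺ Φ-unique Φ-unique)
          S≥0 : ∀ m → 0# ≤ ∑[ L ] (cut m)
          S≥0 m = ∑-≥0 L (cut-≥0 m)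
          S≤1 : ∀ m → ∑[ L ] (cut m) ≤ 1#
          S≤1 m = ≤-respˡ (∑-cong-∈ L (λ p i → ≈-sym (cut-∈ m i))) (σ-sum-≤1 s m)

        deg-≥0 : ∀ {x} → Boxed (Φ 𝓟) x → ∀ m → 0# ≤ deg x m
        deg-≥0 b ⟨ m₁ , m₂ , m₃ ⟩ = ∑-≥0-∈ (patterns 𝓟) (λ (p , q , r) t → let i , j , k = patterns⊆Φ t in
          *-nonNeg (*-nonNeg (σ-≥0 b m₁ i) (σ-≥0 b m₂ j)) (σ-≥0 b m₃ k))

        slots : ∀ {⋆ m₁ m₂ m₃} → Admissible ⋆ ⟨ m₁ , m₂ , m₃ ⟩ → Coloured m₁ × Coloured m₂ × Coloured m₃
        slots vvv₀ = free , free , free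
        slots (ev₁ i) = pinned i , free , free
        slots (ev₂ i) = free , pinned i , free
        slots (ev₃ i) = free , free , pinned i
        slots (ee₁₂ i j) = pinned i , pinned j , free
        slots (ee₁₃ i j) = pinned i , free , pinned j
        slots (ee₂₃ i j) = free , pinned i , pinned j

        ω-≥0 : ∀ {x} → Boxed (Φ 𝓟) x → ∀ {m} → Coloured m → 0# ≤ ω x m
        ω-≥0 b free = 0≤1
        ω-≥0 b (pinned i) = proj₁ (b _ i)

        ω-≤1 : ∀ {x} → Boxed (Φ 𝓟) x → ∀ {m} → Coloured m → ω x m ≤ 1#
        ω-≤1 b free = ≤-refl
        ω-≤1 b (pinned i) = proj₂ (b _ i)

        weight-≥0 : ∀ {⋆ x} → Boxed (Φ 𝓟) x → ∀ m → Admissible ⋆ m → 0# ≤ weight x m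
        weight-≥0 b ⟨ _ , _ , _ ⟩ adm = let i , j , k = slots adm in *-nonNeg (*-nonNeg (ω-≥0 b i) (ω-≥0 b j)) (ω-≥0 b k)

        weight-≤1 : ∀ {⋆ x} → Boxed (Φ 𝓟) x → ∀ m → Admissible ⋆ m → weight x m ≤ 1#
        weight-≤1 b ⟨ _ , _ , _ ⟩ adm = let i , j , k = slots adm in
          *-≤1 (*-nonNeg (ω-≥0 b i) (ω-≥0 b j)) (*-≤1 (ω-≥0 b i) (ω-≤1 b i) (ω-≥0 b j) (ω-≤1 b j)) (ω-≥0 b k) (ω-≤1 b k)
          where
          *-≤1 : ∀ {y z} → 0# ≤ y → y ≤ 1# → 0# ≤ z → z ≤ 1# → y * z ≤ 1#
          *-≤1 p q r s = ≤-respʳ (*-identityˡ 1#) (*-mono-≤ r p q s)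

        admissible-support : ∀ ⋆ {x} → Simplex ℝ 𝓟 x → ∃[ m ] (Admissible ⋆ m × 0# < weight x m)
        admissible-support vvv s = _ , vvv₀ , 0<-* (0<-* 0<1 0<1) 0<1
        admissible-support ev s = let a , i , p = simplex-support s in _ , ev₁ i , 0<-* (0<-* p 0<1) 0<1
        admissible-support ee s = let a , i , p = simplex-support s in _ , ee₁₂ i i , 0<-* (0<-* p p) 0<1

        feasible-≤1 : ∀ ⋆ {d} → Feasible ⋆ d → d ≤ 1#
        feasible-≤1 ⋆ (x , s , g) = let m , adm , pos = admissible-support ⋆ s in ≤-trans (g m adm pos) (deg-≤1 s m)

        feasible-0 : ∀ ⋆ → Feasible ⋆ 0#
        feasible-0 ⋆ = let x , s = point-mass in x , s , λ m _ _ → deg-≥0 (simplex-boxed s) m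

        σ-lip : ∀ m {p} → p ∈ Φ 𝓟 → Lipschitz (Φ 𝓟) (λ x → σ x m p)
        σ-lip nothing i = coordinate-lip i
        σ-lip (just c) {p} i = ind-lip (𝟙-ind (p ℕ.≟ c))

        deg-lip : ∀ m → Lipschitz (Φ 𝓟) (λ x → deg x m)
        deg-lip ⟨ m₁ , m₂ , m₃ ⟩ = ∑-lip (patterns 𝓟) (λ (p , q , r) t → let i , j , k = patterns⊆Φ t in
          *-lip (*-lip (σ-lip m₁ i) (σ-lip m₂ j)) (σ-lip m₃ k))

        ω-lip : ∀ {m} → Coloured m → Lipschitz (Φ 𝓟) (λ x → ω x m)
        ω-lip free = ind-lip ind-1
        ω-lip (pinned i) = coordinate-lip i

        weight-lip : ∀ {⋆} m → Admissible ⋆ m → Lipschitz (Φ 𝓟) (λ x → weight x m)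
        weight-lip ⟨ _ , _ , _ ⟩ adm = let i , j , k = slots adm in *-lip (*-lip (ω-lip i) (ω-lip j)) (ω-lip k)

  open Palettes

  -- Existence and characterisation of the Lagrangian

  module Lagrangians where

    abstract
      ≤-ε-scaled : ∀ {x y K} → 0# ≤ K → (∀ δ → 0# < δ → x ≤ y + K * δ) → x ≤ y
      -- The error ε is divided by K + 1, because K may be 0.
      ≤-ε-scaled {x} {y} {K} K≥0 h = ≤-ε (λ ε p → let δ , δ>0 , eq = shrink K+1>0 p in
        ≤-trans (h δ δ>0) (+-monoʳ-≤ y (≤-trans (≤-by (<⇒≤ δ>0)
          (solve 2 (λ K δ → (K :+ :1) :* δ := K :* δ :+ δ) ≈-refl K δ)) (≤-reflexive eq))))
        where
        K+1>0 : 0# < K + 1#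
        K+1>0 = <-≤-trans 0<1 (≤-by K≥0 (+-comm K 1#))

      -- Positivity of a weight is undecidable; excluded middle settles for each entry whether it
      -- competes.
      list-minimum : {A : Set} (L : List A) (Q : A → Set) (f : A → Carrier) → ∃[ a ] (a ∈ L × Q a) →
        ∃[ a ] (a ∈ L × Q a × ∀ b → b ∈ L → Q b → f a ≤ f b)
      list-minimum (a ∷ L) Q f w with em {∃[ b ] (b ∈ L × Q b)}
      list-minimum (a ∷ L) Q f (_ , here ≡.refl , q) | no none = a , here ≡.refl , q ,
        λ { b (here ≡.refl) r → ≤-refl ; b (there i) r → contradiction (b , i , r) none }
      list-minimum (a ∷ L) Q f (b , there i , q) | no none = contradiction (b , i , q) none
      list-minimum (a ∷ L) Q f w | yes tail with list-minimum L Q f tail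
      ... | b , i , q , low with em {Q a × f a ≤ f b}
      ...   | yes (r , le) = a , here ≡.refl , r , λ { c (here ≡.refl) s → ≤-refl ; c (there j) s → ≤-trans le (low c j s) }
      ...   | no nle = b , there i , q , λ { c (here ≡.refl) s → ≰⇒≥ (λ le → nle (s , le)) ; c (there j) s → low c j s }

    module _ (𝓟 : Palette) where

      abstract
        λ¹-glb : ∀ {d x a} → d ≤ deg 𝓟 x ⟨ just a , nothing , nothing ⟩ → d ≤ deg 𝓟 x ⟨ nothing , just a , nothing ⟩ →
          d ≤ deg 𝓟 x ⟨ nothing , nothing , just a ⟩ → d ≤ λ¹ ℝ 𝓟 x a
        λ¹-glb {x = x} {a} p₁ p₂ p₃ = ⊓-glb (⊓-glb
          (≤-respʳ (≈-trans (∑-cong (patterns 𝓟) (λ (p , q , r) → *-assoc _ _ _)) (≈-sym (∑-filter _ (patterns 𝓟) _))) p₁)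
          (≤-respʳ (≈-trans (∑-cong (patterns 𝓟) (λ (p , q , r) → solve 3
            (λ u v w → u :* v :* w := v :* (u :* w)) ≈-refl (x p) (𝟙 (q ℕ.≟ a)) (x r)))
             (≈-sym (∑-filter _ (patterns 𝓟) _))) p₂))
          (≤-respʳ (≈-trans (∑-cong (patterns 𝓟) (λ (p , q , r) → *-comm _ _)) (≈-sym (∑-filter _ (patterns 𝓟) _))) p₃)

        λ¹-≤ : ∀ {x a} → λ¹ ℝ 𝓟 x a ≤ deg 𝓟 x ⟨ just a , nothing , nothing ⟩ × λ¹ ℝ 𝓟 x a ≤ deg 𝓟 x ⟨ nothing , just a , nothing ⟩ ×
          λ¹ ℝ 𝓟 x a ≤ deg 𝓟 x ⟨ nothing , nothing , just a ⟩
        λ¹-≤ {x = x} {a} =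
          ≤-respʳ (≈-trans (∑-filter _ (patterns 𝓟) _) (∑-cong (patterns 𝓟) (λ (p , q , r) → ≈-sym (*-assoc _ _ _))))
            (≤-trans (x⊓y≤x _ _) (x⊓y≤x _ _)) ,
          ≤-respʳ (≈-trans (∑-filter _ (patterns 𝓟) _) (∑-cong (patterns 𝓟) (λ (p , q , r) →
            solve 3 (λ u v w → v :* (u :* w) := u :* v :* w) ≈-refl (x p) (𝟙 (q ℕ.≟ a)) (x r))))
            (≤-trans (x⊓y≤x _ _) (x⊓y≤y _ _)) ,
          ≤-respʳ (≈-trans (∑-filter _ (patterns 𝓟) _) (∑-cong (patterns 𝓟) (λ (p , q , r) → *-comm _ _))) (x⊓y≤y _ _)

        private
          ∑₁₂ : ∀ x a b → ∑𝓟 ℝ 𝓟 (λ (p , q , r) → (p ℕ.≟ a) ×-dec (q ℕ.≟ b))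
            (λ (p , q , r) → x r) ≈ deg 𝓟 x ⟨ just a , just b , nothing ⟩
          ∑₁₂ x a b = ≈-trans (∑-filter _ (patterns 𝓟) _)
            (∑-cong (patterns 𝓟) (λ (p , q , r) → *-congʳ (𝟙-× (p ℕ.≟ a) (q ℕ.≟ b))))
          ∑₁₃ : ∀ x a b → ∑𝓟 ℝ 𝓟 (λ (p , q , r) → (p ℕ.≟ a) ×-dec (r ℕ.≟ b))
            (λ (p , q , r) → x q) ≈ deg 𝓟 x ⟨ just a , nothing , just b ⟩
          ∑₁₃ x a b = ≈-trans (∑-filter _ (patterns 𝓟) _)
            (∑-cong (patterns 𝓟) (λ (p , q , r) → ≈-trans (*-congʳ (𝟙-× (p ℕ.≟ a) (r ℕ.≟ b)))
            (solve 3 (λ u v w → u :* v :* w := u :* w :* v) ≈-refl (𝟙 (p ℕ.≟ a)) (𝟙 (r ℕ.≟ b)) (x q))))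
          ∑₂₃ : ∀ x a b → ∑𝓟 ℝ 𝓟 (λ (p , q , r) → (q ℕ.≟ a) ×-dec (r ℕ.≟ b))
            (λ (p , q , r) → x p) ≈ deg 𝓟 x ⟨ nothing , just a , just b ⟩
          ∑₂₃ x a b = ≈-trans (∑-filter _ (patterns 𝓟) _)
            (∑-cong (patterns 𝓟) (λ (p , q , r) → ≈-trans (*-congʳ (𝟙-× (q ℕ.≟ a) (r ℕ.≟ b)))
            (solve 3 (λ u v w → u :* v :* w := w :* u :* v) ≈-refl (𝟙 (q ℕ.≟ a)) (𝟙 (r ℕ.≟ b)) (x p))))

        λ²-glb : ∀ {d x a b} →
          d ≤ deg 𝓟 x ⟨ just a , just b , nothing ⟩ → d ≤ deg 𝓟 x ⟨ just b , just a , nothing ⟩ →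
          d ≤ deg 𝓟 x ⟨ just a , nothing , just b ⟩ → d ≤ deg 𝓟 x ⟨ just b , nothing , just a ⟩ →
          d ≤ deg 𝓟 x ⟨ nothing , just a , just b ⟩ → d ≤ deg 𝓟 x ⟨ nothing , just b , just a ⟩ → d ≤ λ² ℝ 𝓟 x a b
        λ²-glb {x = x} {a} {b} p₁ p₂ p₃ p₄ p₅ p₆ = ⊓-glb (⊓-glb (⊓-glb (⊓-glb (⊓-glb
          (≤-respʳ (≈-sym (∑₁₂ x a b)) p₁) (≤-respʳ (≈-sym (∑₁₂ x b a)) p₂)) (≤-respʳ (≈-sym (∑₁₃ x a b)) p₃))
          (≤-respʳ (≈-sym (∑₁₃ x b a)) p₄)) (≤-respʳ (≈-sym (∑₂₃ x a b)) p₅)) (≤-respʳ (≈-sym (∑₂₃ x b a)) p₆)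

        λ²-≤ : ∀ {x a b} → λ² ℝ 𝓟 x a b ≤ deg 𝓟 x ⟨ just a , just b , nothing ⟩ ×
          λ² ℝ 𝓟 x a b ≤ deg 𝓟 x ⟨ just a , nothing , just b ⟩ × λ² ℝ 𝓟 x a b ≤ deg 𝓟 x ⟨ nothing , just a , just b ⟩
        λ²-≤ {x} {a} {b} =
          ≤-respʳ (∑₁₂ x a b) (≤-trans (x⊓y≤x _ _)
            (≤-trans (x⊓y≤x _ _) (≤-trans (x⊓y≤x _ _) (≤-trans (x⊓y≤x _ _) (x⊓y≤x _ _))))) ,
          ≤-respʳ (∑₁₃ x a b) (≤-trans (x⊓y≤x _ _) (≤-trans (x⊓y≤x _ _) (≤-trans (x⊓y≤x _ _) (x⊓y≤y _ _)))) ,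
          ≤-respʳ (∑₂₃ x a b) (≤-trans (x⊓y≤x _ _) (x⊓y≤y _ _))

        private
          w₁ : ∀ y → y * 1# * 1# ≈ y
          w₁ y = ≈-trans (*-identityʳ _) (*-identityʳ _)
          w₂ : ∀ y → 1# * y * 1# ≈ y
          w₂ y = ≈-trans (*-identityʳ _) (*-identityˡ _)
          w₃ : ∀ y → 1# * 1# * y ≈ y
          w₃ y = ≈-trans (*-congʳ (*-identityˡ _)) (*-identityˡ _)
          w₁₂ : ∀ y z → y * z * 1# ≈ y * z
          w₁₂ y z = *-identityʳ _
          w₁₃ : ∀ y z → y * 1# * z ≈ y * z
          w₁₃ y z = *-congʳ (*-identityʳ _)
          w₂₃ : ∀ y z → 1# * y * z ≈ y * z
          w₂₃ y z = *-congʳ (*-identityˡ _)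

        -- Together with `Good⇒≤λ` this identifies λ(x) as the greatest d for which x is `Good`;
        -- from here on minima are no longer mentioned.
        Isλ⇒Good : ∀ ⋆ {x v} → Isλ ℝ 𝓟 ⋆ x v → Good 𝓟 ⋆ v x
        Isλ⇒Good vvv v≈ _ vvv₀ pos = ≤-reflexive v≈
        Isλ⇒Good ev {x} (_ , low) _ (ev₁ {a} i) pos =
          ≤-trans (low _ (a , i , <-respʳ-≈ (w₁ (x a)) pos , ≈-refl)) (proj₁ (λ¹-≤ {x}))
        Isλ⇒Good ev {x} (_ , low) _ (ev₂ {a} i) pos =
          ≤-trans (low _ (a , i , <-respʳ-≈ (w₂ (x a)) pos , ≈-refl)) (proj₁ (proj₂ (λ¹-≤ {x})))
        Isλ⇒Good ev {x} (_ , low) _ (ev₃ {a} i) pos =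
          ≤-trans (low _ (a , i , <-respʳ-≈ (w₃ (x a)) pos , ≈-refl)) (proj₂ (proj₂ (λ¹-≤ {x})))
        Isλ⇒Good ee {x} (_ , low) _ (ee₁₂ {a} {b} i j) pos =
          ≤-trans (low _ (a , b , i , j , <-respʳ-≈ (w₁₂ (x a) (x b)) pos , ≈-refl)) (proj₁ (λ²-≤ {x}))
        Isλ⇒Good ee {x} (_ , low) _ (ee₁₃ {a} {b} i j) pos =
          ≤-trans (low _ (a , b , i , j , <-respʳ-≈ (w₁₃ (x a) (x b)) pos , ≈-refl)) (proj₁ (proj₂ (λ²-≤ {x})))
        Isλ⇒Good ee {x} (_ , low) _ (ee₂₃ {a} {b} i j) pos =
          ≤-trans (low _ (a , b , i , j , <-respʳ-≈ (w₂₃ (x a) (x b)) pos , ≈-refl)) (proj₂ (proj₂ (λ²-≤ {x})))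

        Good⇒≤λ : ∀ ⋆ {x v d} → Isλ ℝ 𝓟 ⋆ x v → Good 𝓟 ⋆ d x → d ≤ v
        Good⇒≤λ vvv v≈ g = ≤-respʳ (≈-sym v≈) (g _ vvv₀ (0<-* (0<-* 0<1 0<1) 0<1))
        Good⇒≤λ ev {x} ((a , i , pos , v≈) , _) g = ≤-respʳ (≈-sym v≈) (λ¹-glb {x = x}
          (g _ (ev₁ i) (<-respʳ-≈ (≈-sym (w₁ (x a))) pos)) (g _ (ev₂ i) (<-respʳ-≈ (≈-sym (w₂ (x a))) pos))
            (g _ (ev₃ i) (<-respʳ-≈ (≈-sym (w₃ (x a))) pos)))
        Good⇒≤λ ee {x} ((a , b , i , j , pos , v≈) , _) g = ≤-respʳ (≈-sym v≈) (λ²-glb {x = x}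
          (g _ (ee₁₂ i j) (<-respʳ-≈ (≈-sym (w₁₂ (x a) (x b))) pos)) (g _ (ee₁₂ j i) (<-respʳ-≈ (≈-sym (w₁₂ (x b) (x a))) pos′))
          (g _ (ee₁₃ i j) (<-respʳ-≈ (≈-sym (w₁₃ (x a) (x b))) pos)) (g _ (ee₁₃ j i) (<-respʳ-≈ (≈-sym (w₁₃ (x b) (x a))) pos′))
          (g _ (ee₂₃ i j) (<-respʳ-≈ (≈-sym (w₂₃ (x a) (x b))) pos)) (g _ (ee₂₃ j i) (<-respʳ-≈ (≈-sym (w₂₃ (x b) (x a))) pos′)))
          where
          pos′ : 0# < x b * x a
          pos′ = <-respʳ-≈ (*-comm _ _) pos

        λ-exists : ∀ ⋆ {x} → Simplex ℝ 𝓟 x → ∃[ v ] Isλ ℝ 𝓟 ⋆ x v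
        λ-exists vvv s = _ , ≈-refl
        λ-exists ev {x} s = let a , i , pos , low = list-minimum (Φ 𝓟) (λ a → 0# < x a) (λ¹ ℝ 𝓟 x) (simplex-support 𝓟 s) in
          λ¹ ℝ 𝓟 x a , (a , i , pos , ≈-refl) , λ v (b , j , q , v≈) → ≤-respʳ (≈-sym v≈) (low b j q)
        λ-exists ee {x} s =
          let a₀ , i₀ , p₀ = simplex-support 𝓟 s
              (a , b) , ij , pos , low = list-minimum (cartesianProduct (Φ 𝓟) (Φ 𝓟)) (λ (a , b) → 0# < x a * x b)
                (λ (a , b) → λ² ℝ 𝓟 x a b)
                ((a₀ , a₀) , ∈-cartesianProduct⁺ i₀ i₀ , 0<-* p₀ p₀)
              i , j = ∈-cartesianProduct⁻ (Φ 𝓟) (Φ 𝓟) ij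
          in λ² ℝ 𝓟 x a b , (a , b , i , j , pos , ≈-refl) , λ v (c , d , k , l , q , v≈) → ≤-respʳ (≈-sym v≈)
            (low (c , d) (∈-cartesianProduct⁺ k l) q)

        -- Almost good points cluster at a good one; a colour whose weight vanishes in the limit imposes no condition there.
        feasible-limit : ∀ ⋆ {d} → 0# ≤ d → (∀ ε → 0# < ε → ∃[ x ] AlmostGood 𝓟 ⋆ d ε x) → Feasible 𝓟 ⋆ d
        feasible-limit ⋆ {d} d≥0 h = t , (boxed-t , total-t) , good-t
          where
          open AlmostGood
          relax : ∀ ε δ x → ε ≤ δ → AlmostGood 𝓟 ⋆ d ε x → AlmostGood 𝓟 ⋆ d δ x
          relax ε δ x p g .boxed = g .boxed
          relax ε δ x p g .total-≈1 = near-mono p (g .total-≈1)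
          relax ε δ x p g .good m adm = ≤-trans (g .good m adm) (+-monoʳ-≤ _ p)
          cluster : Σ[ t ∈ (ℕ → Carrier) ] (∀ ε → 0# < ε → ∃[ x ] (AlmostGood 𝓟 ⋆ d ε x × (∀ a → a ∈ Φ 𝓟 → Near ε (x a) (t a))))
          cluster = cluster-point (Φ 𝓟) (AlmostGood 𝓟 ⋆ d) relax (λ ε x g → g .boxed) h
          t : ℕ → Carrier
          t = proj₁ cluster
          boxed-t : Boxed (Φ 𝓟) t
          boxed-t a i = ≤-ε (λ ε p → let x , g , n = proj₂ cluster ε p in ≤-trans (proj₁ (g .boxed a i)) (below (n a i))) ,
                        ≤-ε (λ ε p → let x , g , n = proj₂ cluster ε p in ≤-trans (above (n a i)) (+-monoˡ-≤ ε (proj₂ (g .boxed a i))))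
          sum-lip : Lipschitz (Φ 𝓟) (λ x → ∑[ Φ 𝓟 ] x)
          sum-lip = ∑-lip (Φ 𝓟) (λ a i → coordinate-lip i)
          K+1≥0 : 0# ≤ sum-lip .slope + 1#
          K+1≥0 = 0≤-+ (slope-≥0 sum-lip (t , boxed-t)) 0≤1
          total-t : ∑[ Φ 𝓟 ] t ≈ 1#
          total-t = ≤-antisym
            (≤-ε-scaled K+1≥0 (λ δ p → let x , g , n = proj₂ cluster δ p in
               ≤-trans (sum-lip .lipschitz boxed-t (g .boxed) (<⇒≤ p) (boxed-sym n)) (≤-trans (+-monoˡ-≤ _ (below (g .total-≈1)))
                 (≤-reflexive (solve 2 (λ K δ → :1 :+ δ :+ K :* δ := :1 :+ (K :+ :1) :* δ) ≈-refl (sum-lip .slope) δ)))))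
            (≤-ε-scaled K+1≥0 (λ δ p → let x , g , n = proj₂ cluster δ p in
               ≤-trans (above (g .total-≈1)) (≤-trans (+-monoˡ-≤ _ (sum-lip .lipschitz (g .boxed) boxed-t (<⇒≤ p) n))
                 (≤-reflexive (solve 3 (λ s K δ → s :+ K :* δ :+ δ := s :+ (K :+ :1) :* δ) ≈-refl (∑[ Φ 𝓟 ] t)
                   (sum-lip .slope) δ)))))
          good-t : Good 𝓟 ⋆ d t
          good-t m adm pos = *-cancel-≤ pos (≤-respˡ (*-comm _ _) (≤-ε-scaled C≥0 step))
            where
            lw : Lipschitz (Φ 𝓟) (λ x → weight x m)
            lw = weight-lip 𝓟 m adm
            lp : Lipschitz (Φ 𝓟) (λ x → weight x m * deg 𝓟 x m)
            lp = *-lip lw (deg-lip 𝓟 m)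
            -- Three losses proportional to δ: moving the weight on the left, moving the product on
            -- the right, and the accuracy of the almost good point.
            C : Carrier
            C = d * lw .slope + (lp .slope + 1#)
            C≥0 : 0# ≤ C
            C≥0 = 0≤-+ (*-nonNeg d≥0 (slope-≥0 lw (t , boxed-t))) (0≤-+ (slope-≥0 lp (t , boxed-t)) 0≤1)
            step : ∀ δ → 0# < δ → d * weight t m ≤ weight t m * deg 𝓟 t m + C * δ
            step δ p = let x , g , n = proj₂ cluster δ p in begin
              d * weight t m                                         ≤⟨ *-monoˡ-≤ d≥0
                (lw .lipschitz boxed-t (g .boxed) (<⇒≤ p) (boxed-sym n)) ⟩
              d * (weight x m + lw .slope * δ)                           ≈⟨ solve 4
                (λ d w K δ → d :* (w :+ K :* δ) := d :* w :+ d :* K :* δ) ≈-refl d _ (lw .slope) δ ⟩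
              d * weight x m + d * lw .slope * δ                         ≤⟨ +-monoˡ-≤ _ (g .good m adm) ⟩
              weight x m * deg 𝓟 x m + δ + d * lw .slope * δ             ≤⟨ +-monoˡ-≤ _
                (+-monoˡ-≤ _ (lp .lipschitz (g .boxed) boxed-t (<⇒≤ p) n)) ⟩
              weight t m * deg 𝓟 t m + lp .slope * δ + δ + d * lw .slope * δ ≈⟨ solve 4
                (λ a K L δ → a :+ K :* δ :+ δ :+ L :* δ := a :+ (L :+ (K :+ :1)) :* δ) ≈-refl _ (lp .slope) (d * lw .slope) δ ⟩
              weight t m * deg 𝓟 t m + C * δ                         ∎
              where open ≤R

        -- Since λ is not continuous in x, the maximum is found from the other side: the supremum r
        -- of the feasible d is itself feasible by `feasible-limit`, and the value of λ at the point
        -- witnessing this is at least r.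
        lagrangian : ∀ ⋆ → ∃[ r ] (IsLagrangian ℝ ⋆ 𝓟 r × Feasible 𝓟 ⋆ r × (∀ d → Feasible 𝓟 ⋆ d → d ≤ r))
        lagrangian ⋆ = v , ((x , s , isλ) , λ v′ (x′ , s′ , isλ′) → top v′ (x′ , s′ , Isλ⇒Good ⋆ isλ′)) ,
          (x , s , Isλ⇒Good ⋆ isλ) , top
          where
          sup : ∃ (IsSupremum _≤_ (Feasible 𝓟 ⋆))
          sup = complete (Feasible 𝓟 ⋆) (0# , feasible-0 𝓟 ⋆) (1# , λ d → feasible-≤1 𝓟 ⋆)
          r : Carrier
          r = proj₁ sup
          r≥0 : 0# ≤ r
          r≥0 = proj₁ (proj₂ sup) 0# (feasible-0 𝓟 ⋆)
          approach : ∀ ε → 0# < ε → ∃[ d ] (Feasible 𝓟 ⋆ d × r ≤ d + ε)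
          approach ε p with em {∃[ d ] (Feasible 𝓟 ⋆ d × r ≤ d + ε)}
          ... | yes q = q
          ... | no none = contradiction (≤-antisym (<⇒≤ p)
            (absurd (proj₂ (proj₂ sup) (r - ε) (λ d f → low d (<⇒≤ (≰⇒> (λ q → none (d , f , q)))))))) (proj₂ p)
            where
            low : ∀ d → d + ε ≤ r → d ≤ r - ε
            low d q = ≤-by (x≤y⇒0≤y-x q) (solve 3 (λ r d ε → r :- ε := d :+ (r :- (d :+ ε))) ≈-refl r d ε)
            absurd : r ≤ r - ε → ε ≤ 0#
            absurd q = ≤-by (x≤y⇒0≤y-x q) (solve 2 (λ r ε → :0 := ε :+ (r :- ε :- r)) ≈-refl r ε)
          almost : ∀ ε → 0# < ε → ∃[ x ] AlmostGood 𝓟 ⋆ r ε x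
          almost ε p = let d , (x , s , g) , q = approach ε p in x , record
            { boxed = simplex-boxed 𝓟 s
            ; total-≈1 = ≤-trans (≤-reflexive (proj₂ s)) (≤+ (<⇒≤ p)) & ≤-trans (≤-reflexive (≈-sym (proj₂ s))) (≤+ (<⇒≤ p))
            ; good = λ m adm → almost-good d x m q (weight-≥0 𝓟 (simplex-boxed 𝓟 s) m adm)
              (weight-≤1 𝓟 (simplex-boxed 𝓟 s) m adm) (g m adm) p
            }
            where
            almost-good : ∀ d x m {ε} → r ≤ d + ε → 0# ≤ weight x m → weight x m ≤ 1# →
              (0# < weight x m → d ≤ deg 𝓟 x m) → 0# < ε →
              r * weight x m ≤ weight x m * deg 𝓟 x m + ε
            almost-good d x m {ε} q w≥0 w≤1 g p with em {0# ≈ weight x m}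
            ... | yes w≈0 = ≤-respˡ (≈-trans (≈-sym (zeroʳ r)) (*-congˡ w≈0)) (0≤-+
                   (≤-reflexive (≈-trans (≈-sym (zeroˡ _)) (*-congʳ w≈0))) (<⇒≤ p))
            ... | no w≉0 = begin
              r * weight x m                    ≤⟨ *-monoʳ-≤ w≥0 q ⟩
              (d + ε) * weight x m              ≈⟨ solve 3 (λ d ε w → (d :+ ε) :* w := w :* d :+ ε :* w) ≈-refl d ε _ ⟩
              weight x m * d + ε * weight x m   ≤⟨ +-mono-≤ (*-monoˡ-≤ w≥0 (g (w≥0 , w≉0)))
                (≤-respʳ (*-identityʳ ε) (*-monoˡ-≤ (<⇒≤ p) w≤1)) ⟩
              weight x m * deg 𝓟 x m + ε        ∎
              where open ≤R
          feasible-r : Feasible 𝓟 ⋆ r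
          feasible-r = feasible-limit ⋆ r≥0 almost
          x : ℕ → Carrier
          x = proj₁ feasible-r
          s : Simplex ℝ 𝓟 x
          s = proj₁ (proj₂ feasible-r)
          v : Carrier
          v = proj₁ (λ-exists ⋆ s)
          isλ : Isλ ℝ 𝓟 ⋆ x v
          isλ = proj₂ (λ-exists ⋆ s)
          top : ∀ d → Feasible 𝓟 ⋆ d → d ≤ v
          top d f = ≤-trans (proj₁ (proj₂ sup) d f) (Good⇒≤λ ⋆ isλ (proj₂ (proj₂ feasible-r)))

  open Lagrangians

  -- Cut norm and the counting lemma

  module Counting where

    private
      variable
        n : ℕ
        I : Set
        x x′ y y′ z c ε δ κ : Carrier

    Kernel : ℕ → Set
    Kernel n = Fin n → Fin n → Carrier

    Kernel₃ : ℕ → Set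
    Kernel₃ n = Fin n → Fin n → Fin n → Carrier

    ∑₂ : Kernel n → Carrier
    ∑₂ f = ∑ᵥ λ u → ∑ᵥ λ v → f u v

    ∑₃ : Kernel₃ n → Carrier
    ∑₃ f = ∑ᵥ λ u → ∑ᵥ λ v → ∑ᵥ λ w → f u v w

    IndVec : (Fin n → Carrier) → Set
    IndVec a = ∀ u → Ind (a u)

    IndKer : Kernel n → Set
    IndKer f = ∀ u v → Ind (f u v)

    -- The distance of `F` and `G` in cut norm is at most κ, tested on 0-1 rectangles only.
    record Cut {n} (κ : Carrier) (F G : Kernel n) : Set where
      constructor mkCut
      field
        cut : ∀ a b → IndVec a → IndVec b → Near κ (∑₂ λ u v → a u * b v * F u v) (∑₂ λ u v → a u * b v * G u v)

    open Cut public

    -- For each fixed w, the kernel is a multiple of a rectangle in (u , v); this is what the cut norm can be tested against.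
    record Separable {n} (P : Kernel₃ n) : Set where
      field
        coef     : Carrier
        coef-≥0  : 0# ≤ coef
        coef-≤1  : coef ≤ 1#
        left right : Kernel n
        left-ind : IndKer left
        right-ind : IndKer right
        splits   : ∀ u v w → P u v w ≈ coef * (left u w * right v w)
        domain  : Fin n → Carrier
        domain-ind : IndVec domain
        supported : ∀ u w → left u w ≈ left u w * domain w

    open Separable public

    abstract
      near-refl : 0# ≤ κ → x ≈ y → Near κ x y
      near-refl p e = ≤-trans (≤-reflexive e) (≤+ p) & ≤-trans (≤-reflexive (≈-sym e)) (≤+ p)

      near-cong : x ≈ x′ → y ≈ y′ → Near κ x y → Near κ x′ y′
      near-cong e f (p & q) = ≤-respˡ e (≤-respʳ (+-congʳ f) p) & ≤-respˡ f (≤-respʳ (+-congʳ e) q)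

      near-sym : Near κ x y → Near κ y x
      near-sym (p & q) = q & p

      near-trans : Near ε x y → Near δ y z → Near (ε + δ) x z
      near-trans {ε} {x} {y} {δ} {z} (p & q) (r & s) =
        ≤-respʳ (solve 3 (λ z ε δ → z :+ δ :+ ε := z :+ (ε :+ δ)) ≈-refl z ε δ) (≤-trans p (+-monoˡ-≤ ε r)) &
        ≤-respʳ (+-assoc x ε δ) (≤-trans s (+-monoˡ-≤ δ q))

      near-+ : Near ε x y → Near δ x′ y′ → Near (ε + δ) (x + x′) (y + y′)
      near-+ {ε} {x} {y} {δ} {x′} {y′} (p & q) (r & s) =
        ≤-respʳ (lemma y y′) (+-mono-≤ p r) & ≤-respʳ (lemma x x′) (+-mono-≤ q s)
        where
        lemma : ∀ a b → a + ε + (b + δ) ≈ a + b + (ε + δ)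
        lemma a b = solve 4 (λ a b ε δ → a :+ ε :+ (b :+ δ) := a :+ b :+ (ε :+ δ)) ≈-refl a b ε δ

      near-scale : 0# ≤ κ → 0# ≤ c → c ≤ 1# → Near κ x y → Near κ (c * x) (c * y)
      near-scale {κ} {c} {x} {y} κ≥0 c≥0 c≤1 (p & q) = go p & go q
        where
        go : ∀ {x y} → x ≤ y + κ → c * x ≤ c * y + κ
        go {x} {y} p = ≤-trans (*-monoˡ-≤ c≥0 p) (≤-respˡ (≈-sym (distribˡ c y κ))
          (+-monoʳ-≤ _ (≤-respʳ (*-identityˡ κ) (*-monoʳ-≤ κ≥0 c≤1))))

      ∑₂-cong : {f g : Kernel n} → (∀ u v → f u v ≈ g u v) → ∑₂ f ≈ ∑₂ g
      ∑₂-cong {n} h = ∑-cong (allFin n) (λ u → ∑-cong (allFin n) (h u))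

      ∑₃-cong : {f g : Kernel₃ n} → (∀ u v w → f u v w ≈ g u v w) → ∑₃ f ≈ ∑₃ g
      ∑₃-cong {n} h = ∑-cong (allFin n) (λ u → ∑₂-cong {n} (h u))

      ∑₃-mono : {f g : Kernel₃ n} → (∀ u v w → f u v w ≤ g u v w) → ∑₃ f ≤ ∑₃ g
      ∑₃-mono {n} h = ∑-mono (allFin n) (λ u → ∑-mono (allFin n) (λ v → ∑-mono (allFin n) (h u v)))

      ∑₃-swap₂₃ : (f : Kernel₃ n) → ∑₃ f ≈ ∑₃ (λ u w v → f u v w)
      ∑₃-swap₂₃ {n} f = ∑-cong (allFin n) (λ u → ∑-comm (allFin n) (allFin n) (f u))

      ∑₃-swap₁₂ : (f : Kernel₃ n) → ∑₃ f ≈ ∑₃ (λ v u w → f u v w)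
      ∑₃-swap₁₂ {n} f = ∑-comm (allFin n) (allFin n) _

      ∑₃-rotate : (f : Kernel₃ n) → ∑₃ f ≈ ∑₃ (λ w u v → f u v w)
      ∑₃-rotate {n} f = ≈-trans (∑₃-swap₂₃ f) (∑₃-swap₁₂ {n} _)

      ∑₂-*ˡ : (c : Carrier) (f : Kernel n) → ∑₂ (λ u v → c * f u v) ≈ c * ∑₂ f
      ∑₂-*ˡ {n} c f = ≈-trans (∑-cong (allFin n) (λ u → ∑-*ˡ (allFin n) c (f u))) (∑-*ˡ (allFin n) c _)

      ∑₃-*ˡ : (c : Carrier) (f : Kernel₃ n) → ∑₃ (λ u v w → c * f u v w) ≈ c * ∑₃ f
      ∑₃-*ˡ {n} c f = ≈-trans (∑-cong (allFin n) (λ u → ∑₂-*ˡ {n} c (f u))) (∑-*ˡ (allFin n) c _)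

      ∑₃-+ : (f g : Kernel₃ n) → ∑₃ (λ u v w → f u v w + g u v w) ≈ ∑₃ f + ∑₃ g
      ∑₃-+ {n} f g = ≈-trans (∑-cong (allFin n)
        (λ u → ≈-trans (∑-cong (allFin n) (λ v → ∑-+ (allFin n) (f u v) (g u v))) (∑-+ (allFin n) _ _)))
        (∑-+ (allFin n) _ _)

      ∑₃-∑ : (is : List I) (f : I → Kernel₃ n) → ∑₃ (λ u v w → ∑[ is ] (λ i → f i u v w)) ≈ ∑[ is ] (λ i → ∑₃ (f i))
      ∑₃-∑ {n = n} is f = ≈-trans (∑-cong (allFin n)
        (λ u → ≈-trans (∑-cong (allFin n) (λ v → ∑-comm (allFin n) is _)) (∑-comm (allFin n) is _)))
        (∑-comm (allFin n) is _)

      near-∑-weighted : (is : List I) (f g k : I → Carrier) → (∀ i → Near (k i) (f i) (g i)) → Near (∑[ is ] k)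
        (∑[ is ] f) (∑[ is ] g)
      near-∑-weighted [] f g k h = near-refl ≤-refl ≈-refl
      near-∑-weighted (i ∷ is) f g k h = near-+ (h i) (near-∑-weighted is f g k h)

      -- For every third vertex w the sum is a cut-norm test. Only w in the domain contribute, so
      -- the error is κ times the size of the domain; for tests supported on small parts this is far
      -- below n κ.
      count₁₂ : {F G : Kernel n} → 0# ≤ κ → Cut κ F G → (P : Kernel₃ n) → (S : Separable P) →
        Near (∑ᵥ (S .domain) * κ) (∑₃ λ u v w → P u v w * F u v) (∑₃ λ u v w → P u v w * G u v)
      count₁₂ {n} {κ} {F} {G} κ≥0 FG P S = near-cong (side F) (side G) (near-mono (≤-reflexive (∑-*ʳ (allFin n) κ (S .domain)))
        (near-∑-weighted (allFin n) _ _ _ (λ w → near-cong (slice F w) (slice G w)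
          (near-scale (*-nonNeg (ind-≥0 (S .domain-ind w)) κ≥0) (S .coef-≥0) (S .coef-≤1) (near-masked (S .domain-ind w)
          (FG .cut (λ u → S .left u w) (λ v → S .right v w) (λ u → S .left-ind u w) (λ v → S .right-ind v w)))))))
        where
        near-masked : ∀ {t x y} → Ind t → Near κ x y → Near (t * κ) (t * x) (t * y)
        near-masked {t} {x} {y} (inj₁ e) (p & q) = near-cong (vanish x) (vanish y)
          (near-mono (≤-reflexive (≈-trans (≈-sym (zeroˡ κ)) (*-congʳ (≈-sym e)))) (near-refl ≤-refl ≈-refl))
          where
          vanish : ∀ z → 0# ≈ t * z
          vanish z = ≈-trans (≈-sym (zeroˡ z)) (*-congʳ (≈-sym e))
        near-masked {t} {x} {y} (inj₂ e) (p & q) = near-cong (one x) (one y) (near-mono (≤-reflexive (one κ)) (p & q))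
          where
          one : ∀ z → z ≈ t * z
          one z = ≈-trans (≈-sym (*-identityˡ z)) (*-congʳ (≈-sym e))
        slice : (F : Kernel n) → ∀ w → S .coef *
          (S .domain w * ∑₂ λ u v → S .left u w * S .right v w * F u v) ≈ S .coef * ∑₂ λ u v → S .left u w * S .right v w * F u v
        slice F w = *-congˡ (≈-trans (≈-sym (∑₂-*ˡ {n} (S .domain w) _))
          (∑₂-cong {n} (λ u v → ≈-trans (move _ _ _ _) (*-congʳ (*-congʳ (≈-sym (S .supported u w)))))))
          where
          move : ∀ t l r f → t * (l * r * f) ≈ l * t * r * f
          move = solve 4 (λ t l r f → t :* (l :* r :* f) := l :* t :* r :* f) ≈-refl
        side : (F : Kernel n) → ∑ᵥ (λ w → S .coef * ∑₂ λ u v → S .left u w * S .right v w * F u v) ≈ ∑₃ λ u v w → P u v w * F u v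
        side F = ≈-sym (≈-trans (∑₃-cong {n} (λ u v w → ≈-trans (*-congʳ (S .splits u v w)) (*-assoc _ _ _)))
          (≈-trans (∑₃-rotate {n} _) (∑-cong (allFin n) (λ w → ∑₂-*ˡ {n} (S .coef) _))))

      count₁₃ : {F G : Kernel n} → 0# ≤ κ → Cut κ F G → (P : Kernel₃ n) → (S : Separable (λ u w v → P u v w)) →
        Near (∑ᵥ (S .domain) * κ) (∑₃ λ u v w → P u v w * F u w) (∑₃ λ u v w → P u v w * G u w)
      count₁₃ {n = n} κ≥0 FG P S = near-cong (≈-sym (∑₃-swap₂₃ {n} _)) (≈-sym (∑₃-swap₂₃ {n} _))
        (count₁₂ κ≥0 FG (λ u w v → P u v w) S)

      count₂₃ : {F G : Kernel n} → 0# ≤ κ → Cut κ F G → (P : Kernel₃ n) → (S : Separable (λ v w u → P u v w)) →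
        Near (∑ᵥ (S .domain) * κ) (∑₃ λ u v w → P u v w * F v w) (∑₃ λ u v w → P u v w * G v w)
      count₂₃ {n = n} κ≥0 FG P S = near-cong (∑₃-rotate {n} _) (∑₃-rotate {n} _) (count₁₂ κ≥0 FG (λ v w u → P u v w) S)

    -- In sums weighted by `T`, the kernel `G` may be exchanged for c times `H` at cost η. The case
    -- `exact` covers pairs on which the two agree, so that one counting lemma serves all modes and
    -- both bounds.
    data Replace {n} (η : Carrier) (T : Kernel₃ n) (G : Kernel n) (c : Carrier) (H : Kernel n) : Set where
      close : ∀ {κ} (S : Separable T) → S .coef ≈ 1# → 0# ≤ κ → ∑ᵥ (S .domain) * κ ≤ η → Cut κ G (λ u v → c * H u v) →
        Replace η T G c H
      exact : 0# ≤ η → (∀ u v → G u v ≈ c * H u v) → Replace η T G c H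

    ∑₃-kernels : Kernel₃ n → Kernel n → Kernel n → Kernel n → Carrier
    ∑₃-kernels T F₁ F₂ F₃ = ∑₃ λ u v w → T u v w * (F₁ u v * F₂ u w * F₃ v w)

    private
      -- For a fixed third vertex, indicators of the two other pairs depend on one vertex of the
      -- rectangle each, so they only shrink its sides.
      separable-times : {T P : Kernel₃ n} {A B : Kernel n} (S : Separable T) → S .coef ≈ 1# → 0# ≤ c → c ≤ 1# →
        IndKer A → IndKer B → (∀ u v w → P u v w ≈ T u v w * (c * (A u w * B v w))) → Separable P
      separable-times {c = c} S e p q i j h .coef = c
      separable-times S e p q i j h .coef-≥0 = p
      separable-times S e p q i j h .coef-≤1 = q
      separable-times {A = A} S e p q i j h .left u w = S .left u w * A u w
      separable-times {B = B} S e p q i j h .right v w = S .right v w * B v w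
      separable-times S e p q i j h .left-ind u w = ind-* (S .left-ind u w) (i u w)
      separable-times S e p q i j h .right-ind u w = ind-* (S .right-ind u w) (j u w)
      separable-times S e p q i j h .domain = S .domain
      separable-times S e p q i j h .domain-ind = S .domain-ind
      separable-times {A = A} S e p q i j h .supported u w = ≈-trans (*-congʳ (S .supported u w))
        (solve 3 (λ l s a → l :* s :* a := l :* a :* s) ≈-refl (S .left u w) (S .domain w) (A u w))
      separable-times {c = c} {A = A} {B} S e p q i j h .splits u v w = ≈-trans (h u v w)
        (≈-trans (*-congʳ (≈-trans (S .splits u v w) (≈-trans (*-congʳ e) (*-identityˡ _))))
        (solve 5 (λ l r c a b → l :* r :* (c :* (a :* b)) := c :* (l :* a :* (r :* b))) ≈-refl (S .left u w)
          (S .right v w) c (A u w) (B v w)))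

    module _ {n : ℕ} {η₁ η₂ η₃ : Carrier} (T : Kernel₃ n) {G₁ G₂ G₃ H₁ H₂ H₃ : Kernel n} {c₁ c₂ c₃ : Carrier}
      (g₁ : IndKer G₁) (g₂ : IndKer G₂) (g₃ : IndKer G₃) (h₁ : IndKer H₁) (h₂ : IndKer H₂) (h₃ : IndKer H₃)
      (c₁≥0 : 0# ≤ c₁) (c₁≤1 : c₁ ≤ 1#) (c₂≥0 : 0# ≤ c₂) (c₂≤1 : c₂ ≤ 1#) where

      abstract
        private
          replace₁ : Replace η₁ T G₁ c₁ H₁ →
            Near η₁ (∑₃-kernels T G₁ G₂ G₃) (∑₃-kernels T (λ u v → c₁ * H₁ u v) G₂ G₃)
          replace₁ (exact p e) = near-refl p (∑₃-cong {n} (λ u v w → *-congˡ (*-congʳ (*-congʳ (e u v)))))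
          replace₁ (close S e κ≥0 le C) = near-mono le
            (near-cong (∑₃-cong {n} (λ u v w → shuffle (T u v w) (G₁ u v) (G₂ u w) (G₃ v w)))
            (∑₃-cong {n} (λ u v w → shuffle (T u v w) (c₁ * H₁ u v) (G₂ u w) (G₃ v w)))
            (count₁₂ κ≥0 C (λ u v w → T u v w * (1# * (G₂ u w * G₃ v w)))
              (separable-times S e 0≤1 ≤-refl g₂ g₃ (λ u v w → ≈-refl))))
            where
            shuffle : ∀ t a b c → t * (1# * (b * c)) * a ≈ t * (a * b * c)
            shuffle = solve 4 (λ t a b c → t :* (:1 :* (b :* c)) :* a := t :* (a :* b :* c)) ≈-refl

          replace₂ : Replace η₂ (λ u w v → T u v w) G₂ c₂ H₂ →
            Near η₂ (∑₃-kernels T (λ u v → c₁ * H₁ u v) G₂ G₃) (∑₃-kernels T (λ u v → c₁ * H₁ u v) (λ u v → c₂ * H₂ u v) G₃)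
          replace₂ (exact p e) = near-refl p (∑₃-cong {n} (λ u v w → *-congˡ (*-congʳ (*-congˡ (e u w)))))
          replace₂ (close S e κ≥0 le C) = near-mono le
            (near-cong (∑₃-cong {n} (λ u v w → shuffle (T u v w) (H₁ u v) (G₂ u w) (G₃ v w) c₁))
            (∑₃-cong {n} (λ u v w → shuffle (T u v w) (H₁ u v) (c₂ * H₂ u w) (G₃ v w) c₁))
            (count₁₃ κ≥0 C (λ u v w → T u v w * (c₁ * (H₁ u v * G₃ v w)))
              (separable-times S e c₁≥0 c₁≤1 h₁ (λ w v → g₃ v w) (λ u w v → ≈-refl))))
            where
            shuffle : ∀ t a b c k → t * (k * (a * c)) * b ≈ t * (k * a * b * c)
            shuffle = solve 5 (λ t a b c k → t :* (k :* (a :* c)) :* b := t :* (k :* a :* b :* c)) ≈-refl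

          replace₃ : Replace η₃ (λ v w u → T u v w) G₃ c₃ H₃ →
            Near η₃ (∑₃-kernels T (λ u v → c₁ * H₁ u v) (λ u v → c₂ * H₂ u v) G₃)
              (∑₃-kernels T (λ u v → c₁ * H₁ u v) (λ u v → c₂ * H₂ u v) (λ u v → c₃ * H₃ u v))
          replace₃ (exact p e) = near-refl p (∑₃-cong {n} (λ u v w → *-congˡ (*-congˡ (e v w))))
          replace₃ (close S e κ≥0 le C) = near-mono le
            (near-cong (∑₃-cong {n} (λ u v w → shuffle (T u v w) (H₁ u v) (H₂ u w) (G₃ v w) c₁ c₂))
            (∑₃-cong {n} (λ u v w → shuffle (T u v w) (H₁ u v) (H₂ u w) (c₃ * H₃ v w) c₁ c₂))
            (count₂₃ κ≥0 C (λ u v w → T u v w * (c₁ * c₂ * (H₁ u v * H₂ u w)))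
              (separable-times S e (*-nonNeg c₁≥0 c₂≥0) (≤-respʳ (*-identityˡ 1#) (*-mono-≤ c₂≥0 c₁≥0 c₁≤1 c₂≤1))
                (λ v u → h₁ u v) (λ w u → h₂ u w) (λ v w u → ≈-refl))))
            where
            shuffle : ∀ t a b c k l → t * (k * l * (a * b)) * c ≈ t * (k * a * (l * b) * c)
            shuffle = solve 6 (λ t a b c k l → t :* (k :* l :* (a :* b)) :* c := t :* (k :* a :* (l :* b) :* c)) ≈-refl

        -- The kernels are exchanged one by one. At each turn the two others are indicators up to
        -- factors in [0, 1]; the indicators go into the rectangle and the factors into `coef`.
        counting : Replace η₁ T G₁ c₁ H₁ → Replace η₂ (λ u w v → T u v w) G₂ c₂ H₂ → Replace η₃ (λ v w u → T u v w) G₃ c₃ H₃ →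
          Near (η₁ + η₂ + η₃) (∑₃-kernels T G₁ G₂ G₃)
            (∑₃-kernels T (λ u v → c₁ * H₁ u v) (λ u v → c₂ * H₂ u v) (λ u v → c₃ * H₃ u v))
        counting r₁ r₂ r₃ = near-trans (near-trans (replace₁ r₁) (replace₂ r₂)) (replace₃ r₃)

  open Counting

  -- Derandomised quasirandom colourings

  module QuasirandomColourings where

    module _ (𝓟 : Palette) {x : ℕ → Carrier} (simplex : Simplex ℝ 𝓟 x) where

      private
        L : List ℕ
        L = Φ 𝓟

      -- Pairs only receive colours of positive weight, because `Good` promises nothing about the
      -- others.
      Usable : ℕ → Set
      Usable a = a ∈ L × 0# < x a

      dev : ℕ → ℕ → Carrier
      dev a c = 𝟙 (a ℕ.≟ c) - x c

      private
        M : Carrier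
        M = fromℕ (length L)

      -- The Gram matrix of the columns of the deviations of colour c. The mask `h`, later `below?`,
      -- restricts them to the pairs u < y.
      gram : ∀ {k n} → (Fin k → Fin n → Carrier) → (Fin k → Fin n → ℕ) → ℕ → Kernel n
      gram h φ c y y′ = ∑ᵥ λ u → (h u y * dev (φ u y) c) * (h u y′ * dev (φ u y′) c)

      rectangle-sum : ∀ {n} → Kernel n → (Fin n → Fin n → ℕ) → (a b : Fin n → Carrier) → ℕ → Carrier
      rectangle-sum h φ a b c = ∑₂ λ u y → a u * b y * (h u y * dev (φ u y) c)

      abstract
        -- Under the distribution x the deviations have mean 0, so some colour does no worse than the average.
        favourable-colour : (ℓ : ℕ → Carrier) → ∃[ a ] (Usable a × ∑[ L ] (λ c → ℓ c * dev a c) ≤ 0#)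
        favourable-colour ℓ with em {∃[ a ] (Usable a × ∑[ L ] (λ c → ℓ c * dev a c) ≤ 0#)}
        ... | yes p = p
        ... | no none = contradiction (≤-antisym (<⇒≤ positive)
          (≤-trans (∑-term-≤′ (proj₁ (proj₂ support))) (≤-reflexive average))) (proj₂ positive)
          where
          v : ℕ → Carrier
          v a = ∑[ L ] (λ c → ℓ c * dev a c)
          S : Carrier
          S = ∑[ L ] (λ c → ℓ c * x c)
          support : ∃[ a ] (a ∈ L × 0# < x a)
          support = simplex-support 𝓟 simplex
          v>0 : ∀ a → Usable a → 0# < v a
          v>0 a u = ≰⇒> (λ q → none (a , u , q))
          term≥0 : ∀ a → a ∈ L → 0# ≤ x a * v a
          term≥0 a i with em {0# ≈ x a}
          ... | yes e = ≤-reflexive (≈-trans (≈-sym (zeroˡ _)) (*-congʳ e))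
          ... | no ne = let p = proj₁ (simplex-boxed 𝓟 simplex a i) in *-nonNeg p (<⇒≤ (v>0 a (i , p , ne)))
          positive : 0# < x (proj₁ support) * v (proj₁ support)
          positive = let a , i , p = support in 0<-* p (v>0 a (i , p))
          ∑-term-≤′ : ∀ {a} → a ∈ L → x a * v a ≤ ∑[ L ] (λ a → x a * v a)
          ∑-term-≤′ = go L (λ a i → i)
            where
            go : (is : List ℕ) → (∀ a → a ∈ is → a ∈ L) → ∀ {a} → a ∈ is → x a * v a ≤ ∑[ is ] (λ a → x a * v a)
            go (i ∷ is) sub (here ≡.refl) = ≤-by (∑-≥0-∈ is (λ a j → term≥0 a (sub a (there j)))) ≈-refl
            go (i ∷ is) sub (there q) = ≤-trans (go is (λ a j → sub a (there j)) q)
              (≤-by (term≥0 i (sub i (here ≡.refl))) (+-comm _ _))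
          v≈ : ∀ a → a ∈ L → v a ≈ ℓ a - S
          v≈ a i = ≈-trans (∑-cong L (λ c → solve 3 (λ l t y → l :* (t :- y) := t :* l :- l :* y) ≈-refl (ℓ c)
            (𝟙 (a ℕ.≟ c)) (x c)))
            (≈-trans (∑-- L _ _) (+-congʳ (≈-trans (∑-cong L (λ c → *-congʳ (𝟙-cong (a ℕ.≟ c) (c ℕ.≟ a) ≡.sym ≡.sym)))
              (∑-dirac ℕ._≟_ ℓ (Φ-unique 𝓟) i))))
          average : ∑[ L ] (λ a → x a * v a) ≈ 0#
          average = ≈-trans (∑-cong-∈ L (λ a i → ≈-trans (*-congˡ (v≈ a i))
            (solve 3 (λ y l s → y :* (l :- s) := l :* y :- y :* s) ≈-refl (x a) (ℓ a) S)))
            (≈-trans (∑-- L _ _) (≈-trans (+-congˡ (-‿cong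
              (≈-trans (∑-*ʳ L S x) (≈-trans (*-congʳ (proj₂ simplex)) (*-identityˡ S))))) (-‿inverseʳ S)))

        dev²≤1 : ∀ a {c} → c ∈ L → dev a c * dev a c ≤ 1#
        dev²≤1 a {c} i = square (𝟙-ind (a ℕ.≟ c)) (simplex-boxed 𝓟 simplex c i)
          where
          square : ∀ {t y} → Ind t → 0# ≤ y × y ≤ 1# → (t - y) * (t - y) ≤ 1#
          square {t} {y} (inj₁ e) (p , q) = ≤-respˡ (≈-trans (solve 1 (λ y → y :* y := (:0 :- y) :* (:0 :- y)) ≈-refl y)
            (*-cong (+-congʳ (≈-sym e)) (+-congʳ (≈-sym e)))) (≤-respʳ (*-identityˡ 1#) (*-mono-≤ p p q q))
          square {t} {y} (inj₂ e) (p , q) = ≤-respˡ (*-cong (+-congʳ (≈-sym e)) (+-congʳ (≈-sym e)))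
            (≤-respʳ (*-identityˡ 1#) (*-mono-≤ r r s s))
            where
            r : 0# ≤ 1# - y
            r = x≤y⇒0≤y-x q
            s : 1# - y ≤ 1#
            s = ≤-by p (solve 1 (λ y → :1 := :1 :- y :+ y) ≈-refl y)

        -- This is the method of conditional expectations. For independent colours with distribution
        -- x the off-diagonal terms have mean 0, so the expected value is at most the diagonal sum.
        -- Each new colour is chosen so that the terms linear in its deviation sum to at most 0, and
        -- its square is at most 1.
        favourable-row : ∀ {n} (s : ℕ → Kernel n) → (∀ c y → 0# ≤ s c y y) →
          Σ[ row ∈ (Fin n → ℕ) ] ((∀ y → Usable (row y)) ×
            ∑[ L ] (λ c → ∑₂ λ y y′ → s c y y′ * (dev (row y) c * dev (row y′) c)) ≤ ∑[ L ] (λ c → ∑ᵥ λ y → s c y y))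
        favourable-row {zero} s s≥0 = (λ ()) , (λ ()) , ≤-refl
        favourable-row {suc n} s s≥0 = extend-row head row , usable , bound
          where
          extend-row : ℕ → (Fin n → ℕ) → Fin (suc n) → ℕ
          extend-row a r Fin.zero = a
          extend-row a r (Fin.suc y) = r y
          rest : Σ[ row ∈ (Fin n → ℕ) ] ((∀ y → Usable (row y)) ×
            ∑[ L ] (λ c → ∑₂ λ y y′ → s c (Fin.suc y) (Fin.suc y′) * (dev (row y) c * dev (row y′) c)) ≤ ∑[ L ]
              (λ c → ∑ᵥ λ y → s c (Fin.suc y) (Fin.suc y)))
          rest = favourable-row (λ c y y′ → s c (Fin.suc y) (Fin.suc y′)) (λ c y → s≥0 c (Fin.suc y))
          row : Fin n → ℕ
          row = proj₁ rest
          -- The coefficient of the deviation of the head; row and column contribute separately, as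
          -- `s` may be asymmetric.
          ℓ : ℕ → Carrier
          ℓ c = ∑ᵥ λ y → (s c Fin.zero (Fin.suc y) + s c (Fin.suc y) Fin.zero) * dev (row y) c
          best : ∃[ a ] (Usable a × ∑[ L ] (λ c → ℓ c * dev a c) ≤ 0#)
          best = favourable-colour ℓ
          head : ℕ
          head = proj₁ best
          usable : ∀ y → Usable (extend-row head row y)
          usable Fin.zero = proj₁ (proj₂ best)
          usable (Fin.suc y) = proj₁ (proj₂ rest) y
          full tail : ℕ → Carrier
          full c = ∑₂ λ y y′ → s c y y′ * (dev (extend-row head row y) c * dev (extend-row head row y′) c)
          tail c = ∑₂ λ y y′ → s c (Fin.suc y) (Fin.suc y′) * (dev (row y) c * dev (row y′) c)
          d : ℕ → Carrier
          d = dev head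
          expand : ∀ c → full c ≈ s c Fin.zero Fin.zero * (d c * d c) + ℓ c * d c + tail c
          expand c = ≈-trans (∑ᵥ-suc {n} _) (≈-trans
            (+-cong (∑ᵥ-suc {n} _) (≈-trans (∑-cong (allFin n) (λ y → ∑ᵥ-suc {n} _)) (∑-+ (allFin n) _ _)))
            (≈-trans (+-congʳ (+-congˡ (≈-trans (∑-cong (allFin n)
              (λ y → solve 3 (λ a b e → a :* (b :* e) := a :* e :* b) ≈-refl (s c Fin.zero (Fin.suc y)) (d c)
              (dev (row y) c))) (∑-*ʳ (allFin n) (d c) _))))
            (≈-trans (+-congˡ (+-congʳ (≈-trans (∑-cong (allFin n)
              (λ y → solve 3 (λ a b e → a :* (e :* b) := a :* e :* b) ≈-refl (s c (Fin.suc y) Fin.zero) (d c)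
              (dev (row y) c))) (∑-*ʳ (allFin n) (d c) _))))
            (≈-trans (solve 5 (λ h a b e t → h :+ a :* e :+ (b :* e :+ t) := h :+ (a :+ b) :* e :+ t) ≈-refl _ _ _ (d c) (tail c))
             (+-congʳ (+-congˡ (*-congʳ (≈-trans (≈-sym (∑-+ (allFin n) _ _))
               (∑-cong (allFin n) (λ y → ≈-sym (distribʳ _ _ _)))))))))))
          bound : ∑[ L ] full ≤ ∑[ L ] (λ c → ∑ᵥ λ y → s c y y)
          bound = begin
            ∑[ L ] full                                    ≈⟨ ≈-trans (∑-cong L expand)
              (≈-trans (∑-+ L _ _) (+-congʳ (∑-+ L _ _))) ⟩
            ∑[ L ] (λ c → s c Fin.zero Fin.zero * (d c * d c)) + ∑[ L ] (λ c → ℓ c * d c) + ∑[ L ] tail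
              ≤⟨ +-mono-≤ (+-mono-≤ (∑-mono-∈ L (λ c i → ≤-respʳ (*-identityʳ _)
                (*-monoˡ-≤ (s≥0 c Fin.zero) (dev²≤1 head i)))) (proj₂ (proj₂ best))) (proj₂ (proj₂ rest)) ⟩
            ∑[ L ] (λ c → s c Fin.zero Fin.zero) + 0# + ∑[ L ] (λ c → ∑ᵥ λ y → s c (Fin.suc y) (Fin.suc y))
              ≈⟨ ≈-trans (+-congʳ (+-identityʳ _)) (≈-trans (≈-sym (∑-+ L _ _)) (∑-cong L (λ c → ≈-sym (∑ᵥ-suc {n} _)))) ⟩
            ∑[ L ] (λ c → ∑ᵥ λ y → s c y y)                ∎
            where open ≤R

        ∑₂-≤ : ∀ {n} (f : Kernel n) {c} → (∀ u v → f u v ≤ c) → ∑₂ f ≤ fromℕ n * (fromℕ n * c)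
        ∑₂-≤ {n} f {c} h = ≤-respʳ (*-cong len (*-congʳ len)) (∑-≤const (allFin n) _ (λ u → ∑-≤const (allFin n) c (h u)))
          where
          len : fromℕ (length (allFin n)) ≈ fromℕ n
          len = ≈-reflexive (≡.cong fromℕ (length-allFin n))

        ∑ᵥ-≤ : ∀ {n} (f : Fin n → Carrier) {c} → (∀ u → f u ≤ c) → ∑ᵥ f ≤ fromℕ n * c
        ∑ᵥ-≤ {n} f {c} h = ≤-respʳ (*-congʳ (≈-reflexive (≡.cong fromℕ (length-allFin n)))) (∑-≤const (allFin n) c h)

        masked²≤1 : ∀ {t} a {c} → Ind t → c ∈ L → (t * dev a c) * (t * dev a c) ≤ 1#
        masked²≤1 {t} a {c} i j = ≤-respˡ (≈-trans (*-congʳ (≈-sym (ind-idem i)))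
          (solve 2 (λ t d → t :* t :* (d :* d) := t :* d :* (t :* d)) ≈-refl t (dev a c)))
          (≤-respʳ (*-identityˡ 1#) (*-mono-≤ (0≤x² _) (ind-≥0 i) (ind-≤1 i) (dev²≤1 a j)))

        gram-diag≥0 : ∀ {k n} (h : Fin k → Fin n → Carrier) φ c y → 0# ≤ gram h φ c y y
        gram-diag≥0 {k} h φ c y = ∑-≥0 (allFin k) (λ u → 0≤x² _)

        gram-diag≤ : ∀ {k n} (h : Fin k → Fin n → Carrier) → (∀ u y → Ind (h u y)) → ∀ φ {c} → c ∈ L → ∀ y →
          gram h φ c y y ≤ fromℕ k
        gram-diag≤ {k} h ind φ i y = ≤-respʳ (*-identityʳ _) (∑ᵥ-≤ {k} _ (λ u → masked²≤1 (φ u y) (ind u y) i))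

        -- Each row adds O(n²) to the total squared correlation of the columns, as independent random rows would.
        favourable-matrix : ∀ k {n K} (h : Fin k → Fin n → Carrier) → (∀ u y → Ind (h u y)) → fromℕ k ≤ K →
          Σ[ φ ∈ (Fin k → Fin n → ℕ) ] ((∀ u y → Usable (φ u y)) ×
            ∑[ L ] (λ c → ∑₂ λ y y′ → gram h φ c y y′ * gram h φ c y y′) ≤ fromℕ k * (M * (fromℕ n * (2# * K + fromℕ n))))
        favourable-matrix zero {n} h ind le = (λ ()) , (λ ()) ,
          ≤-reflexive (≈-trans (≈-trans (∑-cong L (λ c → ≈-trans (∑₂-cong {n} (λ y y′ → zeroˡ 0#))
            (≈-trans (∑-cong (allFin n) (λ _ → ∑-zero (allFin n))) (∑-zero (allFin n))))) (∑-zero L)) (≈-sym (zeroˡ _)))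
        favourable-matrix (suc k) {n} {K} h ind le = extend-matrix , usable , bound
          where
          h′ : Fin k → Fin n → Carrier
          h′ u = h (Fin.suc u)
          -- K bounds the number of rows throughout the recursion, so that every step has the same
          -- cost.
          k≤K : fromℕ k ≤ K
          k≤K = ≤-trans (≤-by 0≤1 (+-comm 1# (fromℕ k))) le
          rest : Σ[ φ ∈ (Fin k → Fin n → ℕ) ] ((∀ u y → Usable (φ u y)) ×
            ∑[ L ] (λ c → ∑₂ λ y y′ → gram h′ φ c y y′ * gram h′ φ c y y′) ≤ fromℕ k * (M * (fromℕ n * (2# * K + fromℕ n))))
          rest = favourable-matrix k h′ (λ u → ind (Fin.suc u)) k≤K
          φ′ : Fin k → Fin n → ℕ
          φ′ = proj₁ rest
          S : ℕ → Kernel n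
          S = gram h′ φ′
          h₀ : Fin n → Carrier
          h₀ = h Fin.zero
          -- A new row adds a product of two entries to each Gram entry. Squaring the sum leaves
          -- twice this quadratic form as cross term, and it is what the new row has to keep small.
          s : ℕ → Kernel n
          s c y y′ = S c y y′ * (h₀ y * h₀ y′)
          s≥0 : ∀ c y → 0# ≤ s c y y
          s≥0 c y = *-nonNeg (gram-diag≥0 h′ φ′ c y) (0≤x² (h₀ y))
          next : Σ[ row ∈ (Fin n → ℕ) ] ((∀ y → Usable (row y)) ×
            ∑[ L ] (λ c → ∑₂ λ y y′ → s c y y′ * (dev (row y) c * dev (row y′) c)) ≤ ∑[ L ] (λ c → ∑ᵥ λ y → s c y y))
          next = favourable-row s s≥0
          row : Fin n → ℕ
          row = proj₁ next
          extend-matrix : Fin (suc k) → Fin n → ℕ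
          extend-matrix Fin.zero = row
          extend-matrix (Fin.suc u) = φ′ u
          usable : ∀ u y → Usable (extend-matrix u y)
          usable Fin.zero = proj₁ (proj₂ next)
          usable (Fin.suc u) = proj₁ (proj₂ rest) u
          ρ : ℕ → Fin n → Carrier
          ρ c y = h₀ y * dev (row y) c
          cross : ℕ → Carrier
          cross c = ∑₂ λ y y′ → s c y y′ * (dev (row y) c * dev (row y′) c)
          old new : ℕ → Carrier
          old c = ∑₂ λ y y′ → S c y y′ * S c y y′
          new c = ∑₂ λ y y′ → (ρ c y * ρ c y) * (ρ c y′ * ρ c y′)
          full : ℕ → Kernel n
          full = gram h extend-matrix
          expand : ∀ c → ∑₂ (λ y y′ → full c y y′ * full c y y′) ≈ old c + 2# * cross c + new c
          expand c = ≈-trans (∑₂-cong {n} (λ y y′ → ≈-trans (*-cong (∑ᵥ-suc {k} _) (∑ᵥ-suc {k} _))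
              (solve 5 (λ S h d h′ d′ → (h :* d :* (h′ :* d′) :+ S) :* (h :* d :* (h′ :* d′) :+ S) :=
                  S :* S :+ :2 :* (S :* (h :* h′) :* (d :* d′)) :+ (h :* d) :* (h :* d) :* ((h′ :* d′) :* (h′ :* d′))) ≈-refl
                (S c y y′) (h₀ y) (dev (row y) c) (h₀ y′) (dev (row y′) c))))
            (≈-trans (∑₂-+ _ _) (+-congʳ (≈-trans (∑₂-+ _ _) (+-congˡ (∑₂-*ˡ {n} 2# _)))))
            where
            ∑₂-+ : (f g : Kernel n) → ∑₂ (λ u v → f u v + g u v) ≈ ∑₂ f + ∑₂ g
            ∑₂-+ f g = ≈-trans (∑-cong (allFin n) (λ u → ∑-+ (allFin n) (f u) (g u))) (∑-+ (allFin n) _ _)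
          diag : ∑[ L ] (λ c → ∑ᵥ λ y → s c y y) ≤ M * (fromℕ n * K)
          diag = ≤-respʳ (∑-const L _) (∑-mono-∈ L (λ c i → ∑ᵥ-≤ {n} _ (λ y → ≤-trans (≤-respʳ (*-identityʳ _)
            (*-mono-≤ (0≤x² (h₀ y)) (gram-diag≥0 h′ φ′ c y) (gram-diag≤ h′ (λ u → ind (Fin.suc u)) φ′ i y)
              (≤-respʳ (*-identityʳ 1#) (*-mono-≤ (ind-≥0 (ind Fin.zero y)) (ind-≥0 (ind Fin.zero y))
                (ind-≤1 (ind Fin.zero y)) (ind-≤1 (ind Fin.zero y)))))) k≤K)))
          fresh : ∑[ L ] new ≤ M * (fromℕ n * (fromℕ n * 1#))
          fresh = ≤-respʳ (∑-const L _) (∑-mono-∈ L (λ c i → ∑₂-≤ {n} _ (λ y y′ → ≤-respʳ (*-identityʳ 1#)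
            (*-mono-≤ (0≤x² _) (0≤x² _) (masked²≤1 (row y) (ind Fin.zero y) i) (masked²≤1 (row y′) (ind Fin.zero y′) i)))))
          bound : ∑[ L ] (λ c → ∑₂ λ y y′ → full c y y′ * full c y y′) ≤ fromℕ (suc k) * (M * (fromℕ n * (2# * K + fromℕ n)))
          bound = begin
            ∑[ L ] (λ c → ∑₂ λ y y′ → full c y y′ * full c y y′)   ≈⟨ ≈-trans (∑-cong L expand)
              (≈-trans (∑-+ L _ _) (+-congʳ (≈-trans (∑-+ L _ _) (+-congˡ (∑-*ˡ L 2# cross))))) ⟩
            ∑[ L ] old + 2# * ∑[ L ] cross + ∑[ L ] new           ≤⟨ +-mono-≤
              (+-mono-≤ (proj₂ (proj₂ rest)) (*-monoˡ-≤ 0≤2 (≤-trans (proj₂ (proj₂ next)) diag))) fresh ⟩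
            fromℕ k * (M * (fromℕ n * (2# * K + fromℕ n))) + 2# * (M * (fromℕ n * K)) + M * (fromℕ n * (fromℕ n * 1#))
              ≈⟨ solve 4 (λ k m n K → k :* (m :* (n :* (:2 :* K :+ n))) :+ :2 :* (m :* (n :* K)) :+ m :* (n :* (n :* :1)) :=
                   (:1 :+ k) :* (m :* (n :* (:2 :* K :+ n)))) ≈-refl (fromℕ k) M (fromℕ n) K ⟩
            fromℕ (suc k) * (M * (fromℕ n * (2# * K + fromℕ n)))  ∎
            where open ≤R

        -- Cauchy-Schwarz twice: over the rows, which turns the squared rectangle sum into a sum of
        -- Gram entries, and then over pairs of columns, which squares those entries. Dropping the
        -- indicators a and b only increases the sums of squares.
        rectangle⁴ : ∀ {n} (h : Kernel n) → IndKer h → ∀ φ (a b : Fin n → Carrier) → IndVec a → IndVec b → ∀ {c} → c ∈ L →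
          let Z = rectangle-sum h φ a b c; N = fromℕ n in
          (Z * Z) * (Z * Z) ≤ N * N * (N * N) * ∑[ L ] (λ c → ∑₂ λ y y′ → gram h φ c y y′ * gram h φ c y y′)
        rectangle⁴ {n} h ind φ a b ia ib {c} i = begin
          (Z * Z) * (Z * Z)             ≤⟨ *-mono-≤ (0≤x² Z) (0≤x² Z) Z²≤NY Z²≤NY ⟩
          N * Y * (N * Y)               ≈⟨ solve 2 (λ N Y → N :* Y :* (N :* Y) := N :* N :* (Y :* Y)) ≈-refl N Y ⟩
          N * N * (Y * Y)               ≤⟨ *-monoˡ-≤ (0≤x² N) Y²≤ ⟩
          N * N * (N * (N * G))         ≈⟨ solve 2 (λ N G → N :* N :* (N :* (N :* G)) := N :* N :* (N :* N) :* G) ≈-refl N G ⟩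
          N * N * (N * N) * G           ≤⟨ *-monoˡ-≤ (0≤x² (N * N))
            (∑-term-≤ L (λ c → ∑-≥0 (allFin n) (λ y → ∑-≥0 (allFin n) (λ y′ → 0≤x² _))) i) ⟩
          N * N * (N * N) * ∑[ L ] (λ c → ∑₂ λ y y′ → gram h φ c y y′ * gram h φ c y y′) ∎
          where
          open ≤R
          N Z : Carrier
          N = fromℕ n
          Z = rectangle-sum h φ a b c
          f : Kernel n
          f u y = h u y * dev (φ u y) c
          R : Fin n → Carrier
          R u = ∑ᵥ λ y → b y * f u y
          Q : Kernel n
          Q y y′ = b y * b y′ * gram h φ c y y′
          Y G : Carrier
          Y = ∑₂ Q
          G = ∑₂ λ y y′ → gram h φ c y y′ * gram h φ c y y′
          cs : (g : Fin n → Carrier) → ∑ᵥ g * ∑ᵥ g ≤ N * ∑ᵥ λ i → g i * g i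
          cs g = ≤-respʳ (*-congʳ (≈-reflexive (≡.cong fromℕ (length-allFin n)))) (∑-cauchy-schwarz (allFin n) g)
          drop-ind : ∀ {t} y → Ind t → (t * y) * (t * y) ≤ y * y
          drop-ind {t} y i = ≤-respˡ (≈-trans (*-congʳ (≈-sym (ind-idem i)))
            (solve 2 (λ t y → t :* t :* (y :* y) := t :* y :* (t :* y)) ≈-refl t y))
            (≤-respʳ (*-identityˡ _) (*-monoʳ-≤ (0≤x² y) (ind-≤1 i)))
          Z≈ : Z ≈ ∑ᵥ λ u → a u * R u
          Z≈ = ∑-cong (allFin n) (λ u → ≈-trans (∑-cong (allFin n) (λ y → *-assoc _ _ _)) (∑-*ˡ (allFin n) (a u) _))
          ΣR²≈ : ∑ᵥ (λ u → R u * R u) ≈ Y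
          ΣR²≈ = ≈-trans (∑-cong (allFin n) (λ u → ∑-double (allFin n) (allFin n) _ _)) (≈-trans (∑₃-swap₁₂ {n} _)
            (≈-trans (∑-cong (allFin n) (λ y → ∑-comm (allFin n) (allFin n) _)) (∑₂-cong {n} (λ y y′ →
              ≈-trans (∑-cong (allFin n) (λ u → solve 4 (λ a b c d → a :* b :* (c :* d) := a :* c :* (b :* d)) ≈-refl
                (b y) (f u y) (b y′) (f u y′)))
                (∑-*ˡ (allFin n) (b y * b y′) _)))))
          Z²≤NY : Z * Z ≤ N * Y
          Z²≤NY = ≤-respˡ (≈-sym (*-cong Z≈ Z≈)) (≤-trans (cs _) (*-monoˡ-≤ (0≤fromℕ n)
            (≤-trans (∑-mono (allFin n) (λ u → drop-ind (R u) (ia u))) (≤-reflexive ΣR²≈))))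
          Y²≤ : Y * Y ≤ N * (N * G)
          Y²≤ = ≤-trans (cs _) (*-monoˡ-≤ (0≤fromℕ n) (≤-trans (∑-mono (allFin n) (λ y → ≤-trans (cs (Q y))
            (*-monoˡ-≤ (0≤fromℕ n) (∑-mono (allFin n) (λ y′ → drop-ind (gram h φ c y y′) (ind-* (ib y) (ib y′)))))))
              (≤-reflexive (∑-*ˡ (allFin n) N _))))

        quasirandom-colouring : ∀ {κ} → 0# < κ → ∃[ n₀ ] (∀ n → n₀ ℕ.≤ n → (h : Kernel n) → IndKer h →
          Σ[ φ ∈ (Fin n → Fin n → ℕ) ] ((∀ u v → Usable (φ u v)) ×
            (∀ c → c ∈ L → Cut (κ * (fromℕ n * fromℕ n)) (λ u v → h u v * 𝟙 (φ u v ℕ.≟ c)) (λ u v → x c * h u v))))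
        quasirandom-colouring {κ} κ>0 = proj₁ large , λ n n₀≤n h ind →
          let φ , usable , Ψ = favourable-matrix n {n} {fromℕ n} h ind ≤-refl in
          φ , usable , λ c i → mkCut (λ a b ia ib → near n h φ c a b (rectangle-≤ n n₀≤n h ind φ Ψ a b ia ib i))
          where
          κ⁴ : Carrier
          κ⁴ = (κ * κ) * (κ * κ)
          κ⁴>0 : 0# < κ⁴
          κ⁴>0 = 0<-* (0<-* κ>0 κ>0) (0<-* κ>0 κ>0)
          -- The squared Gram entries sum to at most 3 M n³, so the fourth power of a rectangle sum
          -- is at most 3 M n⁷; this is below (κ n²)⁴ as soon as 3 M ≤ κ⁴ n.
          large : ∃[ n₀ ] (∀ n → n₀ ℕ.≤ n → 3# * M ≤ κ⁴ * fromℕ n)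
          large =
            let i , κ⁴i≈1 , i>0 = inverse>0 κ⁴>0
                n₀ , le = archimedean (i * (3# * M))
            in n₀ , λ n p → ≤-trans (≤-reflexive (≈-trans (≈-sym (*-identityˡ _))
              (≈-trans (*-congʳ (≈-sym κ⁴i≈1)) (*-assoc κ⁴ i _))))
              (*-monoˡ-≤ (<⇒≤ κ⁴>0) (≤-trans le (fromℕ-mono p)))
          rectangle-≤ : ∀ n → proj₁ large ℕ.≤ n → (h : Kernel n) → IndKer h → ∀ φ →
            ∑[ L ] (λ c → ∑₂ λ y y′ → gram h φ c y y′ * gram h φ c y y′) ≤ fromℕ n * (M * (fromℕ n * (2# * fromℕ n + fromℕ n))) →
            ∀ a b → IndVec a → IndVec b → ∀ {c} → c ∈ L →
            let Z = rectangle-sum h φ a b c; B = κ * (fromℕ n * fromℕ n) in Z * Z ≤ B * B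
          rectangle-≤ n p h ind φ Ψ a b ia ib {c} i = x²-mono⁻ (0≤x² B) (begin
            (Z * Z) * (Z * Z)                    ≤⟨ rectangle⁴ h ind φ a b ia ib i ⟩
            N * N * (N * N) * _                  ≤⟨ *-monoˡ-≤ (0≤x² (N * N)) Ψ ⟩
            N * N * (N * N) * (N * (M * (N * (2# * N + N)))) ≈⟨ solve 2
              (λ N M → N :* N :* (N :* N) :* (N :* (M :* (N :* (:2 :* N :+ N)))) := N :* N :* (N :* N) :*
              (N :* N :* N) :* (:3 :* M)) ≈-refl N M ⟩
            N * N * (N * N) * (N * N * N) * (3# * M) ≤⟨ *-monoˡ-≤
              (*-nonNeg (0≤x² (N * N)) (*-nonNeg (0≤x² N) (0≤fromℕ n))) (proj₂ large n p) ⟩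
            N * N * (N * N) * (N * N * N) * (κ⁴ * N) ≈⟨ solve 2
              (λ N k → N :* N :* (N :* N) :* (N :* N :* N) :* (k :* k :* (k :* k) :* N) := k :* (N :* N) :*
              (k :* (N :* N)) :* (k :* (N :* N) :* (k :* (N :* N)))) ≈-refl N κ ⟩
            (B * B) * (B * B)                    ∎)
            where
            open ≤R
            N B Z : Carrier
            N = fromℕ n
            B = κ * (N * N)
            Z = rectangle-sum h φ a b c
          near : ∀ n (h : Kernel n) φ c (a b : Fin n → Carrier) → rectangle-sum h φ a b c * rectangle-sum h φ a b c ≤
            (κ * (fromℕ n * fromℕ n)) * (κ * (fromℕ n * fromℕ n)) →
            Near (κ * (fromℕ n * fromℕ n)) (∑₂ λ u v → a u * b v * (h u v * 𝟙 (φ u v ℕ.≟ c)))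
              (∑₂ λ u v → a u * b v * (x c * h u v))
          near n h φ c a b q =
            ≤-by (x≤y⇒0≤y-x (x²-mono⁻ B≥0 q)) (≈-trans
              (solve 3 (λ F G B → G :+ B := F :+ (B :- (F :- G))) ≈-refl F G B) (+-congˡ (+-congˡ (-‿cong (≈-sym Z≈))))) &
            ≤-by (x≤y⇒0≤y-x (x²-mono⁻ B≥0 (≤-respˡ (solve 1 (λ z → z :* z := :- z :* :- z) ≈-refl Z) q)))
              (≈-trans (solve 3 (λ F G B → F :+ B := G :+ (B :- (:- (F :- G)))) ≈-refl F G B)
                (+-congˡ (+-congˡ (-‿cong (-‿cong (≈-sym Z≈))))))
            where
            F′ G′ : Kernel n
            F′ u v = a u * b v * (h u v * 𝟙 (φ u v ℕ.≟ c))
            G′ u v = a u * b v * (x c * h u v)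
            B F G Z : Carrier
            B = κ * (fromℕ n * fromℕ n)
            F = ∑₂ F′
            G = ∑₂ G′
            Z = rectangle-sum h φ a b c
            B≥0 : 0# ≤ B
            B≥0 = *-nonNeg (<⇒≤ κ>0) (0≤x² (fromℕ n))
            Z≈ : Z ≈ F - G
            Z≈ = ≈-trans (∑₂-cong {n} (λ u v → solve 4
              (λ r h t y → r :* (h :* (t :- y)) := r :* (h :* t) :- r :* (y :* h)) ≈-refl (a u * b v) (h u v)
              (𝟙 (φ u v ℕ.≟ c)) (x c)))
              (≈-trans (∑-cong (allFin n) (λ u → ∑-- (allFin n) (F′ u) (G′ u)))
                (∑-- (allFin n) (λ u → ∑ᵥ (F′ u)) (λ u → ∑ᵥ (G′ u))))

  open QuasirandomColourings

  -- Density as weighted sums, and the family of uncolourable graphs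

  module Colourings where

    private
      variable
        n : ℕ

    ind : Subset n → Fin n → Carrier
    ind X v = 𝟙 (v ∈? X)

    abstract
      ind-suc : ∀ b (X : Subset n) v → ind (b ∷ X) (Fin.suc v) ≈ ind X v
      ind-suc b X v = 𝟙-cong (Fin.suc v ∈? (b ∷ X)) (v ∈? X) drop-there Vec.there

      fromℕ-∣∣ : (X : Subset n) → fromℕ ∣ X ∣ ≈ ∑ᵥ (ind X)
      fromℕ-∣∣ [] = ≈-refl
      fromℕ-∣∣ {suc n} (true ∷ X) = ≈-trans (+-congˡ (fromℕ-∣∣ X)) (≈-sym (≈-trans (∑ᵥ-suc {n} (ind (true ∷ X)))
        (+-cong (𝟙-yes (Fin.zero ∈? (true ∷ X)) Vec.here) (∑-cong (allFin n) (ind-suc true X)))))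
      fromℕ-∣∣ {suc n} (false ∷ X) = ≈-trans (fromℕ-∣∣ X) (≈-sym (≈-trans (∑ᵥ-suc {n} (ind (false ∷ X)))
        (≈-trans (+-cong (𝟙-no (Fin.zero ∈? (false ∷ X)) (λ ())) (∑-cong (allFin n) (ind-suc false X))) (+-identityˡ _))))

      fromℕ-pairs : {C : Fin n × Fin n → Set} (C? : ∀ t → Dec (C t)) → fromℕ (#[ pairs n ] C?) ≈ ∑₂ λ y z → 𝟙 (C? (y , z))
      fromℕ-pairs {n} C? = ≈-trans (fromℕ-count C? (pairs n)) (∑-cartesianProduct (allFin n) (allFin n) _)

      fromℕ-triples : {C : Fin n × Fin n × Fin n → Set} (C? : ∀ t → Dec (C t)) →
        fromℕ (#[ triples n ] C?) ≈ ∑₃ λ x y z → 𝟙 (C? (x , y , z))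
      fromℕ-triples {n} C? = ≈-trans (fromℕ-count C? (triples n)) (≈-trans (∑-cartesianProduct (allFin n) (pairs n) _)
        (∑-cong (allFin n) (λ x → ∑-cartesianProduct (allFin n) (allFin n) _)))

    edge : (H : 3Graph) → Kernel₃ (order H)
    edge H x y z = 𝟙 (edges H ∋? triple x y z)

    linked : UniformSet 2 n → Kernel n
    linked P x y = 𝟙 (P ∋? pair x y)

    below? : Kernel n
    below? x y = 𝟙 (x Fin.<? y)

    test-vvv : (X Y Z : Subset n) → Kernel₃ n
    test-vvv X Y Z x y z = ind X x * (ind Y y * ind Z z)

    test-ev : Subset n → UniformSet 2 n → Kernel₃ n
    test-ev X P x y z = ind X x * (below? y z * linked P y z)

    test-ee : (P Q : UniformSet 2 n) → Kernel₃ n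
    test-ee P Q x y z = linked P x y * linked Q y z

    -- All modes ask for the same inequality and differ only in the kernel `T`; the bounds can thus
    -- be proved for kernels instead of sets.
    DenseFor : Carrier → Carrier → (H : 3Graph) → Kernel₃ (order H) → Set
    DenseFor d η H T = d * ∑₃ T - η * fromℕ (order H ℕ.^ 3) ≤ ∑₃ λ x y z → T x y z * edge H x y z

    abstract
      volume-vvv : (X Y Z : Subset n) → fromℕ (∣ X ∣ ℕ.* ∣ Y ∣ ℕ.* ∣ Z ∣) ≈ ∑₃ (test-vvv X Y Z)
      volume-vvv {n} X Y Z = ≈-trans (fromℕ-* (∣ X ∣ ℕ.* ∣ Y ∣) ∣ Z ∣) (≈-trans (*-congʳ (fromℕ-* ∣ X ∣ ∣ Y ∣))
        (≈-trans (*-cong (*-cong (fromℕ-∣∣ X) (fromℕ-∣∣ Y)) (fromℕ-∣∣ Z)) (≈-trans (*-assoc _ _ _)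
        (≈-trans (*-congˡ (∑-double (allFin n) (allFin n) (ind Y) (ind Z))) (≈-trans (∑-double (allFin n) (allFin n) (ind X) _)
          (∑₂-cong {n} (λ x y → ≈-sym (∑-*ˡ (allFin n) (ind X x) _))))))))

      volume-ev : (X : Subset n) (P : UniformSet 2 n) → fromℕ (∣ X ∣ ℕ.* ∣ P ∣₂) ≈ ∑₃ (test-ev X P)
      volume-ev {n} X P = ≈-trans (fromℕ-* ∣ X ∣ ∣ P ∣₂) (≈-trans (*-cong (fromℕ-∣∣ X)
          (≈-trans (fromℕ-pairs {n} (λ (y , z) → (y Fin.<? z) ×-dec (P ∋? pair y z)))
            (∑₂-cong {n} (λ y z → 𝟙-× (y Fin.<? z) (P ∋? pair y z)))))
        (≈-trans (∑-double (allFin n) (allFin n) (ind X) _) (∑₂-cong {n} (λ x y → ≈-sym (∑-*ˡ (allFin n) (ind X x) _)))))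

      volume-ee : (P Q : UniformSet 2 n) → fromℕ (∣Kee∣ P Q) ≈ ∑₃ (test-ee P Q)
      volume-ee {n} P Q = ≈-trans (fromℕ-triples {n} (λ (x , y , z) → (P ∋? pair x y) ×-dec (Q ∋? pair y z)))
        (∑₃-cong {n} (λ x y z → 𝟙-× (P ∋? pair x y) (Q ∋? pair y z)))

      edges-vvv : (H : 3Graph) (X Y Z : Subset (order H)) → fromℕ (e-vvv H X Y Z) ≈ ∑₃ λ x y z →
        test-vvv X Y Z x y z * edge H x y z
      edges-vvv H X Y Z = ≈-trans (fromℕ-triples {order H}
        (λ (x , y , z) → (x ∈? X) ×-dec (y ∈? Y) ×-dec (z ∈? Z) ×-dec (edges H ∋? triple x y z)))
        (∑₃-cong {order H} (λ x y z → ≈-trans (𝟙-× (x ∈? X) ((y ∈? Y) ×-dec (z ∈? Z) ×-dec (edges H ∋? triple x y z)))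
          (≈-trans (*-congˡ (≈-trans (𝟙-× (y ∈? Y) ((z ∈? Z) ×-dec (edges H ∋? triple x y z)))
          (*-congˡ (𝟙-× (z ∈? Z) (edges H ∋? triple x y z)))))
          (solve 4 (λ a b c e → a :* (b :* (c :* e)) := a :* (b :* c) :* e) ≈-refl (ind X x) (ind Y y) (ind Z z)
            (edge H x y z)))))

      edges-ev : (H : 3Graph) (X : Subset (order H)) (P : UniformSet 2 (order H)) → fromℕ (e-ev H X P) ≈ ∑₃ λ x y z →
        test-ev X P x y z * edge H x y z
      edges-ev H X P = ≈-trans (fromℕ-triples {order H}
        (λ (x , y , z) → (x ∈? X) ×-dec (y Fin.<? z) ×-dec (P ∋? pair y z) ×-dec (edges H ∋? triple x y z)))
        (∑₃-cong {order H} (λ x y z → ≈-trans (𝟙-× (x ∈? X)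
          ((y Fin.<? z) ×-dec (P ∋? pair y z) ×-dec (edges H ∋? triple x y z)))
          (≈-trans (*-congˡ (≈-trans (𝟙-× (y Fin.<? z) ((P ∋? pair y z) ×-dec (edges H ∋? triple x y z)))
          (*-congˡ (𝟙-× (P ∋? pair y z) (edges H ∋? triple x y z)))))
          (solve 4 (λ a b c e → a :* (b :* (c :* e)) := a :* (b :* c) :* e) ≈-refl (ind X x) (below? y z)
            (linked P y z) (edge H x y z)))))

      edges-ee : (H : 3Graph) (P Q : UniformSet 2 (order H)) → fromℕ (e-ee H P Q) ≈ ∑₃ λ x y z → test-ee P Q x y z * edge H x y z
      edges-ee H P Q = ≈-trans (fromℕ-triples {order H}
        (λ (x , y , z) → (P ∋? pair x y) ×-dec (Q ∋? pair y z) ×-dec (edges H ∋? triple x y z)))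
        (∑₃-cong {order H} (λ x y z → ≈-trans (𝟙-× (P ∋? pair x y) ((Q ∋? pair y z) ×-dec (edges H ∋? triple x y z)))
          (≈-trans (*-congˡ (𝟙-× (Q ∋? pair y z) (edges H ∋? triple x y z))) (≈-sym (*-assoc _ _ _)))))

      private
        transfer : ∀ {d e y y′ z z′} → y ≈ y′ → z ≈ z′ → d * y - e ≤ z → d * y′ - e ≤ z′
        transfer p q h = ≤-respˡ (+-congʳ (*-congˡ p)) (≤-respʳ q h)

      dense-vvv⁻ : ∀ {d η H} → Dense ℝ vvv d η H → ∀ X Y Z → DenseFor d η H (test-vvv X Y Z)
      dense-vvv⁻ {H = H} D X Y Z = transfer (volume-vvv X Y Z) (edges-vvv H X Y Z) (D X Y Z)

      dense-ev⁻ : ∀ {d η H} → Dense ℝ ev d η H → ∀ X P → DenseFor d η H (test-ev X P)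
      dense-ev⁻ {H = H} D X P = transfer (volume-ev X P) (edges-ev H X P) (D X P)

      dense-ee⁻ : ∀ {d η H} → Dense ℝ ee d η H → ∀ P Q → DenseFor d η H (test-ee P Q)
      dense-ee⁻ {H = H} D P Q = transfer (volume-ee P Q) (edges-ee H P Q) (D P Q)

      dense-vvv⁺ : ∀ {d η H} → (∀ X Y Z → DenseFor d η H (test-vvv X Y Z)) → Dense ℝ vvv d η H
      dense-vvv⁺ {H = H} D X Y Z = transfer (≈-sym (volume-vvv X Y Z)) (≈-sym (edges-vvv H X Y Z)) (D X Y Z)

      dense-ev⁺ : ∀ {d η H} → (∀ X P → DenseFor d η H (test-ev X P)) → Dense ℝ ev d η H
      dense-ev⁺ {H = H} D X P = transfer (≈-sym (volume-ev X P)) (≈-sym (edges-ev H X P)) (D X P)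

      dense-ee⁺ : ∀ {d η H} → (∀ P Q → DenseFor d η H (test-ee P Q)) → Dense ℝ ee d η H
      dense-ee⁺ {H = H} D P Q = transfer (≈-sym (volume-ee P Q)) (≈-sym (edges-ee H P Q)) (D P Q)

      ∈-pair⁻ : ∀ {v x y : Fin n} → v Sub.∈ pair x y → v ≡ x ⊎ v ≡ y
      ∈-pair⁻ {x = x} {y} p with x∈p∪q⁻ ⁅ x ⁆ ⁅ y ⁆ p
      ... | inj₁ q = inj₁ (x∈⁅y⁆⇒x≡y x q)
      ... | inj₂ q = inj₂ (x∈⁅y⁆⇒x≡y y q)

      ∈-pairˡ : ∀ (x y : Fin n) → x Sub.∈ pair x y
      ∈-pairˡ x y = x∈p∪q⁺ (inj₁ (x∈⁅x⁆ x))

      ∈-pairʳ : ∀ (x y : Fin n) → y Sub.∈ pair x y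
      ∈-pairʳ x y = x∈p∪q⁺ {p = ⁅ x ⁆} (inj₂ (x∈⁅x⁆ y))

      pair-comm : ∀ (x y : Fin n) → pair x y ≡ pair y x
      pair-comm x y = ∪-comm ⁅ x ⁆ ⁅ y ⁆

      ∈-triple⁻ : ∀ {v x y z : Fin n} → v Sub.∈ triple x y z → v ≡ x ⊎ v ≡ y ⊎ v ≡ z
      ∈-triple⁻ {x = x} {y} {z} p with x∈p∪q⁻ ⁅ x ⁆ (⁅ y ⁆ ∪ ⁅ z ⁆) p
      ... | inj₁ q = inj₁ (x∈⁅y⁆⇒x≡y x q)
      ... | inj₂ q = inj₂ (∈-pair⁻ q)

      ∈-triple₁ : ∀ (x y z : Fin n) → x Sub.∈ triple x y z
      ∈-triple₁ x y z = x∈p∪q⁺ (inj₁ (x∈⁅x⁆ x))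

      ∈-triple₂ : ∀ (x y z : Fin n) → y Sub.∈ triple x y z
      ∈-triple₂ x y z = x∈p∪q⁺ {p = ⁅ x ⁆} (inj₂ (∈-pairˡ y z))

      ∈-triple₃ : ∀ (x y z : Fin n) → z Sub.∈ triple x y z
      ∈-triple₃ x y z = x∈p∪q⁺ {p = ⁅ x ⁆} (inj₂ (∈-pairʳ y z))

      triple-swap₂₃ : ∀ (x y z : Fin n) → triple x y z ≡ triple x z y
      triple-swap₂₃ x y z = ≡.cong (⁅ x ⁆ ∪_) (pair-comm y z)

      triple-swap₁₂ : ∀ (x y z : Fin n) → triple x y z ≡ triple y x z
      triple-swap₁₂ x y z = ≡.trans (≡.sym (∪-assoc ⁅ x ⁆ ⁅ y ⁆ ⁅ z ⁆))
        (≡.trans (≡.cong (_∪ ⁅ z ⁆) (pair-comm x y)) (∪-assoc ⁅ y ⁆ ⁅ x ⁆ ⁅ z ⁆))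

      ∣⁅x⁆∪p∣ : ∀ (x : Fin n) (p : Subset n) → x ∉ p → ∣ ⁅ x ⁆ ∪ p ∣ ≡ suc ∣ p ∣
      ∣⁅x⁆∪p∣ Fin.zero (true ∷ p) x∉p = contradiction Vec.here x∉p
      ∣⁅x⁆∪p∣ Fin.zero (false ∷ p) x∉p = ≡.cong (λ q → suc ∣ q ∣) (∪-identityˡ p)
      ∣⁅x⁆∪p∣ (Fin.suc x) (true ∷ p) x∉p = ≡.cong suc (∣⁅x⁆∪p∣ x p (λ i → x∉p (Vec.there i)))
      ∣⁅x⁆∪p∣ (Fin.suc x) (false ∷ p) x∉p = ∣⁅x⁆∪p∣ x p (λ i → x∉p (Vec.there i))

      ∣pair∣ : ∀ {x y : Fin n} → x ≢ y → ∣ pair x y ∣ ≡ 2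
      ∣pair∣ {x = x} {y} x≢y = ≡.trans (∣⁅x⁆∪p∣ x ⁅ y ⁆ (λ i → x≢y (x∈⁅y⁆⇒x≡y y i))) (≡.cong suc (∣⁅x⁆∣≡1 y))

      ∣triple∣ : ∀ {x y z : Fin n} → x ≢ y → x ≢ z → y ≢ z → ∣ triple x y z ∣ ≡ 3
      ∣triple∣ {x = x} {y} {z} x≢y x≢z y≢z = ≡.trans (∣⁅x⁆∪p∣ x (pair y z) x∉) (≡.cong suc (∣pair∣ y≢z))
        where
        x∉ : x ∉ pair y z
        x∉ i with ∈-pair⁻ i
        ... | inj₁ e = x≢y e
        ... | inj₂ e = x≢z e

      pair-injective : ∀ {x y x′ y′ : Fin n} → pair x y ≡ pair x′ y′ → (x ≡ x′ × y ≡ y′) ⊎ (x ≡ y′ × y ≡ x′)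
      pair-injective {x = x} {y} {x′} {y′} e
        with ∈-pair⁻ (≡.subst (x Sub.∈_) e (∈-pairˡ x y)) | ∈-pair⁻ (≡.subst (y Sub.∈_) e (∈-pairʳ x y))
           | ∈-pair⁻ (≡.subst (x′ Sub.∈_) (≡.sym e) (∈-pairˡ x′ y′)) | ∈-pair⁻ (≡.subst (y′ Sub.∈_) (≡.sym e) (∈-pairʳ x′ y′))
      ... | inj₁ ≡.refl | inj₂ ≡.refl | _ | _ = inj₁ (≡.refl , ≡.refl)
      ... | inj₂ ≡.refl | inj₁ ≡.refl | _ | _ = inj₂ (≡.refl , ≡.refl)
      ... | inj₁ ≡.refl | inj₁ ≡.refl | _ | inj₁ ≡.refl = inj₁ (≡.refl , ≡.refl)
      ... | inj₁ ≡.refl | inj₁ ≡.refl | _ | inj₂ ≡.refl = inj₁ (≡.refl , ≡.refl)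
      ... | inj₂ ≡.refl | inj₂ ≡.refl | inj₁ ≡.refl | _ = inj₂ (≡.refl , ≡.refl)
      ... | inj₂ ≡.refl | inj₂ ≡.refl | inj₂ ≡.refl | _ = inj₂ (≡.refl , ≡.refl)

      -- The first and last entries are the least and the greatest element of the set, which leaves
      -- one possibility for the middle.
      sorted-triple-injective : ∀ {x y z x′ y′ z′ : Fin n} → x Fin.< y → y Fin.< z → x′ Fin.< y′ → y′ Fin.< z′ →
        triple x y z ≡ triple x′ y′ z′ → x ≡ x′ × y ≡ y′ × z ≡ z′
      sorted-triple-injective {n} {x} {y} {z} {x′} {y′} {z′} p q p′ q′ e = x≡ , y≡ , z≡
        where
        min : ∀ {v x y z : Fin n} → x Fin.< y → y Fin.< z → v Sub.∈ triple x y z → x Fin.≤ v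
        min p q i with ∈-triple⁻ i
        ... | inj₁ ≡.refl = ℕ.≤-refl
        ... | inj₂ (inj₁ ≡.refl) = ℕ.<⇒≤ p
        ... | inj₂ (inj₂ ≡.refl) = ℕ.<⇒≤ (ℕ.<-trans p q)
        max : ∀ {v x y z : Fin n} → x Fin.< y → y Fin.< z → v Sub.∈ triple x y z → v Fin.≤ z
        max p q i with ∈-triple⁻ i
        ... | inj₁ ≡.refl = ℕ.<⇒≤ (ℕ.<-trans p q)
        ... | inj₂ (inj₁ ≡.refl) = ℕ.<⇒≤ q
        ... | inj₂ (inj₂ ≡.refl) = ℕ.≤-refl
        x≡ : x ≡ x′
        x≡ = Fin.≤-antisym (min p q (≡.subst (x′ Sub.∈_) (≡.sym e) (∈-triple₁ x′ y′ z′)))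
          (min p′ q′ (≡.subst (x Sub.∈_) e (∈-triple₁ x y z)))
        z≡ : z ≡ z′
        z≡ = Fin.≤-antisym (max p′ q′ (≡.subst (z Sub.∈_) e (∈-triple₃ x y z)))
          (max p q (≡.subst (z′ Sub.∈_) (≡.sym e) (∈-triple₃ x′ y′ z′)))
        y≡ : y ≡ y′
        y≡ with ∈-triple⁻ (≡.subst (y Sub.∈_) e (∈-triple₂ x y z))
        ... | inj₁ y≡x′ = contradiction (≡.trans x≡ (≡.sym y≡x′)) (Fin.<⇒≢ p)
        ... | inj₂ (inj₁ y≡y′) = y≡y′
        ... | inj₂ (inj₂ y≡z′) = contradiction (≡.trans y≡z′ (≡.sym z≡)) (Fin.<⇒≢ q)

      edge-swap₂₃ : ∀ H x y z → edge H x y z ≈ edge H x z y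
      edge-swap₂₃ H x y z = ≈-reflexive (≡.cong (λ e → 𝟙 (edges H ∋? e)) (triple-swap₂₃ x y z))

      edge-swap₁₂ : ∀ H x y z → edge H x y z ≈ edge H y x z
      edge-swap₁₂ H x y z = ≈-reflexive (≡.cong (λ e → 𝟙 (edges H ∋? e)) (triple-swap₁₂ x y z))

    -- The order is an injective rank rather than the order of `Fin`, since embeddings need not be
    -- monotone: composed with an embedding, an injective rank is again one.
    record Colouring (𝓟 : Palette) (H : 3Graph) : Set where
      field
        rank           : Fin (order H) → ℕ
        rank-injective : ∀ {x y} → rank x ≡ rank y → x ≡ y
        -- Only the values colour x y with rank x < rank y matter.
        colour         : Fin (order H) → Fin (order H) → ℕ
        colour-∈       : ∀ x y → colour x y ∈ Φ 𝓟
        coloured       : ∀ x y z → rank x ℕ.< rank y → rank y ℕ.< rank z → edges H ∋ triple x y z →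
                         (colour x y , colour x z , colour y z) ∈ patterns 𝓟

    uncolourable : Palette → Family
    uncolourable 𝓟 F = ¬ Colouring 𝓟 F

    module _ (𝓟 : Palette) where

      open Colouring

      abstract
        -- An uncolourable graph belongs to the family and is contained in itself.
        free⇒colouring : ∀ {H} → H FreeOf uncolourable 𝓟 → Colouring 𝓟 H
        free⇒colouring {H} H-free with em {Colouring 𝓟 H}
        ... | yes C = C
        ... | no none = contradiction ((λ x → x) , (λ {x} {y} e → e) , (λ x y z i → i)) (H-free H none)

        -- A colouring pulls back along embeddings, so a colourable graph has no uncolourable
        -- subgraph.
        colouring⇒free : ∀ {H} → Colouring 𝓟 H → H FreeOf uncolourable 𝓟
        colouring⇒free C F none (f , f-inj , f-edge) = none (record
          { rank = λ x → C .rank (f x)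
          ; rank-injective = λ e → f-inj (C .rank-injective e)
          ; colour = λ x y → C .colour (f x) (f y)
          ; colour-∈ = λ x y → C .colour-∈ (f x) (f y)
          ; coloured = λ x y z p q i → C .coloured (f x) (f y) (f z) p q (f-edge x y z i)
          })

      module _ {n : ℕ} (φ : Fin n → Fin n → ℕ) where

        Patterned : Subset n → Set
        Patterned e = Σ[ x ∈ Fin n ] Σ[ y ∈ Fin n ] Σ[ z ∈ Fin n ]
          (x Fin.< y × y Fin.< z × e ≡ triple x y z × (φ x y , φ x z , φ y z) ∈ patterns 𝓟)

        pattern-graph : 3Graph
        pattern-graph .order = n
        pattern-graph .edges .member e = ⌊ em {Patterned e} ⌋
        pattern-graph .edges .uniform e i = let x , y , z , p , q , e≡ , _ = toWitness i in
          ≡.trans (≡.cong ∣_∣ e≡) (∣triple∣ (Fin.<⇒≢ p) (Fin.<⇒≢ (Fin.<-trans p q)) (Fin.<⇒≢ q))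

        abstract
          pattern-graph-edge : ∀ {x y z} → x Fin.< y → y Fin.< z → (φ x y , φ x z , φ y z) ∈ patterns 𝓟 →
            edges pattern-graph ∋ triple x y z
          pattern-graph-edge p q t = fromWitness (_ , _ , _ , p , q , ≡.refl , t)

          pattern-graph-colouring : (∀ x y → φ x y ∈ Φ 𝓟) → Colouring 𝓟 pattern-graph
          pattern-graph-colouring φ-∈ .rank = Fin.toℕ
          pattern-graph-colouring φ-∈ .rank-injective = Fin.toℕ-injective
          pattern-graph-colouring φ-∈ .colour = φ
          pattern-graph-colouring φ-∈ .colour-∈ = φ-∈
          pattern-graph-colouring φ-∈ .coloured x y z p q i with toWitness i
          ... | x′ , y′ , z′ , p′ , q′ , e , t with sorted-triple-injective p q p′ q′ e
          ...   | ≡.refl , ≡.refl , ≡.refl = t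

  open Colourings

  -- Counting edges of a patterned graph in the six vertex orders

  module OrderedTests where

    -- The value `true` marks a pair on which the test may depend arbitrarily: its colour is pinned,
    -- while the colours of the other pairs are averaged.
    slot : Bool → ℕ → Slot
    slot false c = nothing
    slot true  c = just c

    -- There is one factor for each of the three pairs, because the kernel of every pair carries its
    -- own `below?`.
    sorted : ∀ {n} → Kernel₃ n
    sorted u v w = below? u v * below? u w * below? v w

    abstract
      below-ind : ∀ {n} → IndKer (below? {n})
      below-ind u v = 𝟙-ind (u Fin.<? v)

      comparable : ∀ {n} (u v : Fin n) → below? u v + below? v u ≈ 1# - 𝟙 (u Fin.≟ v)
      comparable u v = go (Fin.<-cmp u v)
        where
        go : Tri (u Fin.< v) (u ≡ v) (v Fin.< u) → below? u v + below? v u ≈ 1# - 𝟙 (u Fin.≟ v)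
        go (tri< p ¬q ¬r) = ≈-trans (+-cong (𝟙-yes (u Fin.<? v) p) (𝟙-no (v Fin.<? u) ¬r))
          (≈-trans (solve 0 (:1 :+ :0 := :1 :- :0) ≈-refl) (+-congˡ (-‿cong (≈-sym (𝟙-no (u Fin.≟ v) ¬q)))))
        go (tri≈ ¬p q ¬r) = ≈-trans (+-cong (𝟙-no (u Fin.<? v) ¬p) (𝟙-no (v Fin.<? u) ¬r))
          (≈-trans (solve 0 (:0 :+ :0 := :1 :- :1) ≈-refl) (+-congˡ (-‿cong (≈-sym (𝟙-yes (u Fin.≟ v) q)))))
        go (tri> ¬p ¬q r) = ≈-trans (+-cong (𝟙-no (u Fin.<? v) ¬p) (𝟙-yes (v Fin.<? u) r))
          (≈-trans (solve 0 (:0 :+ :1 := :1 :- :0) ≈-refl) (+-congˡ (-‿cong (≈-sym (𝟙-no (u Fin.≟ v) ¬q)))))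

      sorted-≥0 : ∀ {n} (u v w : Fin n) → 0# ≤ sorted u v w
      sorted-≥0 u v w = ind-≥0 (ind-* (ind-* (below-ind u v) (below-ind u w)) (below-ind v w))

    abstract
      private
        pair-up : ∀ t g a b → t * a * g + t * b * g ≈ t * (a + b) * g
        pair-up = solve 4 (λ t g a b → t :* a :* g :+ t :* b :* g := t :* (a :+ b) :* g) ≈-refl

        six-terms : ∀ t g a b c d e f → t * a * g + t * b * g + t * c * g + t * d * g + t * e * g + t * f * g ≈ t *
          (a + b + c + d + e + f) * g
        six-terms t g a b c d e f = ≈-trans (+-congʳ (≈-trans (+-congʳ (≈-trans (+-congʳ (≈-trans (+-congʳ (pair-up t g a b))
          (pair-up t g _ c))) (pair-up t g _ d))) (pair-up t g _ e))) (pair-up t g _ f)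

        interchange : ∀ a x b y → (a + x) + (b + y) ≈ (a + b) + (x + y)
        interchange = solve 4 (λ a x b y → (a :+ x) :+ (b :+ y) := (a :+ b) :+ (x :+ y)) ≈-refl

        six-errors : ∀ a b c d e f x → (a + x) + (b + x) + (c + x) + (d + x) + (e + x) +
          (f + x) ≈ a + b + c + d + e + f + (x + x + x + x + x + x)
        six-errors a b c d e f x = ≈-trans (+-congʳ (≈-trans (+-congʳ (≈-trans (+-congʳ (≈-trans (+-congʳ (interchange a x b x))
          (interchange _ _ c x))) (interchange _ _ d x))) (interchange _ _ e x))) (interchange _ _ f x)

        swap-middle : ∀ y z t → y * z * t ≈ y * t * z
        swap-middle = solve 3 (λ y z t → y :* z :* t := y :* t :* z) ≈-refl

        -- Here a, b, c stand for u < v, u < w, v < w and primes for the reversed relations. The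
        -- first six products are the linear orders of u, v, w, the last two the cyclic ones.
        eight-terms : ∀ a a′ b b′ c c′ →
          a * b * c + b * a * c′ + a′ * c * b + c * a′ * b′ + b′ * c′ * a + c′ * b′ * a′ +
            (a * c * b′ + a′ * b * c′) ≈ (a + a′) * (b + b′) * (c + c′)
        eight-terms a a′ b b′ c c′ = ≈-trans
          (+-cong (+-cong (+-cong (+-cong (+-cong (+-cong ≈-refl (*-congʳ (*-comm b a))) (swap-middle a′ c b))
            (≈-trans (*-congʳ (*-comm c a′)) (swap-middle a′ c b′)))
            (≈-trans (*-comm _ a) (≈-sym (*-assoc a b′ c′))))
              (≈-trans (*-comm _ a′) (≈-trans (*-congˡ (*-comm c′ b′)) (≈-sym (*-assoc a′ b′ c′)))))
            (+-congʳ (swap-middle a c b′)))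
          (≈-trans (collect _ _ _ _ _ _ _ _)
            (≈-sym (≈-trans (distribˡ _ c c′) (+-cong (expand c) (expand c′)))))
          where
          expand : ∀ d → (a + a′) * (b + b′) * d ≈ (a * b * d + a * b′ * d) + (a′ * b * d + a′ * b′ * d)
          expand d = solve 5 (λ a a′ b b′ d → (a :+ a′) :* (b :+ b′) :* d := (a :* b :* d :+ a :* b′ :* d) :+
            (a′ :* b :* d :+ a′ :* b′ :* d)) ≈-refl a a′ b b′ d
          collect : ∀ p q r s t u v w → p + q + r + s + t + u + (v + w) ≈ ((p + v) + (r + s)) + ((q + t) + (w + u))
          collect = solve 8 (λ p q r s t u v w → p :+ q :+ r :+ s :+ t :+ u :+ (v :+ w) := ((p :+ v) :+ (r :+ s)) :+
            ((q :+ t) :+ (w :+ u))) ≈-refl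

    -- A pair can be averaged only where the test is a rectangle in it for each third vertex. The
    -- domain of size n makes every replacement cost n κ.
    data Slotted {n} (T : Kernel₃ n) : Bool → Set where
      keep    : Slotted T true
      average : (S : Separable T) → S .coef ≈ 1# → ∑ᵥ (S .domain) ≈ fromℕ n → Slotted T false

    abstract
      separate : ∀ {n} {T : Kernel₃ n} (A B : Kernel n) → IndKer A → IndKer B → (∀ u v w → T u v w ≈ A u w * B v w) →
        Slotted T false
      separate {n} A B i j e = average (record
        { domain = λ _ → 1# ; domain-ind = λ _ → ind-1 ; supported = λ u w → ≈-sym (*-identityʳ _) ; coef =
          1# ; coef-≥0 = 0≤1 ; coef-≤1 = ≤-refl ; left = A ; right = B ; left-ind = i ; right-ind = j
        ; splits = λ u v w → ≈-trans (e u v w) (≈-sym (*-identityˡ _)) }) ≈-refl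
        (≈-trans (∑-const (allFin n) 1#) (≈-trans (*-identityʳ _) (≈-reflexive (≡.cong fromℕ (length-allFin n)))))

    module LowerBound (𝓟 : Palette) {x : ℕ → Carrier} (simplex : Simplex ℝ 𝓟 x) {n : ℕ} {κ r : Carrier} (κ≥0 : 0# ≤ κ)
      (r≥0 : 0# ≤ r)
      (φ : Fin n → Fin n → ℕ) (usable : ∀ u v → Usable 𝓟 simplex (φ u v))
      (close-cut : ∀ c → c ∈ Φ 𝓟 → Cut κ (λ u v → below? u v * 𝟙 (φ u v ℕ.≟ c)) (λ u v → x c * below? u v)) where

      private
        N : Carrier
        N = fromℕ n
        H : 3Graph
        H = pattern-graph 𝓟 φ
        G : ℕ → Kernel n
        G c u v = below? u v * 𝟙 (φ u v ℕ.≟ c)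
        e : Kernel₃ n
        e = edge H

        -- An averaged pair contributes the number x c and the order indicator, a kept pair the
        -- factor 1 and its actual colour class.
        level : Bool → ℕ → Carrier
        level false c = x c
        level true  c = 1#
        kernel : Bool → ℕ → Kernel n
        kernel false c = below?
        kernel true  c = G c

      error : Carrier
      error = fromℕ (length (patterns 𝓟)) * (N * κ + N * κ + N * κ)

      OrderBound : Kernel₃ n → Set
      OrderBound T = r * ∑₃ (λ u v w → T u v w * sorted u v w) ≤ ∑₃ (λ u v w → T u v w * sorted u v w * e u v w) + error

      abstract
        private
          G-ind : ∀ c → IndKer (G c)
          G-ind c u v = ind-* (below-ind u v) (𝟙-ind (φ u v ℕ.≟ c))
          kernel-ind : ∀ b c → IndKer (kernel b c)
          kernel-ind false c = below-ind
          kernel-ind true c = G-ind c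
          level-≥0 : ∀ b {c} → c ∈ Φ 𝓟 → 0# ≤ level b c
          level-≥0 false i = proj₁ (simplex-boxed 𝓟 simplex _ i)
          level-≥0 true i = 0≤1
          level-≤1 : ∀ b {c} → c ∈ Φ 𝓟 → level b c ≤ 1#
          level-≤1 false i = proj₂ (simplex-boxed 𝓟 simplex _ i)
          level-≤1 true i = ≤-refl
          replacement : ∀ {T b c} → Slotted T b → c ∈ Φ 𝓟 → Replace (N * κ) T (G c) (level b c) (kernel b c)
          replacement keep i = exact (*-nonNeg (0≤fromℕ n) κ≥0) (λ u v → ≈-sym (*-identityˡ _))
          replacement (average S eq sz) i = close S eq κ≥0 (≤-reflexive (*-congʳ sz)) (close-cut _ i)
          level-kernel : ∀ b c u v → level b c * kernel b c u v ≈ below? u v * σ x (slot b (φ u v)) c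
          level-kernel false c u v = *-comm _ _
          level-kernel true c u v = ≈-trans (*-identityˡ _) (*-congˡ (𝟙-cong (φ u v ℕ.≟ c) (c ℕ.≟ φ u v) ≡.sym ≡.sym))

          -- The patterns are distinct, so at most one of them matches the colours of u < v < w, and
          -- then the triple is an edge.
          pattern-edge : ∀ u v w → sorted u v w * ∑[ patterns 𝓟 ]
            (λ (p , q , r) → 𝟙 (φ u v ℕ.≟ p) * 𝟙 (φ u w ℕ.≟ q) * 𝟙 (φ v w ℕ.≟ r)) ≤ sorted u v w * e u v w
          pattern-edge u v w = by-cases (u Fin.<? v) (v Fin.<? w) em
            where
            t₀ : Triple
            t₀ = φ u v , φ u w , φ v w
            matches : Triple → Carrier
            matches (p , q , r) = 𝟙 (φ u v ℕ.≟ p) * 𝟙 (φ u w ℕ.≟ q) * 𝟙 (φ v w ℕ.≟ r)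
            dirac : ∀ t → matches t ≈ 𝟙 (em {t ≡ t₀})
            dirac (p , q , r) = ≈-trans (≈-sym (≈-trans (𝟙-× ((φ u v ℕ.≟ p) ×-dec (φ u w ℕ.≟ q)) (φ v w ℕ.≟ r))
              (*-congʳ (𝟙-× (φ u v ℕ.≟ p) (φ u w ℕ.≟ q)))))
              (𝟙-cong (((φ u v ℕ.≟ p) ×-dec (φ u w ℕ.≟ q)) ×-dec (φ v w ℕ.≟ r)) em
                (λ { ((≡.refl , ≡.refl) , ≡.refl) → ≡.refl }) (λ { ≡.refl → (≡.refl , ≡.refl) , ≡.refl }))
            zero-sides : ∀ y z → sorted u v w ≈ 0# → sorted u v w * y ≤ sorted u v w * z
            zero-sides y z e = ≤-reflexive (≈-trans (*-congʳ e) (≈-trans (zeroˡ y) (≈-sym (≈-trans (*-congʳ e) (zeroˡ z)))))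
            by-cases : Dec (u Fin.< v) → Dec (v Fin.< w) → Dec (t₀ ∈ patterns 𝓟) →
              sorted u v w * ∑[ patterns 𝓟 ] matches ≤ sorted u v w * e u v w
            by-cases (no ¬p) _ _ = zero-sides _ _ (≈-trans
              (*-congʳ (≈-trans (*-congʳ (𝟙-no (u Fin.<? v) ¬p)) (zeroˡ _))) (zeroˡ _))
            by-cases (yes _) (no ¬q) _ = zero-sides _ _ (≈-trans (*-congˡ (𝟙-no (v Fin.<? w) ¬q)) (zeroʳ _))
            by-cases (yes p) (yes q) (yes t) = *-monoˡ-≤ (sorted-≥0 u v w) (≤-trans
              (≤-trans (≤-reflexive (∑-cong (patterns 𝓟) dirac)) (∑-dirac-≤1 (λ i j → em) t₀ (unique 𝓟)))
              (≤-reflexive (≈-sym (𝟙-yes (edges H ∋? triple u v w) (pattern-graph-edge 𝓟 φ p q t)))))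
            by-cases (yes _) (yes _) (no ∉) = *-monoˡ-≤ (sorted-≥0 u v w) (≤-trans
              (≤-reflexive (≈-trans (∑-cong-∈ (patterns 𝓟) (λ t i → ≈-trans (dirac t) (𝟙-no em (λ { ≡.refl → ∉ i }))))
                (∑-zero (patterns 𝓟))))
              (ind-≥0 (𝟙-ind (edges H ∋? triple u v w))))

        -- At every triple r is at most the degree of the pattern pinned by φ. Expanded over the
        -- patterns, the degree has a factor x c for each free pair; counting turns these averages
        -- into actual colour classes, and a matched pattern is an edge.
        order-bound : ∀ {T : Kernel₃ n} b₁ b₂ b₃ → (∀ u v w → 0# ≤ T u v w) →
          Slotted T b₁ → Slotted (λ u w v → T u v w) b₂ → Slotted (λ v w u → T u v w) b₃ →
          (∀ u v w → r ≤ deg 𝓟 x ⟨ slot b₁ (φ u v) , slot b₂ (φ u w) , slot b₃ (φ v w) ⟩) → OrderBound T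
        order-bound {T} b₁ b₂ b₃ T≥0 s₁ s₂ s₃ hyp = begin
          r * ∑₃ (λ u v w → T u v w * sorted u v w)      ≈⟨ ≈-sym (∑₃-*ˡ {n} r _) ⟩
          ∑₃ (λ u v w → r * (T u v w * sorted u v w))    ≤⟨ ∑₃-mono {n}
            (λ u v w → ≤-trans (*-monoʳ-≤ (*-nonNeg (T≥0 u v w) (sorted-≥0 u v w)) (hyp u v w)) (≤-reflexive (averaged u v w))) ⟩
          ∑₃ (λ u v w → ∑[ patterns 𝓟 ] (λ t → A t u v w)) ≈⟨ ∑₃-∑ {n = n} (patterns 𝓟) A ⟩
          ∑[ patterns 𝓟 ] (λ t → ∑₃ (A t))               ≤⟨ ∑-mono-∈ (patterns 𝓟) count ⟩
          ∑[ patterns 𝓟 ] (λ t → ∑₃ (B t) + (N * κ + N * κ + N * κ)) ≈⟨ ≈-trans (∑-+ (patterns 𝓟) _ _)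
            (+-cong (≈-sym (∑₃-∑ {n = n} (patterns 𝓟) B)) (∑-const (patterns 𝓟) _)) ⟩
          ∑₃ (λ u v w → ∑[ patterns 𝓟 ] (λ t → B t u v w)) + error ≤⟨ +-monoˡ-≤ error (∑₃-mono {n} coloured-edge) ⟩
          ∑₃ (λ u v w → T u v w * sorted u v w * e u v w) + error ∎
          where
          open ≤R
          A B : Triple → Kernel₃ n
          A (p , q , r) u v w = T u v w * ((level b₁ p * kernel b₁ p u v) * (level b₂ q * kernel b₂ q u w) *
            (level b₃ r * kernel b₃ r v w))
          B (p , q , r) u v w = T u v w * (G p u v * G q u w * G r v w)
          averaged : ∀ u v w → deg 𝓟 x ⟨ slot b₁ (φ u v) , slot b₂ (φ u w) , slot b₃ (φ v w) ⟩ *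
            (T u v w * sorted u v w) ≈ ∑[ patterns 𝓟 ] (λ t → A t u v w)
          averaged u v w = ≈-trans (≈-sym (∑-*ʳ (patterns 𝓟) (T u v w * sorted u v w) _))
            (∑-cong (patterns 𝓟) (λ (p , q , r) → ≈-trans
            (solve 7 (λ s₁ s₂ s₃ t h₁ h₂ h₃ → s₁ :* s₂ :* s₃ :* (t :* (h₁ :* h₂ :* h₃)) := t :*
              ((h₁ :* s₁) :* (h₂ :* s₂) :* (h₃ :* s₃))) ≈-refl
              (σ x (slot b₁ (φ u v)) p) (σ x (slot b₂ (φ u w)) q) (σ x (slot b₃ (φ v w)) r) (T u v w) (below? u v)
                (below? u w) (below? v w))
            (*-congˡ (≈-sym (*-cong (*-cong (level-kernel b₁ p u v) (level-kernel b₂ q u w)) (level-kernel b₃ r v w))))))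
          count : ∀ t → t ∈ patterns 𝓟 → ∑₃ (A t) ≤ ∑₃ (B t) + (N * κ + N * κ + N * κ)
          count (p , q , r) t = let i , j , k = patterns⊆Φ 𝓟 t in
            above (counting T (G-ind p) (G-ind q) (G-ind r) (kernel-ind b₁ p) (kernel-ind b₂ q) (kernel-ind b₃ r)
              (level-≥0 b₁ i) (level-≤1 b₁ i) (level-≥0 b₂ j) (level-≤1 b₂ j) (replacement s₁ i) (replacement s₂ j)
                (replacement s₃ k))
          coloured-edge : ∀ u v w → ∑[ patterns 𝓟 ] (λ t → B t u v w) ≤ T u v w * sorted u v w * e u v w
          coloured-edge u v w = begin
            ∑[ patterns 𝓟 ] (λ t → B t u v w)   ≈⟨ ∑-cong (patterns 𝓟) (λ (p , q , r) →
              solve 7 (λ t h₁ h₂ h₃ d₁ d₂ d₃ → t :* ((h₁ :* d₁) :* (h₂ :* d₂) :* (h₃ :* d₃)) := t :*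
                (h₁ :* h₂ :* h₃) :* (d₁ :* d₂ :* d₃)) ≈-refl
                (T u v w) (below? u v) (below? u w) (below? v w) (𝟙 (φ u v ℕ.≟ p)) (𝟙 (φ u w ℕ.≟ q)) (𝟙 (φ v w ℕ.≟ r))) ⟩
            ∑[ patterns 𝓟 ] (λ (p , q , r) → T u v w * sorted u v w * (𝟙 (φ u v ℕ.≟ p) * 𝟙 (φ u w ℕ.≟ q) * 𝟙 (φ v w ℕ.≟ r)))
              ≈⟨ ≈-trans (∑-*ˡ (patterns 𝓟) (T u v w * sorted u v w) _) (*-assoc _ _ _) ⟩
            T u v w * (sorted u v w * ∑[ patterns 𝓟 ] (λ (p , q , r) → 𝟙 (φ u v ℕ.≟ p) * 𝟙 (φ u w ℕ.≟ q) * 𝟙 (φ v w ℕ.≟ r)))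
              ≤⟨ *-monoˡ-≤ (T≥0 u v w) (pattern-edge u v w) ⟩
            T u v w * (sorted u v w * e u v w)  ≈⟨ ≈-sym (*-assoc _ _ _) ⟩
            T u v w * sorted u v w * e u v w    ∎

      abstract
        -- The six orders of x, y, z; the two cyclic products that are missing from (h + h′)³ vanish.
        orders-sum : ∀ (u v w : Fin n) →
          sorted u v w + sorted u w v + sorted v u w + sorted v w u + sorted w u v + sorted w v u ≈
            (1# - 𝟙 (u Fin.≟ v)) * (1# - 𝟙 (u Fin.≟ w)) * (1# - 𝟙 (v Fin.≟ w))
        orders-sum u v w = ≈-trans (≈-sym (≈-trans
          (+-cong (≈-refl {orders}) (≈-trans (+-cong (cyclic u v w) (cyclic v u w)) (+-identityˡ 0#))) (+-identityʳ _)))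
          (≈-trans (eight-terms (below? u v) (below? v u) (below? u w) (below? w u) (below? v w) (below? w v))
           (*-cong (*-cong (comparable u v) (comparable u w)) (comparable v w)))
          where
          orders : Carrier
          orders = sorted u v w + sorted u w v + sorted v u w + sorted v w u + sorted w u v + sorted w v u
          cyclic : ∀ (u v w : Fin n) → below? u v * below? v w * below? w u ≈ 0#
          cyclic u v w = go (u Fin.<? v) (v Fin.<? w) (w Fin.<? u)
            where
            go : Dec (u Fin.< v) → Dec (v Fin.< w) → Dec (w Fin.< u) → below? u v * below? v w * below? w u ≈ 0#
            go (no ¬p) _ _ = ≈-trans (*-congʳ (≈-trans (*-congʳ (𝟙-no (u Fin.<? v) ¬p)) (zeroˡ _))) (zeroˡ _)
            go (yes _) (no ¬q) _ = ≈-trans (*-congʳ (≈-trans (*-congˡ (𝟙-no (v Fin.<? w) ¬q)) (zeroʳ _))) (zeroˡ _)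
            go (yes _) (yes _) (no ¬r) = ≈-trans (*-congˡ (𝟙-no (w Fin.<? u) ¬r)) (zeroʳ _)
            go (yes p) (yes q) (yes r) = contradiction (Fin.<-trans {i = u} (Fin.<-trans {i = u} p q) r) (Fin.<-irrefl ≡.refl)

        private
          distinct : Kernel₃ n
          distinct u v w = (1# - 𝟙 (u Fin.≟ v)) * (1# - 𝟙 (u Fin.≟ w)) * (1# - 𝟙 (v Fin.≟ w))
          collisions : Kernel₃ n
          collisions u v w = 𝟙 (u Fin.≟ v) + 𝟙 (u Fin.≟ w) + 𝟙 (v Fin.≟ w)

          distinct-ind : ∀ u v w → Ind (distinct u v w)
          distinct-ind u v w = ind-* (ind-* (ind-not (𝟙-ind (u Fin.≟ v))) (ind-not (𝟙-ind (u Fin.≟ w))))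
            (ind-not (𝟙-ind (v Fin.≟ w)))

          -- For indicators a, b, c of the three coincidences, 1 - (1 - a)(1 - b)(1 - c) is at most
          -- a + b + c.
          degenerate : ∀ {t} u v w → Ind t → t ≤ t * distinct u v w + collisions u v w
          degenerate {t} u v w i = ≤-trans (≤-by (*-nonNeg (ind-≥0 (ind-not i))
            (ind-≥0 (ind-not (distinct-ind u v w)))) (split t (distinct u v w)))
            (+-monoʳ-≤ _ (≤-by (0≤-+ (0≤-+ (*-nonNeg (*-nonNeg (p u v) (p u w))
              (ind-≥0 (ind-not (𝟙-ind (v Fin.≟ w))))) (*-nonNeg (p u v) (p v w))) (*-nonNeg (p u w) (p v w)))
              (solve 3 (λ a b c → a :+ b :+ c := (:1 :- (:1 :- a) :* (:1 :- b) :* (:1 :- c)) :+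
                (a :* b :* (:1 :- c) :+ a :* c :+ b :* c)) ≈-refl
                (𝟙 (u Fin.≟ v)) (𝟙 (u Fin.≟ w)) (𝟙 (v Fin.≟ w)))))
            where
            split : ∀ t m → t * m + (1# - m) ≈ t + (1# - t) * (1# - m)
            split = solve 2 (λ t m → t :* m :+ (:1 :- m) := t :+ (:1 :- t) :* (:1 :- m)) ≈-refl
            p : ∀ (u v : Fin n) → 0# ≤ 𝟙 (u Fin.≟ v)
            p u v = ind-≥0 (𝟙-ind (u Fin.≟ v))

          diagonal-≤ : (u : Fin n) → ∑ᵥ (λ v → 𝟙 (v Fin.≟ u)) ≤ 1#
          diagonal-≤ u = ∑-dirac-≤1 Fin._≟_ u (allFin⁺ n)

          -- A coincidence determines one vertex by another and leaves at most n² triples.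
          collisions-≤ : ∑₃ collisions ≤ 3# * (N * N)
          collisions-≤ = ≤-respʳ (solve 1 (λ q → q :+ q :+ q := :3 :* q) ≈-refl (N * N)) (≤-respˡ
            (≈-sym (≈-trans (∑₃-+ {n} _ _) (+-congʳ (∑₃-+ {n} _ _))))
            (+-mono-≤ (+-mono-≤ uv uw) vw))
            where
            row-≤ : (u : Fin n) → ∑ᵥ (λ v → 𝟙 (u Fin.≟ v)) ≤ 1#
            row-≤ u = ≤-respˡ (∑-cong (allFin n) (λ v → 𝟙-cong (v Fin.≟ u) (u Fin.≟ v) ≡.sym ≡.sym)) (diagonal-≤ u)
            uw : ∑₃ (λ (u v w : Fin n) → 𝟙 (u Fin.≟ w)) ≤ N * N
            uw = ≤-respʳ (*-congˡ (*-identityʳ N)) (∑₂-≤ 𝓟 simplex {n} (λ u v → ∑ᵥ λ w → 𝟙 (u Fin.≟ w)) (λ u v → row-≤ u))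
            vw : ∑₃ (λ (u v w : Fin n) → 𝟙 (v Fin.≟ w)) ≤ N * N
            vw = ≤-respʳ (*-congˡ (*-identityʳ N)) (∑₂-≤ 𝓟 simplex {n} (λ u v → ∑ᵥ λ w → 𝟙 (v Fin.≟ w)) (λ u v → row-≤ v))
            uv : ∑₃ (λ (u v w : Fin n) → 𝟙 (u Fin.≟ v)) ≤ N * N
            uv = ≤-respˡ (≈-sym (∑₃-swap₂₃ {n} (λ u v w → 𝟙 (u Fin.≟ v)))) uw

        -- The triples are split by the order of their entries. Renaming the summation variables
        -- brings each part into the form u < v < w, at the price of permuting the arguments of `T`;
        -- the edge indicator is symmetric and does not change.
        order-free-bound : r ≤ 1# → {T : Kernel₃ n} → (∀ u v w → Ind (T u v w)) →
          OrderBound (λ u v w → T u v w) → OrderBound (λ u v w → T u w v) → OrderBound (λ u v w → T v u w) →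
          OrderBound (λ u v w → T w u v) → OrderBound (λ u v w → T v w u) → OrderBound (λ u v w → T w v u) →
          r * ∑₃ T ≤ ∑₃ (λ u v w → T u v w * e u v w) + ((error + error + error + error + error + error) + 3# * (N * N))
        order-free-bound r≤1 {T} T-ind o₁ o₂ o₃ o₄ o₅ o₆ = begin
          r * ∑₃ T                                    ≤⟨ *-monoˡ-≤ r≥0
            (≤-respʳ (∑₃-+ {n} _ _) (∑₃-mono {n} (λ u v w → degenerate u v w (T-ind u v w)))) ⟩
          r * (∑₃ (λ u v w → T u v w * distinct u v w) + ∑₃ collisions) ≈⟨ distribˡ r _ _ ⟩
          r * ∑₃ (λ u v w → T u v w * distinct u v w) + r * ∑₃ collisions
            ≤⟨ +-mono-≤ main (≤-trans (*-monoˡ-≤ r≥0 collisions-≤)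
              (≤-respʳ (*-identityˡ _) (*-monoʳ-≤ (*-nonNeg 0≤3 (0≤x² N)) r≤1))) ⟩
          ∑₃ (λ u v w → T u v w * e u v w) + (error + error + error + error + error + error) + 3# * (N * N) ≈⟨ +-assoc _ _ _ ⟩
          ∑₃ (λ u v w → T u v w * e u v w) + ((error + error + error + error + error + error) + 3# * (N * N)) ∎
          where
          open ≤R
          W : (Kernel₃ n → Kernel₃ n) → Kernel₃ n → Carrier
          W π g = ∑₃ λ u v w → T u v w * π sorted u v w * g u v w
          π₁ π₂ π₃ π₄ π₅ π₆ : Kernel₃ n → Kernel₃ n
          π₁ s u v w = s u v w
          π₂ s u v w = s u w v
          π₃ s u v w = s v u w
          π₄ s u v w = s v w u
          π₅ s u v w = s w u v
          π₆ s u v w = s w v u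
          one : Kernel₃ n
          one u v w = 1#
          six : (g : Kernel₃ n) → W π₁ g + W π₂ g + W π₃ g + W π₄ g + W π₅ g + W π₆ g ≈ ∑₃ λ u v w →
            T u v w * distinct u v w * g u v w
          six g = ≈-trans (≈-sym (≈-trans (∑₃-+ {n} _ _)
            (+-congʳ (≈-trans (∑₃-+ {n} _ _) (+-congʳ
            (≈-trans (∑₃-+ {n} _ _) (+-congʳ (≈-trans (∑₃-+ {n} _ _) (+-congʳ (∑₃-+ {n} _ _))))))))))
            (∑₃-cong {n} (λ u v w → ≈-trans (six-terms (T u v w) (g u v w) (sorted u v w) (sorted u w v)
              (sorted v u w) (sorted v w u) (sorted w u v) (sorted w v u))
              (*-congʳ (*-congˡ (orders-sum u v w)))))
          Bound : (Kernel₃ n → Kernel₃ n) → Set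
          Bound π = r * W π one ≤ W π e + error
          reorder : ∀ {y y′ z z′} → y ≈ y′ → z ≈ z′ → r * y ≤ z + error → r * y′ ≤ z′ + error
          reorder p q h = ≤-respˡ (*-congˡ p) (≤-respʳ (+-congʳ q) h)
          drop-one : ∀ {y} → y ≈ y * 1#
          drop-one = ≈-sym (*-identityʳ _)
          b₁ : Bound π₁
          b₁ = reorder (∑₃-cong {n} (λ u v w → drop-one)) ≈-refl o₁
          b₂ : Bound π₂
          b₂ = reorder (≈-trans (∑₃-swap₂₃ {n} _) (∑₃-cong {n} (λ u v w → drop-one)))
            (≈-trans (∑₃-swap₂₃ {n} _) (∑₃-cong {n} (λ u v w → *-congˡ (edge-swap₂₃ H u w v)))) o₂
          b₃ : Bound π₃
          b₃ = reorder (≈-trans (∑₃-swap₁₂ {n} _) (∑₃-cong {n} (λ u v w → drop-one)))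
            (≈-trans (∑₃-swap₁₂ {n} _) (∑₃-cong {n} (λ u v w → *-congˡ (edge-swap₁₂ H v u w)))) o₃
          b₄ : Bound π₄
          b₄ = reorder (≈-trans (∑₃-rotate {n} _) (∑₃-cong {n} (λ u v w → drop-one)))
            (≈-trans (∑₃-rotate {n} _) (∑₃-cong {n} (λ u v w → *-congˡ (≈-trans (edge-swap₂₃ H v w u) (edge-swap₁₂ H v u w))))) o₄
          b₅ : Bound π₅
          b₅ = reorder (≈-trans (≈-sym (∑₃-rotate {n} _)) (∑₃-cong {n} (λ u v w → drop-one)))
            (≈-trans (≈-sym (∑₃-rotate {n} _)) (∑₃-cong {n}
              (λ u v w → *-congˡ (≈-trans (edge-swap₁₂ H w u v) (edge-swap₂₃ H u w v))))) o₅
          b₆ : Bound π₆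
          b₆ = reorder (≈-trans (≈-trans (∑₃-rotate {n} _) (∑₃-swap₂₃ {n} _)) (∑₃-cong {n} (λ u v w → drop-one)))
            (≈-trans (≈-trans (∑₃-rotate {n} _) (∑₃-swap₂₃ {n} _))
              (∑₃-cong {n} (λ u v w → *-congˡ (≈-trans (edge-swap₁₂ H w v u)
              (≈-trans (edge-swap₂₃ H v w u) (edge-swap₁₂ H v u w)))))) o₆
          main : r * ∑₃ (λ u v w → T u v w * distinct u v w) ≤ ∑₃ (λ u v w → T u v w * e u v w) +
            (error + error + error + error + error + error)
          main = begin
            r * ∑₃ (λ u v w → T u v w * distinct u v w)   ≈⟨ *-congˡ
              (≈-trans (∑₃-cong {n} (λ u v w → drop-one)) (≈-sym (six one))) ⟩
            r * (W π₁ one + W π₂ one + W π₃ one + W π₄ one + W π₅ one + W π₆ one)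
              ≈⟨ ≈-trans (distribˡ r _ _) (+-congʳ (≈-trans (distribˡ r _ _)
                (+-congʳ (≈-trans (distribˡ r _ _) (+-congʳ (≈-trans (distribˡ r _ _) (+-congʳ (distribˡ r _ _)))))))) ⟩
            r * W π₁ one + r * W π₂ one + r * W π₃ one + r * W π₄ one + r * W π₅ one + r * W π₆ one
              ≤⟨ +-mono-≤ (+-mono-≤ (+-mono-≤ (+-mono-≤ (+-mono-≤ b₁ b₂) b₃) b₄) b₅) b₆ ⟩
            (W π₁ e + error) + (W π₂ e + error) + (W π₃ e + error) + (W π₄ e + error) + (W π₅ e + error) + (W π₆ e + error)
              ≈⟨ six-errors (W π₁ e) (W π₂ e) (W π₃ e) (W π₄ e) (W π₅ e) (W π₆ e) error ⟩
            W π₁ e + W π₂ e + W π₃ e + W π₄ e + W π₅ e + W π₆ e +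
              (error + error + error + error + error + error) ≈⟨ +-congʳ (six e) ⟩
            ∑₃ (λ u v w → T u v w * distinct u v w * e u v w) + (error + error + error + error + error + error)
              ≤⟨ +-monoˡ-≤ _ (∑₃-mono {n} (λ u v w → *-monoʳ-≤ (ind-≥0 (𝟙-ind (edges H ∋? triple u v w)))
                   (≤-respʳ (*-identityʳ _) (*-monoˡ-≤ (ind-≥0 (T-ind u v w)) (ind-≤1 (distinct-ind u v w)))))) ⟩
            ∑₃ (λ u v w → T u v w * e u v w) + (error + error + error + error + error + error) ∎

  open OrderedTests

  -- Dense colourable graphs: the lower bound

  module DenseGraphs where

    module DensityOfPatternGraph (𝓟 : Palette) {x : ℕ → Carrier} (simplex : Simplex ℝ 𝓟 x) {n : ℕ} {κ r η : Carrier}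
      (κ≥0 : 0# ≤ κ) (r≥0 : 0# ≤ r) (r≤1 : r ≤ 1#)
      (φ : Fin n → Fin n → ℕ) (usable : ∀ u v → Usable 𝓟 simplex (φ u v))
      (close-cut : ∀ c → c ∈ Φ 𝓟 → Cut κ (λ u v → below? u v * 𝟙 (φ u v ℕ.≟ c)) (λ u v → x c * below? u v)) where

      open LowerBound 𝓟 simplex κ≥0 r≥0 φ usable close-cut

      private
        N : Carrier
        N = fromℕ n
        H : 3Graph
        H = pattern-graph 𝓟 φ
        colour-∈Φ : ∀ u v → φ u v ∈ Φ 𝓟
        colour-∈Φ u v = proj₁ (usable u v)
        pos : ∀ u v → 0# < x (φ u v)
        pos u v = proj₂ (usable u v)

      module _ (small : (error + error + error + error + error + error) + 3# * (N * N) ≤ η * fromℕ (n ℕ.^ 3)) where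

        abstract
          private
            finish : {T : Kernel₃ n} → r * ∑₃ T ≤ ∑₃ (λ u v w → T u v w * edge H u v w) +
              ((error + error + error + error + error + error) + 3# * (N * N)) →
              DenseFor r η H T
            finish {T} h = ≤-by (0≤-+ (x≤y⇒0≤y-x h) (x≤y⇒0≤y-x small))
              (certificate (r * ∑₃ T) (∑₃ (λ u v w → T u v w * edge H u v w)) _ (η * fromℕ (n ℕ.^ 3)))
              where
              certificate : ∀ a b c d → b ≈ a - d + (b + c - a + (d - c))
              certificate = solve 4 (λ a b c d → b := a :- d :+ (b :+ c :- a :+ (d :- c))) ≈-refl

            on-vertices : Good 𝓟 vvv r x → {T : Kernel₃ n} (A B C : Fin n → Carrier) → IndVec A → IndVec B → IndVec C →
              (∀ u v w → T u v w ≈ A u * (B v * C w)) → OrderBound T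
            on-vertices g A B C a b c eq = order-bound false false false
              (λ u v w → ind-≥0 (ind-cong (≈-sym (eq u v w)) (ind-* (a u) (ind-* (b v) (c w)))))
              (separate (λ u w → A u) (λ v w → B v * C w) (λ u w → a u) (λ v w → ind-* (b v) (c w)) eq)
              (separate (λ u v → A u) (λ w v → B v * C w) (λ u v → a u) (λ w v → ind-* (b v) (c w)) (λ u w v → eq u v w))
              (separate (λ v u → B v) (λ w u → A u * C w) (λ v u → b v) (λ w u → ind-* (a u) (c w))
                (λ v w u → ≈-trans (eq u v w) (solve 3 (λ a b c → a :* (b :* c) := b :* (a :* c)) ≈-refl (A u) (B v) (C w))))
              (λ u v w → g _ vvv₀ (0<-* (0<-* 0<1 0<1) 0<1))

            -- For a fixed vertex of the pair tested by `K`, the test is a rectangle in the other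
            -- two vertices. Only the pair under `K` keeps its colour, which leads to degrees with
            -- one pinned slot.
            module _ (g : Good 𝓟 ev r x) {T : Kernel₃ n} (A : Fin n → Carrier) (K : Kernel n) (a : IndVec A) (k : IndKer K) where
              on-pair₂₃ : (∀ u v w → T u v w ≈ A u * K v w) → OrderBound T
              on-pair₂₃ eq = order-bound false false true (λ u v w → ind-≥0 (ind-cong (≈-sym (eq u v w)) (ind-* (a u) (k v w))))
                (separate (λ u w → A u) K (λ u w → a u) k eq)
                (separate (λ u v → A u) (λ w v → K v w) (λ u v → a u) (λ w v → k v w) (λ u w v → eq u v w))
                keep (λ u v w → g _ (ev₃ (colour-∈Φ v w)) (0<-* (0<-* 0<1 0<1) (pos v w)))

              on-pair₁₃ : (∀ u v w → T u v w ≈ A v * K u w) → OrderBound T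
              on-pair₁₃ eq = order-bound false true false (λ u v w → ind-≥0 (ind-cong (≈-sym (eq u v w)) (ind-* (a v) (k u w))))
                (separate K (λ v w → A v) k (λ v w → a v) (λ u v w → ≈-trans (eq u v w) (*-comm _ _)))
                keep
                (separate (λ v u → A v) (λ w u → K u w) (λ v u → a v) (λ w u → k u w) (λ v w u → eq u v w))
                (λ u v w → g _ (ev₂ (colour-∈Φ u w)) (0<-* (0<-* 0<1 (pos u w)) 0<1))

              on-pair₁₂ : (∀ u v w → T u v w ≈ A w * K u v) → OrderBound T
              on-pair₁₂ eq = order-bound true false false (λ u v w → ind-≥0 (ind-cong (≈-sym (eq u v w)) (ind-* (a w) (k u v))))
                keep
                (separate K (λ w v → A w) k (λ w v → a w) (λ u w v → ≈-trans (eq u v w) (*-comm _ _)))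
                (separate (λ v u → K u v) (λ w u → A w) (λ v u → k u v) (λ w u → a w) (λ v w u → ≈-trans (eq u v w) (*-comm _ _)))
                (λ u v w → g _ (ev₁ (colour-∈Φ u v)) (0<-* (0<-* (pos u v) 0<1) 0<1))

            -- Two pairs keep their colours. The position of their common vertex in the order
            -- decides which slot remains free.
            module _ (g : Good 𝓟 ee r x) {T : Kernel₃ n} (K L : Kernel n) (k : IndKer K) (l : IndKer L) where
              centred₁ : (∀ u v w → T u v w ≈ K u v * L u w) → OrderBound T
              centred₁ eq = order-bound true true false (λ u v w → ind-≥0 (ind-cong (≈-sym (eq u v w)) (ind-* (k u v) (l u w))))
                keep keep (separate (λ v u → K u v) (λ w u → L u w) (λ v u → k u v) (λ w u → l u w) (λ v w u → eq u v w))
                (λ u v w → g _ (ee₁₂ (colour-∈Φ u v) (colour-∈Φ u w)) (0<-* (0<-* (pos u v) (pos u w)) 0<1))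

              centred₂ : (∀ u v w → T u v w ≈ K u v * L v w) → OrderBound T
              centred₂ eq = order-bound true false true (λ u v w → ind-≥0 (ind-cong (≈-sym (eq u v w)) (ind-* (k u v) (l v w))))
                keep (separate K (λ w v → L v w) k (λ w v → l v w) (λ u w v → eq u v w)) keep
                (λ u v w → g _ (ee₁₃ (colour-∈Φ u v) (colour-∈Φ v w)) (0<-* (0<-* (pos u v) 0<1) (pos v w)))

              centred₃ : (∀ u v w → T u v w ≈ K u w * L v w) → OrderBound T
              centred₃ eq = order-bound false true true (λ u v w → ind-≥0 (ind-cong (≈-sym (eq u v w)) (ind-* (k u w) (l v w))))
                (separate K L k l eq) keep keep
                (λ u v w → g _ (ee₂₃ (colour-∈Φ u w) (colour-∈Φ v w)) (0<-* (0<-* 0<1 (pos u w)) (pos v w)))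

            transpose : Kernel n → Kernel n
            transpose K u v = K v u

            ind-vec : (X : Subset n) → IndVec (ind X)
            ind-vec X u = 𝟙-ind (u ∈? X)

            linked-ind : (P : UniformSet 2 n) → IndKer (linked P)
            linked-ind P u v = 𝟙-ind (P ∋? pair u v)

          -- In each mode the six entries correspond to the six orders; a kernel is transposed where
          -- the order reverses a pair of the test.
          pattern-graph-dense : ∀ ⋆ → Good 𝓟 ⋆ r x → Dense ℝ ⋆ r η H
          pattern-graph-dense vvv g = dense-vvv⁺ {H = H} (λ X Y Z → let A = ind X; B = ind Y; C = ind Z; a = ind-vec X; b = ind-vec Y; c = ind-vec Z in
            finish (order-free-bound r≤1 {test-vvv X Y Z} (λ u v w → ind-* (a u) (ind-* (b v) (c w)))
              (on-vertices g A B C a b c (λ u v w → ≈-refl))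
              (on-vertices g A C B a c b (λ u v w → *-congˡ (*-comm _ _)))
              (on-vertices g B A C b a c (λ u v w → solve 3 (λ p q r → p :* (q :* r) := q :* (p :* r)) ≈-refl (A v) (B u) (C w)))
              (on-vertices g B C A b c a (λ u v w → solve 3 (λ p q r → p :* (q :* r) := q :* (r :* p)) ≈-refl (A w) (B u) (C v)))
              (on-vertices g C A B c a b (λ u v w → solve 3 (λ p q r → p :* (q :* r) := r :* (p :* q)) ≈-refl (A v) (B w) (C u)))
              (on-vertices g C B A c b a (λ u v w → solve 3 (λ p q r → p :* (q :* r) := r :* (q :* p)) ≈-refl (A w)
                (B v) (C u)))))
          pattern-graph-dense ev g = dense-ev⁺ {H = H} (λ X P → let A = ind X; a = ind-vec X in
            finish (order-free-bound r≤1 {test-ev X P} (λ u v w → ind-* (a u) (ind-* (below-ind v w) (linked-ind P v w)))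
              (on-pair₂₃ g A (K P) a (k P) (λ u v w → ≈-refl))
              (on-pair₂₃ g A (transpose (K P)) a (λ u v → k P v u) (λ u v w → ≈-refl))
              (on-pair₁₃ g A (K P) a (k P) (λ u v w → ≈-refl))
              (on-pair₁₂ g A (K P) a (k P) (λ u v w → ≈-refl))
              (on-pair₁₃ g A (transpose (K P)) a (λ u v → k P v u) (λ u v w → ≈-refl))
              (on-pair₁₂ g A (transpose (K P)) a (λ u v → k P v u) (λ u v w → ≈-refl))))
            where
            K : UniformSet 2 n → Kernel n
            K P v w = below? v w * linked P v w
            k : ∀ P → IndKer (K P)
            k P v w = ind-* (below-ind v w) (linked-ind P v w)
          pattern-graph-dense ee g = dense-ee⁺ {H = H} (λ P Q → let K = linked P; L = linked Q; k = linked-ind P; l = linked-ind Q in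
            finish (order-free-bound r≤1 {test-ee P Q} (λ u v w → ind-* (k u v) (l v w))
              (centred₂ g K L k l (λ u v w → ≈-refl))
              (centred₃ g K (transpose L) k (λ u v → l v u) (λ u v w → ≈-refl))
              (centred₁ g (transpose K) L (λ u v → k v u) l (λ u v w → ≈-refl))
              (centred₁ g L (transpose K) l (λ u v → k v u) (λ u v w → *-comm _ _))
              (centred₃ g (transpose L) K (λ u v → l v u) k (λ u v w → *-comm _ _))
              (centred₂ g (transpose L) (transpose K) (λ u v → l v u) (λ u v → k v u) (λ u v w → *-comm _ _))))

    module _ (𝓟 : Palette) where
      abstract
        fromℕ-cube : ∀ n → fromℕ (n ℕ.^ 3) ≈ fromℕ n * (fromℕ n * fromℕ n)
        fromℕ-cube n = ≈-trans (fromℕ-* n (n ℕ.* (n ℕ.* 1)))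
          (*-congˡ (≈-trans (fromℕ-* n (n ℕ.* 1)) (*-congˡ (≈-reflexive (≡.cong fromℕ (ℕ.*-identityʳ n))))))

        dense-graphs : ∀ ⋆ {r x} → 0# ≤ r → r ≤ 1# → Simplex ℝ 𝓟 x → Good 𝓟 ⋆ r x →
          ∀ η → 0# < η → ∀ n → ∃[ H ] (H FreeOf uncolourable 𝓟 × n ℕ.≤ order H × Dense ℝ ⋆ r η H)
        dense-graphs ⋆ {r} {x} r≥0 r≤1 simplex good η η>0 n₀ =
          pattern-graph 𝓟 φ ,
          colouring⇒free 𝓟 (pattern-graph-colouring 𝓟 φ (λ u v → proj₁ (usable u v))) ,
          ℕ.m≤m⊔n n₀ _ ,
          DensityOfPatternGraph.pattern-graph-dense 𝓟 simplex {n} {κ * (N * N)} {r} {η}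
            (*-nonNeg (<⇒≤ κ>0) (0≤x² N)) r≥0 r≤1 φ usable (proj₂ (proj₂ colouring)) small ⋆ good
          where
          m : Carrier
          m = fromℕ (length (patterns 𝓟))
          -- The total error 18 m κ n³ + 3 n² has to stay below η n³.
          half : ∃[ θ ] (0# < θ × 2# * θ ≈ η)
          half = shrink 0<2 η>0
          θ : Carrier
          θ = proj₁ half
          denominator : Carrier
          denominator = 1# + 3# * 3# * 2# * m
          choice : ∃[ κ ] (0# < κ × denominator * κ ≈ θ)
          choice = shrink (0<-+ˡ 0<1 (*-nonNeg (*-nonNeg (*-nonNeg 0≤3 0≤3) 0≤2) (0≤fromℕ (length (patterns 𝓟)))))
            (proj₁ (proj₂ half))
          κ : Carrier
          κ = proj₁ choice
          κ>0 : 0# < κ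
          κ>0 = proj₁ (proj₂ choice)
          large : ∃[ n₁ ] (∀ n → n₁ ℕ.≤ n → 3# ≤ θ * fromℕ n)
          large = let i , θi≈1 , i>0 = inverse>0 (proj₁ (proj₂ half)); n₁ , le = archimedean (i * 3#) in n₁ , λ n p →
            ≤-trans (≤-reflexive (≈-trans (≈-sym (*-identityˡ 3#)) (≈-trans (*-congʳ (≈-sym θi≈1)) (*-assoc θ i 3#))))
              (*-monoˡ-≤ (<⇒≤ (proj₁ (proj₂ half))) (≤-trans le (fromℕ-mono p)))
          random : ∃[ n₂ ] (∀ n → n₂ ℕ.≤ n → (h : Kernel n) → IndKer h → Σ[ φ ∈ (Fin n → Fin n → ℕ) ]
            ((∀ u v → Usable 𝓟 simplex (φ u v)) ×
            (∀ c → c ∈ Φ 𝓟 → Cut (κ * (fromℕ n * fromℕ n)) (λ u v → h u v * 𝟙 (φ u v ℕ.≟ c)) (λ u v → x c * h u v))))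
          random = quasirandom-colouring 𝓟 simplex κ>0
          n : ℕ
          n = n₀ ℕ.⊔ (proj₁ large ℕ.⊔ proj₁ random)
          N : Carrier
          N = fromℕ n
          colouring : Σ[ φ ∈ (Fin n → Fin n → ℕ) ] ((∀ u v → Usable 𝓟 simplex (φ u v)) ×
            (∀ c → c ∈ Φ 𝓟 → Cut (κ * (fromℕ n * fromℕ n)) (λ u v → below? u v * 𝟙 (φ u v ℕ.≟ c)) (λ u v → x c * below? u v)))
          colouring = proj₂ random n (ℕ.≤-trans (ℕ.m≤n⊔m (proj₁ large) _) (ℕ.m≤n⊔m n₀ _)) below? below-ind
          φ : Fin n → Fin n → ℕ
          φ = proj₁ colouring
          usable : ∀ u v → Usable 𝓟 simplex (φ u v)
          usable = proj₁ (proj₂ colouring)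
          e : Carrier
          e = m * (N * (κ * (N * N)) + N * (κ * (N * N)) + N * (κ * (N * N)))
          small : (e + e + e + e + e + e) + 3# * (N * N) ≤ η * fromℕ (n ℕ.^ 3)
          small = begin
            (e + e + e + e + e + e) + 3# * (N * N)  ≈⟨ +-congʳ (solve 3 (λ m N k → let e = m :* (N :* (k :* (N :* N)) :+ N :* (k :* (N :* N)) :+ N :* (k :* (N :* N))) in
                e :+ e :+ e :+ e :+ e :+ e := :3 :* :3 :* :2 :* m :* k :* (N :* (N :* N))) ≈-refl m N κ) ⟩
            3# * 3# * 2# * m * κ * (N * (N * N)) + 3# * (N * N) ≤⟨ +-mono-≤ (*-monoʳ-≤ N³≥0 below-θ)
              (*-monoʳ-≤ (0≤x² N) (proj₂ large n (ℕ.≤-trans (ℕ.m≤m⊔n (proj₁ large) _) (ℕ.m≤n⊔m n₀ _)))) ⟩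
            θ * (N * (N * N)) + θ * N * (N * N)     ≈⟨ solve 2
              (λ t N → t :* (N :* (N :* N)) :+ t :* N :* (N :* N) := :2 :* t :* (N :* (N :* N))) ≈-refl θ N ⟩
            2# * θ * (N * (N * N))                  ≈⟨ *-cong (proj₂ (proj₂ half)) (≈-sym (fromℕ-cube n)) ⟩
            η * fromℕ (n ℕ.^ 3)                     ∎
            where
            open ≤R
            N³≥0 : 0# ≤ N * (N * N)
            N³≥0 = *-nonNeg (0≤fromℕ n) (0≤x² N)
            below-θ : 3# * 3# * 2# * m * κ ≤ θ
            below-θ = ≤-respʳ (proj₂ (proj₂ choice))
              (≤-by (<⇒≤ κ>0) (solve 2 (λ c k → (:1 :+ c) :* k := c :* k :+ k) ≈-refl (3# * 3# * 2# * m) κ))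

  open DenseGraphs

  -- Regular pairs by density increment

  module RegularPairs where

    private
      variable
        n : ℕ

    Vector : ℕ → Set
    Vector n = Fin n → Carrier

    size : Vector n → Carrier
    size = ∑ᵥ

    -- For indicators this is inclusion of supports, stated as an equation that can be substituted
    -- inside sums.
    _⊆ᵛ_ : Vector n → Vector n → Set
    U ⊆ᵛ V = ∀ u → U u ≈ V u * U u

    box : Vector n → Vector n → Kernel n
    box U W u v = U u * W v

    -- Regularity in discrepancy form: for A in U and B in W the number of pairs counted by g
    -- differs from `density` times |A| |B| by at most ε |U| |W|.
    record RegularPair (ε : Carrier) (g : Kernel n) (U W : Vector n) : Set where
      field
        density    : Carrier
        density-≥0 : 0# ≤ density
        density-≤1 : density ≤ 1#
        regular    : Cut (ε * (size U * size W)) (λ u v → box U W u v * g u v) (λ u v → density * box U W u v)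

    open RegularPair public

    abstract
      ⊆ᵛ-trans : {U V W : Vector n} → U ⊆ᵛ V → V ⊆ᵛ W → U ⊆ᵛ W
      ⊆ᵛ-trans {U = U} {V} {W} p q u = ≈-trans (p u) (≈-trans (*-congʳ (q u)) (≈-trans (*-assoc _ _ _) (*-congˡ (≈-sym (p u)))))

      restrict-⊆ : {U a : Vector n} → IndVec U → (λ u → U u * a u) ⊆ᵛ U
      restrict-⊆ {U = U} {a} i u = ≈-trans (*-congʳ (≈-sym (ind-idem (i u)))) (*-assoc _ _ _)

      ⊆ᵛ-refl : {U : Vector n} → IndVec U → U ⊆ᵛ U
      ⊆ᵛ-refl i u = ≈-sym (ind-idem (i u))

      size-≥0 : {U : Vector n} → IndVec U → 0# ≤ size U
      size-≥0 {n} i = ∑-≥0 (allFin n) (λ u → ind-≥0 (i u))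

      size-restrict : {U a : Vector n} → IndVec U → IndVec a → size (λ u → U u * a u) ≤ size U
      size-restrict {n} i j = ∑-mono (allFin n) (λ u → ≤-respʳ (*-identityʳ _) (*-monoˡ-≤ (ind-≥0 (i u)) (ind-≤1 (j u))))

      size-box : (U W : Vector n) → size U * size W ≈ ∑₂ (box U W)
      size-box {n} U W = ∑-double (allFin n) (allFin n) U W

      ∑₂-mono : {f g : Kernel n} → (∀ u v → f u v ≤ g u v) → ∑₂ f ≤ ∑₂ g
      ∑₂-mono {n} h = ∑-mono (allFin n) (λ u → ∑-mono (allFin n) (h u))

      ∑₂-≥0 : {f : Kernel n} → (∀ u v → 0# ≤ f u v) → 0# ≤ ∑₂ f
      ∑₂-≥0 {n} h = ∑-≥0 (allFin n) (λ u → ∑-≥0 (allFin n) (h u))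

      ∑₂-+ : (f g : Kernel n) → ∑₂ (λ u v → f u v + g u v) ≈ ∑₂ f + ∑₂ g
      ∑₂-+ {n} f g = ≈-trans (∑-cong (allFin n) (λ u → ∑-+ (allFin n) (f u) (g u))) (∑-+ (allFin n) _ _)

      ∑₂-- : (f g : Kernel n) → ∑₂ (λ u v → f u v - g u v) ≈ ∑₂ f - ∑₂ g
      ∑₂-- {n} f g = ≈-trans (∑-cong (allFin n) (λ u → ∑-- (allFin n) (f u) (g u))) (∑-- (allFin n) _ _)

      -- A rectangle inside the subpair is a rectangle inside the pair. Only the scale of the error
      -- changes: each of the two sizes drops by a factor of at least δ, whence ε′ = ε δ².
      regular-sub : ∀ {ε ε′ δ} {g : Kernel n} {U W U′ W′ : Vector n} → 0# ≤ ε → 0# ≤ δ → IndVec U → IndVec W →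
        IndVec U′ → IndVec W′ →
        U′ ⊆ᵛ U → W′ ⊆ᵛ W → δ * size U ≤ size U′ → δ * size W ≤ size W′ → ε′ ≈ ε * (δ * δ) →
        RegularPair ε′ g U W → RegularPair ε g U′ W′
      regular-sub {n} {ε} {ε′} {δ} {g} {U} {W} {U′} {W′} ε≥0 δ≥0 i j i′ j′ p q s t e R = record
        { density = R .density ; density-≥0 = R .density-≥0 ; density-≤1 = R .density-≤1
        ; regular = mkCut (λ a b ia ib → near-mono bound (near-cong (sides a b g) (sides′ a b)
            (R .regular .cut (λ u → a u * U′ u) (λ v → b v * W′ v) (λ u → ind-* (ia u) (i′ u)) (λ v → ind-* (ib v) (j′ v))))) }
        where
        bound : ε′ * (size U * size W) ≤ ε * (size U′ * size W′)
        bound = ≤-respˡ (≈-trans (solve 4 (λ e d u w → e :* (d :* u :* (d :* w)) := e :* (d :* d) :*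
          (u :* w)) ≈-refl ε δ (size U) (size W)) (*-congʳ (≈-sym e)))
          (*-monoˡ-≤ ε≥0 (*-mono-≤ (*-nonNeg δ≥0 (size-≥0 j)) (*-nonNeg δ≥0 (size-≥0 i)) s t))
        absorb : ∀ (a b : Vector n) u v → a u * U′ u * (b v * W′ v) * box U W u v ≈ a u * b v * box U′ W′ u v
        absorb a b u v = ≈-trans (solve 6 (λ a b u w u′ w′ → a :* u′ :* (b :* w′) :* (u :* w) := a :* b :*
          (u :* u′ :* (w :* w′))) ≈-refl (a u) (b v) (U u) (W v) (U′ u) (W′ v))
          (*-congˡ (*-cong (≈-sym (p u)) (≈-sym (q v))))
        sides : ∀ (a b : Vector n) (g : Kernel n) → ∑₂
          (λ u v → a u * U′ u * (b v * W′ v) * (box U W u v * g u v)) ≈ ∑₂ (λ u v → a u * b v * (box U′ W′ u v * g u v))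
        sides a b g = ∑₂-cong {n} (λ u v → ≈-trans (≈-sym (*-assoc _ _ _)) (≈-trans (*-congʳ (absorb a b u v)) (*-assoc _ _ _)))
        sides′ : ∀ (a b : Vector n) → ∑₂ (λ u v → a u * U′ u * (b v * W′ v) * (R .density * box U W u v)) ≈ ∑₂
          (λ u v → a u * b v * (R .density * box U′ W′ u v))
        sides′ a b = ∑₂-cong {n} (λ u v → ≈-trans (rotate _ _ _) (≈-trans (*-congˡ (absorb a b u v)) (≈-sym (rotate _ _ _))))
          where
          rotate : ∀ x d y → x * (d * y) ≈ d * (x * y)
          rotate = solve 3 (λ x d y → x :* (d :* y) := d :* (x :* y)) ≈-refl

    -- The power of θ by which j increments may shrink either side of a pair.
    shrinkage : Carrier → ℕ → Carrier
    shrinkage θ zero    = 1#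
    shrinkage θ (suc j) = shrinkage θ j * θ

    abstract
      shrinkage>0 : ∀ {θ} → 0# < θ → ∀ j → 0# < shrinkage θ j
      shrinkage>0 θ>0 zero = 0<1
      shrinkage>0 θ>0 (suc j) = 0<-* (shrinkage>0 θ>0 j) θ>0

      shrinkage≤1 : ∀ {θ} → 0# < θ → θ ≤ 1# → ∀ j → shrinkage θ j ≤ 1#
      shrinkage≤1 θ>0 θ≤1 zero = ≤-refl
      shrinkage≤1 θ>0 θ≤1 (suc j) = ≤-respʳ (*-identityˡ 1#)
        (*-mono-≤ (<⇒≤ θ>0) (<⇒≤ (shrinkage>0 θ>0 j)) (shrinkage≤1 θ>0 θ≤1 j) θ≤1)

    module Increment {ε θ : Carrier} (θ>0 : 0# < θ) (3θ≈ε : 3# * θ ≈ ε) {n : ℕ} (g : Kernel n) (g-ind : IndKer g) where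

      edges-in : Vector n → Vector n → Carrier
      edges-in U W = ∑₂ λ u v → box U W u v * g u v

      restrict : Vector n → Vector n → Vector n
      restrict U a u = U u * a u

      excess : Carrier → Vector n → Vector n → Vector n → Vector n → Carrier
      excess d U W a b = ∑₂ λ u v → a u * b v * (box U W u v * g u v - d * box U W u v)

      record Denser (d : Carrier) (U W : Vector n) : Set where
        field
          a b      : Vector n
          a-ind    : IndVec a
          b-ind    : IndVec b
          denser   : (d + θ) * (size (restrict U a) * size (restrict W b)) ≤ edges-in (restrict U a) (restrict W b)
          a-large  : θ * size U ≤ size (restrict U a)
          b-large  : θ * size W ≤ size (restrict W b)
          positive : 0# < size U × 0# < size W

      abstract
        edges-≤ : ∀ {U W} → IndVec U → IndVec W → edges-in U W ≤ size U * size W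
        edges-≤ {U} {W} i j = ≤-respʳ (≈-sym (size-box U W)) (∑₂-mono (λ u v → ≤-respʳ (*-identityʳ _)
          (*-monoˡ-≤ (ind-≥0 (ind-* (i u) (j v))) (ind-≤1 (g-ind u v)))))

        edges-≥0 : ∀ {U W} → IndVec U → IndVec W → 0# ≤ edges-in U W
        edges-≥0 i j = ∑₂-≥0 (λ u v → ind-≥0 (ind-* (ind-* (i u) (j v)) (g-ind u v)))

        excess-split : ∀ d U W (a b : Vector n) → excess d U W a b ≈
          ∑₂ (λ u v → a u * b v * (box U W u v * g u v)) - ∑₂ (λ u v → a u * b v * (d * box U W u v))
        excess-split d U W a b = ≈-trans (∑₂-cong {n} (λ u v → distrib (a u * b v) _ _))
          (∑₂-- (λ u v → a u * b v * (box U W u v * g u v)) (λ u v → a u * b v * (d * box U W u v)))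
          where
          distrib : ∀ x y z → x * (y - z) ≈ x * y - x * z
          distrib = solve 3 (λ x y z → x :* (y :- z) := x :* y :- x :* z) ≈-refl

        excess≈ : ∀ d U W (a b : Vector n) → excess d U W a b ≈ edges-in (restrict U a) (restrict W b) - d *
          (size (restrict U a) * size (restrict W b))
        excess≈ d U W a b = ≈-trans (excess-split d U W a b) (+-cong
          (∑₂-cong {n} (λ u v → solve 5 (λ a b u w g → a :* b :* (u :* w :* g) := u :* a :* (w :* b) :* g) ≈-refl
            (a u) (b v) (U u) (W v) (g u v)))
          (-‿cong (≈-trans (∑₂-cong {n} (λ u v → solve 5
            (λ a b u w d → a :* b :* (d :* (u :* w)) := d :* (u :* a :* (w :* b))) ≈-refl (a u) (b v) (U u) (W v) d))
            (≈-trans (∑₂-*ˡ {n} d _) (*-congˡ (≈-sym (size-box (restrict U a) (restrict W b))))))))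

        excess-parts : ∀ d U W (a b : Vector n) → let a′ = λ u → 1# - a u; b′ = λ u → 1# - b u in
          excess d U W a b + excess d U W a b′ + excess d U W a′ b + excess d U W a′ b′ ≈ edges-in U W - d * (size U * size W)
        excess-parts d U W a b = ≈-trans
          (≈-sym (≈-trans (∑₂-+ (λ u v → p a b u v + p a b′ u v + p a′ b u v) (p a′ b′)) (+-congʳ
            (≈-trans (∑₂-+ (λ u v → p a b u v + p a b′ u v) (p a′ b)) (+-congʳ (∑₂-+ (p a b) (p a b′)))))))
          (≈-trans (∑₂-cong {n} (λ u v → partition (a u) (b v) (box U W u v * g u v - d * box U W u v)))
            (≈-trans (∑₂-- (λ u v → box U W u v * g u v) (λ u v → d * box U W u v))
            (+-congˡ (-‿cong (≈-trans (∑₂-*ˡ {n} d _) (*-congˡ (≈-sym (size-box U W))))))))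
          where
          a′ b′ : Vector n
          a′ u = 1# - a u
          b′ u = 1# - b u
          p : Vector n → Vector n → Kernel n
          p a b u v = a u * b v * (box U W u v * g u v - d * box U W u v)
          partition : ∀ a b f → a * b * f + a * (1# - b) * f + (1# - a) * b * f + (1# - a) * (1# - b) * f ≈ f
          partition = solve 3 (λ a b f → a :* b :* f :+ a :* (:1 :- b) :* f :+ (:1 :- a) :* b :* f :+ (:1 :- a) :*
            (:1 :- b) :* f := f) ≈-refl

        private
          cancel-size : ∀ {s t p} → 0# ≤ s → 0# < t → θ * (s * t) ≤ p * t → θ * s ≤ p
          cancel-size {s} {t} {p} s≥0 t>0 h = *-cancel-≤ t>0
            (≤-respˡ (solve 3 (λ θ s t → θ :* (s :* t) := t :* (θ :* s)) ≈-refl θ s t) (≤-respʳ (*-comm p t) h))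

        -- A rectangle of large excess is itself a denser pair, and it cannot be thin.
        large-excess : ∀ {d U W} → 0# ≤ d → IndVec U → IndVec W → ∀ a b → IndVec a → IndVec b →
          θ * (size U * size W) < excess d U W a b → Denser d U W
        large-excess {d} {U} {W} d≥0 i j a b ia ib (le , ne) = record
          { a = a ; b = b ; a-ind = ia ; b-ind = ib
          ; denser = ≤-by (0≤-+ (x≤y⇒0≤y-x le′) (*-nonNeg (<⇒≤ θ>0) (x≤y⇒0≤y-x sub)))
              (solve 5 (λ d θ s t e → e := (d :+ θ) :* s :+ (e :- d :* s :- θ :* t :+ θ :* (t :- s))) ≈-refl d θ _
                (size U * size W) E)
          ; a-large = cancel-size (size-≥0 i) (proj₂ positive)
            (≤-trans θ≤E (≤-trans (edges-≤ i′ j′) (*-monoˡ-≤ (size-≥0 i′) (size-restrict j ib))))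
          ; b-large = cancel-size (size-≥0 j) (proj₁ positive)
            (≤-respˡ (*-congˡ (*-comm _ _)) (≤-trans θ≤E (≤-trans (edges-≤ i′ j′)
              (≤-trans (*-monoʳ-≤ (size-≥0 j′) (size-restrict i ia)) (≤-reflexive (*-comm _ _))))))
          ; positive = positive
          }
          where
          i′ : IndVec (restrict U a)
          i′ u = ind-* (i u) (ia u)
          j′ : IndVec (restrict W b)
          j′ u = ind-* (j u) (ib u)
          E : Carrier
          E = edges-in (restrict U a) (restrict W b)
          le′ : θ * (size U * size W) ≤ E - d * (size (restrict U a) * size (restrict W b))
          le′ = ≤-respʳ (excess≈ d U W a b) le
          sub : size (restrict U a) * size (restrict W b) ≤ size U * size W
          sub = *-mono-≤ (size-≥0 j′) (size-≥0 i′) (size-restrict i ia) (size-restrict j ib)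
          drop : E - d * (size (restrict U a) * size (restrict W b)) ≤ E
          drop = ≤-by (*-nonNeg d≥0 (*-nonNeg (size-≥0 i′) (size-≥0 j′))) (solve 2 (λ E s → E := E :- s :+ s) ≈-refl E _)
          θ≤E : θ * (size U * size W) ≤ E
          θ≤E = ≤-trans le′ drop
          nonempty-product : ¬ (0# ≈ size U * size W)
          nonempty-product z = ne (≤-antisym le (≤-respˡ (≈-sym (excess≈ d U W a b))
            (≤-trans drop (≤-trans (≤-trans (edges-≤ i′ j′) sub)
            (≤-reflexive (≈-trans (≈-sym z) (≈-trans (≈-sym (zeroʳ θ)) (*-congˡ z))))))))
          positive : 0# < size U × 0# < size W
          positive = (size-≥0 i , λ z → nonempty-product (≈-trans (≈-sym (zeroˡ _)) (*-congʳ z))) ,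
                     (size-≥0 j , λ z → nonempty-product (≈-trans (≈-sym (zeroʳ _)) (*-congˡ z)))

        -- No rectangle has excess above θ |U| |W|. The whole pair has nonnegative excess, so a
        -- rectangle of very negative excess would force one of its three complementary rectangles
        -- above that bound; this is the origin of ε = 3 θ.
        not-denser⇒regular : ∀ {d U W} → 0# ≤ d → d ≤ 1# → IndVec U → IndVec W → d * (size U * size W) ≤ edges-in U W →
          ¬ Denser d U W → RegularPair ε g U W
        not-denser⇒regular {d} {U} {W} d≥0 d≤1 i j h none = record
          { density = d ; density-≥0 = d≥0 ; density-≤1 = d≤1
          ; regular = mkCut (λ a b ia ib → upper a b ia ib & lower a b ia ib) }
          where
          s θs : Carrier
          s = size U * size W
          θs = θ * s
          small : ∀ a b → IndVec a → IndVec b → excess d U W a b ≤ θs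
          small a b ia ib = ≮⇒≥ (λ q → none (large-excess d≥0 i j a b ia ib q))
          θs≥0 : 0# ≤ θs
          θs≥0 = *-nonNeg (<⇒≤ θ>0) (*-nonNeg (size-≥0 i) (size-≥0 j))
          ε≈ : ε * s ≈ θs + θs + θs
          ε≈ = ≈-trans (*-congʳ (≈-sym 3θ≈ε)) (solve 2 (λ θ s → :3 :* θ :* s := θ :* s :+ θ :* s :+ θ :* s) ≈-refl θ s)
          upper : ∀ a b → IndVec a → IndVec b → ∑₂ (λ u v → a u * b v * (box U W u v * g u v)) ≤ ∑₂
            (λ u v → a u * b v * (d * box U W u v)) + ε * s
          upper a b ia ib = ≤-by-eq (0≤-+ (x≤y⇒0≤y-x (small a b ia ib)) (0≤-+ θs≥0 θs≥0)) (+-cong (excess-split d U W a b) ε≈)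
            (solve 5 (λ x y e t E → y :+ E := x :+ (t :- e :+ (t :+ t)) :+ ((e :+ E) :- ((x :- y) :+ (t :+ t :+ t)))) ≈-refl
              (∑₂ (λ u v → a u * b v * (box U W u v * g u v))) (∑₂ (λ u v → a u * b v * (d * box U W u v)))
                (excess d U W a b) θs (ε * s))
          lower : ∀ a b → IndVec a → IndVec b → ∑₂ (λ u v → a u * b v * (d * box U W u v)) ≤ ∑₂
            (λ u v → a u * b v * (box U W u v * g u v)) + ε * s
          lower a b ia ib = ≤-by-eq
            (0≤-+ (0≤-+ (0≤-+ (x≤y⇒0≤y-x (small a b′ ia ib′)) (x≤y⇒0≤y-x (small a′ b ia′ ib)))
              (x≤y⇒0≤y-x (small a′ b′ ia′ ib′))) (x≤y⇒0≤y-x h))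
            (+-cong (+-cong (≈-sym (excess-split d U W a b)) ε≈) (excess-parts d U W a b))
            (certificate X Y (excess d U W a b) (excess d U W a b′) (excess d U W a′ b) (excess d U W a′ b′) θs
              (ε * s) (edges-in U W) (d * s))
            where
            a′ b′ : Vector n
            a′ u = 1# - a u
            b′ u = 1# - b u
            ia′ : IndVec a′
            ia′ u = ind-not (ia u)
            ib′ : IndVec b′
            ib′ u = ind-not (ib u)
            X Y : Carrier
            X = ∑₂ (λ u v → a u * b v * (box U W u v * g u v))
            Y = ∑₂ (λ u v → a u * b v * (d * box U W u v))
            certificate : ∀ X Y e f g h t E S D → X + E ≈ Y + (t - f + (t - g) + (t - h) + (S - D)) +
              (X - Y + E + (e + f + g + h) - (e + (t + t + t) + (S - D)))
            certificate X Y e f g h t E S D = solve 6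
              (λ X Y E T P Q → X :+ E := Y :+ (T :- P :+ Q) :+ (X :- Y :+ E :+ P :- (T :+ Q))) ≈-refl X Y E
              (t + t + t) (f + g + h) (S - D)
              ▹ +-cong (+-congˡ (+-congʳ (solve 4 (λ t f g h → t :+ t :+ t :- (f :+ g :+ h) := t :- f :+ (t :- g) :+
                (t :- h)) ≈-refl t f g h)))
                  (solve 7 (λ X Y E e P T Q → X :- Y :+ E :+ P :- (T :+ Q) := X :- Y :+ E :+ (e :+ P) :-
                    (e :+ T :+ Q)) ≈-refl X Y E e (f + g + h) (t + t + t) (S - D)
                   ▹ +-congʳ (+-congˡ (solve 4 (λ e f g h → e :+ (f :+ g :+ h) := e :+ f :+ g :+ h) ≈-refl e f g h)))
              where
              infixl 4 _▹_
              _▹_ : ∀ {x y z} → x ≈ y → y ≈ z → x ≈ z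
              _▹_ = ≈-trans

      record RegularSubpair (δ : Carrier) (U W : Vector n) : Set where
        field
          U′ W′   : Vector n
          U′-ind  : IndVec U′
          W′-ind  : IndVec W′
          U′⊆U    : U′ ⊆ᵛ U
          W′⊆W    : W′ ⊆ᵛ W
          U′-size : δ * size U ≤ size U′
          W′-size : δ * size W ≤ size W′
          pair-regular : RegularPair ε g U′ W′

      abstract
        private
          itself : ∀ {U W} → IndVec U → IndVec W → RegularPair ε g U W → RegularSubpair 1# U W
          itself {U} {W} i k R = record { U′ = U ; W′ = W ; U′-ind = i ; W′-ind = k ; U′⊆U = ⊆ᵛ-refl i ; W′⊆W = ⊆ᵛ-refl k
            ; U′-size = ≤-reflexive (*-identityˡ _) ; W′-size = ≤-reflexive (*-identityˡ _) ; pair-regular = R }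

          weaken : ∀ {δ U W} → δ ≤ 1# → IndVec U → IndVec W → RegularSubpair 1# U W → RegularSubpair δ U W
          weaken {δ} δ≤1 i k S = record { RegularSubpair S
            ; U′-size = ≤-trans (*-monoʳ-≤ (size-≥0 i) δ≤1) (RegularSubpair.U′-size S)
            ; W′-size = ≤-trans (*-monoʳ-≤ (size-≥0 k) δ≤1) (RegularSubpair.W′-size S) }

          not-denser-than-1 : ∀ {d U W} → 1# ≤ d → IndVec U → IndVec W → ¬ Denser d U W
          not-denser-than-1 {d} {U} {W} d≥1 i k D = contradiction (≤-antisym (<⇒≤ θs>0) θs≤0) (proj₂ θs>0)
            where
            open Denser D
            s : Carrier
            s = size (restrict U a) * size (restrict W b)
            s>0 : 0# < s
            s>0 = 0<-* (<-≤-trans (0<-* θ>0 (proj₁ positive)) a-large) (<-≤-trans (0<-* θ>0 (proj₂ positive)) b-large)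
            θs>0 : 0# < θ * s
            θs>0 = 0<-* θ>0 s>0
            θs≤0 : θ * s ≤ 0#
            θs≤0 = ≤-by (0≤-+ (x≤y⇒0≤y-x (≤-trans denser (edges-≤ (λ u → ind-* (i u) (a-ind u)) (λ u → ind-* (k u) (b-ind u)))))
                (*-nonNeg (<⇒≤ s>0) (x≤y⇒0≤y-x d≥1)))
              (solve 3 (λ d θ s → :0 := θ :* s :+ (s :- (d :+ θ) :* s :+ s :* (d :- :1))) ≈-refl d θ s)

        -- Density increment: passing to a denser pair raises the density by θ, which can happen at most j times.
        regular-subpair : θ ≤ 1# → ∀ j {d U W} → 0# ≤ d → d ≤ 1# → 1# ≤ d + fromℕ j * θ → IndVec U → IndVec W →
          d * (size U * size W) ≤ edges-in U W → RegularSubpair (shrinkage θ j) U W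
        regular-subpair θ≤1 j {d} {U} {W} p q r i k h with em {Denser d U W}
        ... | no none = weaken (shrinkage≤1 θ>0 θ≤1 j) i k (itself i k (not-denser⇒regular p q i k h none))
        regular-subpair θ≤1 zero {d} {U} {W} p q r i k h | yes D =
          contradiction D (not-denser-than-1 (≤-respʳ (≈-trans (+-congˡ (zeroˡ θ)) (+-identityʳ d)) r) i k)
        regular-subpair θ≤1 (suc j) {d} {U} {W} p q r i k h | yes D = widen (go (total (d + θ) 1#))
          where
          open Denser D
          i′ : IndVec (restrict U a)
          i′ u = ind-* (i u) (a-ind u)
          k′ : IndVec (restrict W b)
          k′ u = ind-* (k u) (b-ind u)
          s≥0 : 0# ≤ size (restrict U a) * size (restrict W b)
          s≥0 = *-nonNeg (size-≥0 i′) (size-≥0 k′)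
          go : d + θ ≤ 1# ⊎ 1# ≤ d + θ → RegularSubpair (shrinkage θ j) (restrict U a) (restrict W b)
          go (inj₁ le) = regular-subpair θ≤1 j (0≤-+ p (<⇒≤ θ>0)) le
            (≤-respʳ (solve 3 (λ d θ j → d :+ (:1 :+ j) :* θ := d :+ θ :+ j :* θ) ≈-refl d θ (fromℕ j)) r) i′ k′ denser
          -- If the new density would exceed 1, the recursion continues with 1, which the denser
          -- pair reaches a fortiori.
          go (inj₂ ge) = regular-subpair θ≤1 j 0≤1 ≤-refl (≤-by (*-nonNeg (0≤fromℕ j) (<⇒≤ θ>0)) ≈-refl) i′ k′
            (≤-trans (*-monoʳ-≤ s≥0 ge) denser)
          widen : RegularSubpair (shrinkage θ j) (restrict U a) (restrict W b) → RegularSubpair (shrinkage θ (suc j)) U W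
          widen S = record { RegularSubpair S
            ; U′⊆U = ⊆ᵛ-trans (RegularSubpair.U′⊆U S) (restrict-⊆ i)
            ; W′⊆W = ⊆ᵛ-trans (RegularSubpair.W′⊆W S) (restrict-⊆ k)
            ; U′-size = ≤-trans (≤-respˡ (≈-sym (*-assoc _ _ _)) (*-monoˡ-≤ (<⇒≤ (shrinkage>0 θ>0 j)) a-large))
              (RegularSubpair.U′-size S)
            ; W′-size = ≤-trans (≤-respˡ (≈-sym (*-assoc _ _ _)) (*-monoˡ-≤ (<⇒≤ (shrinkage>0 θ>0 j)) b-large))
              (RegularSubpair.W′-size S)
            }

    abstract
      regular-mono : ∀ {ε ε′} {g : Kernel n} {U W : Vector n} → IndVec U → IndVec W → ε′ ≤ ε → RegularPair ε′ g U W →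
        RegularPair ε g U W
      regular-mono i j le R = record { RegularPair R
        ; regular = mkCut (λ a b ia ib → near-mono (*-monoʳ-≤ (*-nonNeg (size-≥0 i) (size-≥0 j)) le)
          (R .regular .cut a b ia ib)) }

      regular-pair : ∀ {ε} → 0# < ε → ∃[ δ ] (0# < δ × δ ≤ 1# ×
        (∀ {n} (g : Kernel n) → IndKer g → ∀ {U W : Vector n} → IndVec U → IndVec W →
        Σ[ U′ ∈ Vector n ] Σ[ W′ ∈ Vector n ] (IndVec U′ × IndVec W′ × U′ ⊆ᵛ U × W′ ⊆ᵛ W × δ * size U ≤ size U′ × δ * size W ≤ size W′ × RegularPair ε g U′ W′)))
      regular-pair {ε} ε>0 = δ , δ>0 , δ≤1 , λ {n} g g-ind {U} {W} i j →
        let module I = Increment θ>0 3θ≈ε′ {n} g g-ind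
            S = I.regular-subpair θ≤1 J ≤-refl 0≤1 (≤-respʳ (≈-sym (+-identityˡ _)) J-large) i j
                  (≤-respˡ (≈-sym (zeroˡ _)) (I.edges-≥0 i j))
            open I.RegularSubpair S
        in U′ , W′ , U′-ind , W′-ind , U′⊆U , W′⊆W , U′-size , W′-size , regular-mono U′-ind W′-ind ε′≤ε pair-regular
        where
        -- Capping ε at 1 gives θ ≤ 1, so that the proportions in `shrinkage` never grow.
        truncated : ∃[ ε′ ] (0# < ε′ × ε′ ≤ ε × ε′ ≤ 1#)
        truncated = ⊓-pos ε>0 0<1
        ε′≤ε : proj₁ truncated ≤ ε
        ε′≤ε = proj₁ (proj₂ (proj₂ truncated))
        third : ∃[ θ ] (0# < θ × 3# * θ ≈ proj₁ truncated)
        third = shrink 0<3 (proj₁ (proj₂ truncated))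
        θ : Carrier
        θ = proj₁ third
        θ>0 : 0# < θ
        θ>0 = proj₁ (proj₂ third)
        3θ≈ε′ : 3# * θ ≈ proj₁ truncated
        3θ≈ε′ = proj₂ (proj₂ third)
        θ≤1 : θ ≤ 1#
        θ≤1 = ≤-trans (≤-by (*-nonNeg 0≤2 (<⇒≤ θ>0)) (solve 1 (λ t → :3 :* t := t :+ :2 :* t) ≈-refl θ))
          (≤-trans (≤-reflexive 3θ≈ε′) (proj₂ (proj₂ (proj₂ truncated))))
        steps : ∃[ J ] 1# ≤ fromℕ J * θ
        steps = let i , θi≈1 , _ = inverse>0 θ>0; J , le = archimedean i in
          J , ≤-respˡ θi≈1 (≤-respʳ (*-comm _ _) (*-monoˡ-≤ (<⇒≤ θ>0) le))
        J : ℕ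
        J = proj₁ steps
        J-large : 1# ≤ fromℕ J * θ
        J-large = proj₂ steps
        δ : Carrier
        δ = shrinkage θ J
        δ>0 : 0# < δ
        δ>0 = shrinkage>0 θ>0 J
        δ≤1 : δ ≤ 1#
        δ≤1 = shrinkage≤1 θ>0 θ≤1 J

  open RegularPairs

  -- Regular families, intervals of an order, and Ramsey's theorem

  module RegularFamilies where

    private
      variable
        n k : ℕ

    colour-kernel : (Fin n → Fin n → ℕ) → ℕ → Kernel n
    colour-kernel φ c u v = 𝟙 (φ u v ℕ.≟ c)

    Task : ℕ → Set
    Task k = Fin k × Fin k × ℕ

    record Subfamily (δ : Carrier) (U : Fin k → Vector n) : Set where
      field
        sub       : Fin k → Vector n
        sub-ind   : ∀ i → IndVec (sub i)
        sub-⊆     : ∀ i → sub i ⊆ᵛ U i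
        sub-large : ∀ i → δ * size (U i) ≤ size (sub i)

    open Subfamily public

    RegularFor : Carrier → (Fin n → Fin n → ℕ) → (Fin k → Vector n) → Task k → Set
    RegularFor ε φ U (i , j , c) = RegularPair ε (colour-kernel φ c) (U i) (U j)

    abstract
      private
        choose : {A B : Set} → Dec A → Dec B → Vector n → Vector n → Vector n → Vector n
        choose (yes _) _ X Y Z = X
        choose (no _) (yes _) X Y Z = Y
        choose (no _) (no _) X Y Z = Z

        choose-elim : {A B : Set} (P : Vector n → Set) {X Y Z : Vector n} (p : Dec A) (q : Dec B) →
          (A → P X) → (B → P Y) → P Z → P (choose p q X Y Z)
        choose-elim P (yes a) q f g h = f a
        choose-elim P (no _) (yes b) f g h = g b
        choose-elim P (no _) (no _) f g h = h

        choose-first : {A B : Set} {X Y Z : Vector n} (p : Dec A) (q : Dec B) → A → choose p q X Y Z ≡ X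
        choose-first (yes _) q a = ≡.refl
        choose-first (no ¬a) q a = contradiction a ¬a

        choose-second : {A B : Set} {X Y Z : Vector n} (p : Dec A) (q : Dec B) → ¬ A → B → choose p q X Y Z ≡ Y
        choose-second (yes a) q ¬a b = contradiction a ¬a
        choose-second (no _) (yes _) ¬a b = ≡.refl
        choose-second (no _) (no ¬b) ¬a b = contradiction b ¬b

      -- Each task is made regular with a margin that absorbs the shrinking caused by all later tasks.
      regular-family : (L : List (Task k)) → (∀ i j c → (i , j , c) ∈ L → i ≢ j) → ∀ {ε} → 0# < ε →
        ∃[ δ ] (0# < δ × (∀ {n} (φ : Fin n → Fin n → ℕ) (U : Fin k → Vector n) → (∀ i → IndVec (U i)) →
          Σ[ S ∈ Subfamily δ U ] (∀ t → t ∈ L → RegularFor ε φ (S .sub) t)))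
      regular-family [] distinct {ε} ε>0 = 1# , 0<1 , λ φ U i → record
        { sub = U ; sub-ind = i ; sub-⊆ = λ l → ⊆ᵛ-refl (i l) ; sub-large = λ l → ≤-reflexive (*-identityˡ _) } , λ t ()
      regular-family {k} ((i , j , c) ∷ L) distinct {ε} ε>0 = δ , 0<-* δ₁>0 δ₂>0 , build
        where
        later : ∃[ δ ] (0# < δ × (∀ {n} (φ : Fin n → Fin n → ℕ) (U : Fin k → Vector n) → (∀ i → IndVec (U i)) →
          Σ[ S ∈ Subfamily δ U ] (∀ t → t ∈ L → RegularFor ε φ (S .sub) t)))
        later = regular-family L (λ i j c p → distinct i j c (there p)) ε>0
        δ₁ : Carrier
        δ₁ = proj₁ later
        δ₁>0 : 0# < δ₁
        δ₁>0 = proj₁ (proj₂ later)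
        first : ∃[ δ ] (0# < δ × δ ≤ 1# × (∀ {n} (g : Kernel n) → IndKer g → ∀ {U W : Vector n} → IndVec U → IndVec W →
          Σ[ U′ ∈ Vector n ] Σ[ W′ ∈ Vector n ] (IndVec U′ × IndVec W′ × U′ ⊆ᵛ U × W′ ⊆ᵛ W × δ * size U ≤ size U′ × δ * size W ≤ size W′ ×
            RegularPair (ε * (δ₁ * δ₁)) g U′ W′)))
        first = regular-pair (0<-* ε>0 (0<-* δ₁>0 δ₁>0))
        δ₂ : Carrier
        δ₂ = proj₁ first
        δ₂>0 : 0# < δ₂
        δ₂>0 = proj₁ (proj₂ first)
        δ₂≤1 : δ₂ ≤ 1#
        δ₂≤1 = proj₁ (proj₂ (proj₂ first))
        δ : Carrier
        δ = δ₁ * δ₂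
        build : ∀ {n} (φ : Fin n → Fin n → ℕ) (U : Fin k → Vector n) → (∀ i → IndVec (U i)) →
          Σ[ S ∈ Subfamily δ U ] (∀ t → t ∈ (i , j , c) ∷ L → RegularFor ε φ (S .sub) t)
        build {n} φ U ind-U = combine (proj₂ (proj₂ (proj₂ first)) (colour-kernel φ c) (λ u v → 𝟙-ind (φ u v ℕ.≟ c))
          (ind-U i) (ind-U j))
          where
          combine : Σ[ X ∈ Vector n ] Σ[ Y ∈ Vector n ]
            (IndVec X × IndVec Y × X ⊆ᵛ U i × Y ⊆ᵛ U j × δ₂ * size (U i) ≤ size X × δ₂ * size (U j) ≤ size Y ×
              RegularPair (ε * (δ₁ * δ₁)) (colour-kernel φ c) X Y) →
            Σ[ S ∈ Subfamily δ U ] (∀ t → t ∈ (i , j , c) ∷ L → RegularFor ε φ (S .sub) t)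
          combine (X , Y , X-ind , Y-ind , X⊆ , Y⊆ , X-large , Y-large , R) = S , regular-task
            where
            V : Fin k → Vector n
            V l = choose (l Fin.≟ i) (l Fin.≟ j) X Y (U l)
            V-ind : ∀ l → IndVec (V l)
            V-ind l = choose-elim IndVec {X} {Y} {U l} (l Fin.≟ i) (l Fin.≟ j) (λ _ → X-ind) (λ _ → Y-ind) (ind-U l)
            V⊆ : ∀ l → V l ⊆ᵛ U l
            V⊆ l = choose-elim (_⊆ᵛ U l) {X} {Y} {U l} (l Fin.≟ i) (l Fin.≟ j) (λ { ≡.refl → X⊆ }) (λ { ≡.refl → Y⊆ })
              (⊆ᵛ-refl (ind-U l))
            V-large : ∀ l → δ₂ * size (U l) ≤ size (V l)
            V-large l = choose-elim (λ Z → δ₂ * size (U l) ≤ size Z) {X} {Y} {U l} (l Fin.≟ i) (l Fin.≟ j)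
              (λ { ≡.refl → X-large }) (λ { ≡.refl → Y-large })
              (≤-respʳ (*-identityˡ _) (*-monoʳ-≤ (size-≥0 (ind-U l)) δ₂≤1))
            R′ : RegularPair (ε * (δ₁ * δ₁)) (colour-kernel φ c) (V i) (V j)
            R′ = ≡.subst₂ (RegularPair (ε * (δ₁ * δ₁)) (colour-kernel φ c))
              (≡.sym (choose-first (i Fin.≟ i) (i Fin.≟ j) ≡.refl))
              (≡.sym (choose-second (j Fin.≟ i) (j Fin.≟ j) (λ e → distinct i j c (here ≡.refl) (≡.sym e)) ≡.refl)) R
            rest : Σ[ S ∈ Subfamily δ₁ V ] (∀ t → t ∈ L → RegularFor ε φ (S .sub) t)
            rest = proj₂ (proj₂ later) φ V V-ind
            S₁ : Subfamily δ₁ V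
            S₁ = proj₁ rest
            S : Subfamily δ U
            S = record
              { sub = S₁ .sub ; sub-ind = S₁ .sub-ind
              ; sub-⊆ = λ l → ⊆ᵛ-trans (S₁ .sub-⊆ l) (V⊆ l)
              ; sub-large = λ l → ≤-trans (≤-respˡ (≈-sym (*-assoc _ _ _)) (*-monoˡ-≤ (<⇒≤ δ₁>0) (V-large l))) (S₁ .sub-large l) }
            regular-task : ∀ t → t ∈ (i , j , c) ∷ L → RegularFor ε φ (S₁ .sub) t
            regular-task t (here ≡.refl) = regular-sub (<⇒≤ ε>0) (<⇒≤ δ₁>0) (V-ind i) (V-ind j) (S₁ .sub-ind i) (S₁ .sub-ind j)
              (S₁ .sub-⊆ i) (S₁ .sub-⊆ j) (S₁ .sub-large i) (S₁ .sub-large j) ≈-refl R′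
            regular-task t (there p) = proj₂ rest t p

    module Intervals {n : ℕ} (rank : Fin n → ℕ) (rank-injective : ∀ {x y} → rank x ≡ rank y → x ≡ y) where

      initial : ℕ → ℕ
      initial t = #[ allFin n ] (λ u → rank u ℕ.<? t)

      abstract
        -- Counts are compared as real sums of indicators; this brings the inequality back to the
        -- natural numbers.
        fromℕ-reflects-≤ : ∀ {a b} → fromℕ a ≤ fromℕ b → a ℕ.≤ b
        fromℕ-reflects-≤ {a} {b} p with a ℕ.≤? b
        ... | yes q = q
        ... | no q = contradiction (≤-antisym 0≤1 (≤-by (x≤y⇒0≤y-x (≤-trans (fromℕ-mono (ℕ.≰⇒> q)) p))
          (solve 1 (λ b → :0 := :1 :+ (b :- (:1 :+ b))) ≈-refl (fromℕ b)))) (proj₂ 0<1)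

        initial≈ : ∀ t → fromℕ (initial t) ≈ ∑ᵥ λ u → 𝟙 (rank u ℕ.<? t)
        initial≈ t = fromℕ-count (λ u → rank u ℕ.<? t) (allFin n)

        initial-mono : ∀ {s t} → s ℕ.≤ t → initial s ℕ.≤ initial t
        initial-mono {s} {t} p = fromℕ-reflects-≤ (≤-respˡ (≈-sym (initial≈ s)) (≤-respʳ (≈-sym (initial≈ t))
          (∑-mono (allFin n) (λ u → 𝟙-mono (rank u ℕ.<? s) (rank u ℕ.<? t) (λ q → ℕ.≤-trans q p)))))

        level-≤1 : ∀ t → ∑ᵥ (λ u → 𝟙 (rank u ℕ.≟ t)) ≤ 1#
        level-≤1 t with em {∃[ u ] rank u ≡ t}
        ... | yes (u₀ , ≡.refl) = ≤-respˡ (∑-cong (allFin n)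
          (λ u → 𝟙-cong (u Fin.≟ u₀) (rank u ℕ.≟ rank u₀) (≡.cong rank) rank-injective))
          (∑-dirac-≤1 Fin._≟_ u₀ (allFin⁺ n))
        ... | no none = ≤-respˡ (≈-sym (≈-trans (∑-cong (allFin n) (λ u → 𝟙-no (rank u ℕ.≟ t) (λ e → none (u , e))))
          (∑-zero (allFin n)))) 0≤1

        initial-suc : ∀ t → initial (suc t) ℕ.≤ suc (initial t)
        initial-suc t = fromℕ-reflects-≤ (≤-respˡ (≈-sym (initial≈ (suc t))) (≤-trans
          (≤-respʳ (≈-trans (∑-+ (allFin n) _ _) (+-comm _ _)) (∑-mono (allFin n) split))
          (+-mono-≤ (level-≤1 t) (≤-reflexive (≈-sym (initial≈ t))))))
          where
          split : ∀ u → 𝟙 (rank u ℕ.<? suc t) ≤ 𝟙 (rank u ℕ.<? t) + 𝟙 (rank u ℕ.≟ t)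
          split u = go (rank u ℕ.<? t) (rank u ℕ.≟ t)
            where
            go : Dec (rank u ℕ.< t) → Dec (rank u ≡ t) → 𝟙 (rank u ℕ.<? suc t) ≤ 𝟙 (rank u ℕ.<? t) + 𝟙 (rank u ℕ.≟ t)
            go (yes p) _ = ≤-trans (ind-≤1 (𝟙-ind (rank u ℕ.<? suc t)))
              (≤-by (ind-≥0 (𝟙-ind (rank u ℕ.≟ t))) (+-congʳ (𝟙-yes (rank u ℕ.<? t) p)))
            go (no _) (yes q) = ≤-trans (ind-≤1 (𝟙-ind (rank u ℕ.<? suc t)))
              (≤-by (ind-≥0 (𝟙-ind (rank u ℕ.<? t))) (≈-trans (+-congˡ (𝟙-yes (rank u ℕ.≟ t) q)) (+-comm _ _)))
            go (no p) (no q) = ≤-respˡ (≈-sym (𝟙-no (rank u ℕ.<? suc t) (λ { (ℕ.s≤s r) → p (ℕ.≤∧≢⇒< r q) })))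
              (0≤-+ (ind-≥0 (𝟙-ind (rank u ℕ.<? t))) (ind-≥0 (𝟙-ind (rank u ℕ.≟ t))))

        rank-bound : ∃[ T ] (∀ u → rank u ℕ.< T)
        rank-bound = bounded n rank
          where
          bounded : ∀ m (f : Fin m → ℕ) → ∃[ T ] (∀ u → f u ℕ.< T)
          bounded zero f = 0 , λ ()
          bounded (suc m) f = let T , p = bounded m (λ u → f (Fin.suc u)) in suc (f Fin.zero) ℕ.⊔ T ,
            λ { Fin.zero → ℕ.m≤m⊔n _ T ; (Fin.suc u) → ℕ.≤-trans (p u) (ℕ.m≤n⊔m (suc (f Fin.zero)) T) }

        initial-bound : n ℕ.≤ initial (proj₁ rank-bound)
        initial-bound = fromℕ-reflects-≤ (≤-respʳ (≈-sym (initial≈ (proj₁ rank-bound))) (≤-reflexive (≈-sym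
          (≈-trans (∑-cong (allFin n) (λ u → 𝟙-yes (rank u ℕ.<? proj₁ rank-bound) (proj₂ rank-bound u)))
            (≈-trans (∑-const (allFin n) 1#) (≈-trans (*-identityʳ _) (≈-reflexive (≡.cong fromℕ (length-allFin n)))))))))

        initial-zero : initial 0 ℕ.≤ 0
        initial-zero = fromℕ-reflects-≤ (≤-reflexive
          (≈-trans (initial≈ 0) (≈-trans (∑-cong (allFin n) (λ u → 𝟙-no (rank u ℕ.<? 0) (λ ()))) (∑-zero (allFin n)))))

        -- A discrete intermediate value theorem: `initial` starts at 0, rises by at most 1 at each
        -- step because the rank is injective, and reaches n.
        attained : ∀ v → ∃[ t ] (v ℕ.≤ n → initial t ≡ v)
        attained v = go (v ℕ.≤? n)
          where
          search : ∀ T → v ℕ.≤ initial T → ∃[ t ] initial t ≡ v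
          search zero p = 0 , ℕ.≤-antisym (ℕ.≤-trans initial-zero ℕ.z≤n) p
          search (suc T) p with v ℕ.≤? initial T
          ... | yes q = search T q
          ... | no q = suc T , ℕ.≤-antisym (ℕ.≤-trans (initial-suc T) (ℕ.≰⇒> q)) p
          go : Dec (v ℕ.≤ n) → ∃[ t ] (v ℕ.≤ n → initial t ≡ v)
          go (yes p) = let t , e = search (proj₁ rank-bound) (ℕ.≤-trans p initial-bound) in t , λ _ → e
          go (no q) = 0 , λ p → contradiction p q

      threshold : ℕ → ℕ
      threshold v = proj₁ (attained v)

      -- Ranks may have gaps. The cuts are therefore placed by the number of vertices below them, at
      -- multiples of s.
      interval : ℕ → ℕ → Vector n
      interval s i u = (1# - 𝟙 (rank u ℕ.<? threshold (i ℕ.* s))) * 𝟙 (rank u ℕ.<? threshold (suc i ℕ.* s))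

      abstract
        interval-ind : ∀ s i → IndVec (interval s i)
        interval-ind s i u = ind-* (ind-not (𝟙-ind (rank u ℕ.<? threshold (i ℕ.* s))))
          (𝟙-ind (rank u ℕ.<? threshold (suc i ℕ.* s)))

        interval-size : ∀ s i → suc i ℕ.* s ℕ.≤ n → fromℕ s ≤ size (interval s i)
        interval-size s i p = ≤-trans (≤-by-eq ≤-refl counted
          (solve 3 (λ a b s → b :- a := s :+ :0 :+ (b :- (s :+ a))) ≈-refl A B (fromℕ s)))
          (≤-respˡ (∑-- (allFin n) _ _) (∑-mono (allFin n)
            (λ u → difference (𝟙-ind (rank u ℕ.<? threshold (i ℕ.* s))) (𝟙-ind (rank u ℕ.<? threshold (suc i ℕ.* s))))))
          where
          A B : Carrier
          A = ∑ᵥ λ u → 𝟙 (rank u ℕ.<? threshold (i ℕ.* s))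
          B = ∑ᵥ λ u → 𝟙 (rank u ℕ.<? threshold (suc i ℕ.* s))
          counted : B ≈ fromℕ s + A
          counted = ≈-trans (≈-sym (initial≈ (threshold (suc i ℕ.* s))))
            (≈-trans (≈-reflexive (≡.cong fromℕ (proj₂ (attained (suc i ℕ.* s)) p)))
            (≈-trans (fromℕ-+ s (i ℕ.* s)) (+-congˡ (≈-trans
              (≈-reflexive (≡.cong fromℕ (≡.sym (proj₂ (attained (i ℕ.* s)) (ℕ.≤-trans (ℕ.m≤n+m _ s) p)))))
              (initial≈ (threshold (i ℕ.* s)))))))
          difference : ∀ {p q} → Ind p → Ind q → q - p ≤ (1# - p) * q
          difference {p} {q} i j = ≤-by (*-nonNeg (ind-≥0 i) (ind-≥0 (ind-not j)))
            (solve 2 (λ p q → (:1 :- p) :* q := q :- p :+ p :* (:1 :- q)) ≈-refl p q)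

        interval-member : ∀ s i {u} → interval s i u ≈ 1# → ¬ (rank u ℕ.< threshold (i ℕ.* s)) × rank u ℕ.< threshold
          (suc i ℕ.* s)
        interval-member s i {u} e = lower , upper (rank u ℕ.<? threshold (suc i ℕ.* s))
          where
          lower : ¬ (rank u ℕ.< threshold (i ℕ.* s))
          lower p = 1≉0 (≈-trans (≈-sym e) (≈-trans
            (*-congʳ (≈-trans (+-congˡ (-‿cong (𝟙-yes (rank u ℕ.<? threshold (i ℕ.* s)) p))) (-‿inverseʳ 1#))) (zeroˡ _)))
          upper : Dec (rank u ℕ.< threshold (suc i ℕ.* s)) → rank u ℕ.< threshold (suc i ℕ.* s)
          upper (yes p) = p
          upper (no q) = contradiction (≈-trans (≈-sym e)
            (≈-trans (*-congˡ (𝟙-no (rank u ℕ.<? threshold (suc i ℕ.* s)) q)) (zeroʳ _))) 1≉0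

        interval-order : ∀ s i j → 0 ℕ.< s → i ℕ.< j → j ℕ.* s ℕ.≤ n → ∀ {u v} → interval s i u ≈ 1# →
          interval s j v ≈ 1# → rank u ℕ.< rank v
        interval-order s i j s>0 i<j p {u} {v} e f = ℕ.<-≤-trans (proj₂ (interval-member s i e))
          (ℕ.≤-trans thresholds (ℕ.≮⇒≥ (proj₁ (interval-member s j f))))
          where
          -- Adjacent intervals share their cut. Otherwise the two counts differ strictly, and since
          -- `initial` is monotone, thresholds in the wrong order would put the counts in the wrong
          -- order.
          thresholds : threshold (suc i ℕ.* s) ℕ.≤ threshold (j ℕ.* s)
          thresholds with suc i ℕ.≟ j
          ... | yes ≡.refl = ℕ.≤-refl
          ... | no ne = ℕ.<⇒≤ (ℕ.≰⇒> (λ q → ℕ.<⇒≱ (ℕ.*-monoˡ-< s {{ℕ.>-nonZero s>0}} (ℕ.≤∧≢⇒< i<j ne))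
            (≡.subst₂ ℕ._≤_ (proj₂ (attained (j ℕ.* s)) p)
              (proj₂ (attained (suc i ℕ.* s)) (ℕ.≤-trans (ℕ.*-monoˡ-≤ s i<j) p)) (initial-mono q))))

    -- Besides the first vertex, one vertex more than q + 1 classes of the previous size forces a
    -- larger class. Without colours, two vertices are already contradictory.
    ramsey-number : ℕ → ℕ
    ramsey-number zero    = 2
    ramsey-number (suc q) = suc (suc (suc q ℕ.* ramsey-number q))

    module _ {A X : Set} (_≺_ : A → A → Set) (χ : A → A → X) where

      record MonochromaticTriangle (xs : List A) : Set where
        field
          i j l : A
          i∈    : i ∈ xs
          j∈    : j ∈ xs
          l∈    : l ∈ xs
          i≺j   : i ≺ j
          i≺l   : i ≺ l
          j≺l   : j ≺ l
          ij≡il : χ i j ≡ χ i l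
          ij≡jl : χ i j ≡ χ j l

      abstract
        private
          _≟X_ : (x y : X) → Dec (x ≡ y)
          x ≟X y = em

        pigeonhole : ∀ m (f : A → X) (cs : List X) (xs : List A) → (∀ y → y ∈ xs → f y ∈ cs) → length cs ℕ.* m ℕ.< length xs →
          ∃[ c ] (c ∈ cs × m ℕ.< length (filter (λ y → f y ≟X c) xs))
        pigeonhole m f [] [] h ()
        pigeonhole m f [] (y ∷ xs) h p with h y (here ≡.refl)
        ... | ()
        pigeonhole m f (c ∷ cs) xs h p with m ℕ.<? length (filter (λ y → f y ≟X c) xs)
        ... | yes q = c , here ≡.refl , q
        ... | no q = let c′ , i , r = pigeonhole m f cs rest rest-colours rest-long in
          c′ , there i , ℕ.<-≤-trans r (shorter xs c′)
          where
          rest : List A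
          rest = filter (λ y → ¬? (f y ≟X c)) xs
          rest-colours : ∀ y → y ∈ rest → f y ∈ cs
          rest-colours y i = drop (h y (proj₁ (∈-filter⁻ (λ y → ¬? (f y ≟X c)) {xs = xs} i)))
            (proj₂ (∈-filter⁻ (λ y → ¬? (f y ≟X c)) {xs = xs} i))
            where
            drop : ∀ {z} → z ∈ c ∷ cs → ¬ (z ≡ c) → z ∈ cs
            drop (here e) ne = contradiction e ne
            drop (there i) ne = i
          partition : ∀ ys → length ys ≡ length (filter (λ y → f y ≟X c) ys) ℕ.+ length (filter (λ y → ¬? (f y ≟X c)) ys)
          partition [] = ≡.refl
          partition (y ∷ ys) with f y ≟X c
          ... | yes _ = ≡.cong suc (partition ys)
          ... | no _ = ≡.trans (≡.cong suc (partition ys)) (≡.sym (ℕ.+-suc _ _))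
          rest-long : length cs ℕ.* m ℕ.< length rest
          rest-long = ℕ.+-cancelˡ-< m _ _ (ℕ.<-≤-trans p
            (≡.subst (ℕ._≤ m ℕ.+ length rest) (≡.sym (partition xs)) (ℕ.+-monoˡ-≤ _ (ℕ.≮⇒≥ q))))
          shorter : ∀ ys c′ → length (filter (λ y → f y ≟X c′) (filter (λ y → ¬? (f y ≟X c)) ys)) ℕ.≤ length
            (filter (λ y → f y ≟X c′) ys)
          shorter [] c′ = ℕ.z≤n
          shorter (y ∷ ys) c′ with f y ≟X c
          ... | yes _ with f y ≟X c′
          ...   | yes _ = ℕ.m≤n⇒m≤1+n (shorter ys c′)
          ...   | no _ = shorter ys c′
          shorter (y ∷ ys) c′ | no _ with f y ≟X c′
          ...   | yes _ = ℕ.s≤s (shorter ys c′)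
          ...   | no _ = shorter ys c′

        -- By pigeonhole the first vertex x sees many later vertices in one colour c. Two of them
        -- joined in colour c close a triangle with x; if there are none, c disappears from the
        -- colours among them and induction on the number of colours applies.
        ramsey : ∀ q (cs : List X) → length cs ℕ.≤ q → (xs : List A) → AllPairs _≺_ xs → ramsey-number q ℕ.≤ length xs →
          (∀ i j → i ∈ xs → j ∈ xs → i ≺ j → χ i j ∈ cs) → MonochromaticTriangle xs
        ramsey q cs le [] ps big h = contradiction (ℕ.≤-trans (positive q) big) λ ()
          where
          positive : ∀ q → 1 ℕ.≤ ramsey-number q
          positive zero = ℕ.s≤s ℕ.z≤n
          positive (suc q) = ℕ.s≤s ℕ.z≤n
        ramsey zero [] le (x ∷ []) ps (ℕ.s≤s ()) h
        ramsey zero [] le (x ∷ y ∷ xs) ((x≺y All.∷ _) ∷ _) big h with h x y (here ≡.refl) (there (here ≡.refl)) x≺y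
        ... | ()
        ramsey (suc q) cs le (x ∷ xs) (px ∷ ps) (ℕ.s≤s big) h = go (pigeonhole (ramsey-number q) (χ x) cs xs
            (λ y i → h x y (here ≡.refl) (there i) (All.lookup px i)) (ℕ.≤-trans (ℕ.s≤s (ℕ.*-monoˡ-≤ (ramsey-number q) le)) big))
          where
          go : ∃[ c ] (c ∈ cs × ramsey-number q ℕ.< length (filter (λ y → χ x y ≟X c) xs)) → MonochromaticTriangle (x ∷ xs)
          go (c , c∈ , long) = split em
            where
            ys : List A
            ys = filter (λ y → χ x y ≟X c) xs
            from-ys : ∀ {y} → y ∈ ys → y ∈ xs × χ x y ≡ c
            from-ys i = ∈-filter⁻ (λ y → χ x y ≟X c) {xs = xs} i
            split : Dec (∃[ i ] ∃[ j ] (i ∈ ys × j ∈ ys × i ≺ j × χ i j ≡ c)) → MonochromaticTriangle (x ∷ xs)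
            split (yes (i , j , i∈ , j∈ , i≺j , e)) = record
              { i = x ; j = i ; l = j ; i∈ = here ≡.refl ; j∈ = there (proj₁ (from-ys i∈)) ; l∈ = there (proj₁ (from-ys j∈))
              ; i≺j = All.lookup px (proj₁ (from-ys i∈)) ; i≺l = All.lookup px (proj₁ (from-ys j∈)) ; j≺l = i≺j
              ; ij≡il = ≡.trans (proj₂ (from-ys i∈)) (≡.sym (proj₂ (from-ys j∈))) ; ij≡jl = ≡.trans
                (proj₂ (from-ys i∈)) (≡.sym e) }
            split (no none) = lift (ramsey q (filter (λ d → ¬? (d ≟X c)) cs)
                (ℕ.≤-pred (ℕ.≤-trans (List.filter-notAll (λ d → ¬? (d ≟X c)) cs (Any.map (λ { ≡.refl ne → ne ≡.refl }) c∈)) le))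
                ys (AllPairs.filter⁺ (λ y → χ x y ≟X c) ps) (ℕ.<⇒≤ long)
                (λ i j i∈ j∈ i≺j → ∈-filter⁺ (λ d → ¬? (d ≟X c))
                  (h i j (there (proj₁ (from-ys i∈))) (there (proj₁ (from-ys j∈))) i≺j)
                  (λ e → none (i , j , i∈ , j∈ , i≺j , e))))
              where
              lift : MonochromaticTriangle ys → MonochromaticTriangle (x ∷ xs)
              lift M = record { MonochromaticTriangle M
                ; i∈ = there (proj₁ (from-ys (MonochromaticTriangle.i∈ M)))
                ; j∈ = there (proj₁ (from-ys (MonochromaticTriangle.j∈ M)))
                ; l∈ = there (proj₁ (from-ys (MonochromaticTriangle.l∈ M))) }

    abstract
      rounding : ∀ K {y} → 0# ≤ y → y ≤ fromℕ K → ∃[ m ] (m ℕ.≤ K × fromℕ m ≤ y × y ≤ fromℕ m + 1#)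
      rounding zero p q = 0 , ℕ.z≤n , p , ≤-trans q (≤+ 0≤1)
      rounding (suc K) {y} p q = go (≤-or-> y (fromℕ K))
        where
        go : y ≤ fromℕ K ⊎ fromℕ K < y → ∃[ m ] (m ℕ.≤ suc K × fromℕ m ≤ y × y ≤ fromℕ m + 1#)
        go (inj₁ r) = let m , m≤K , s , t = rounding K p r in m , ℕ.m≤n⇒m≤1+n m≤K , s , t
        go (inj₂ r) = K , ℕ.n≤1+n K , <⇒≤ r , ≤-respʳ (+-comm 1# (fromℕ K)) q

    -- The possible lists of rounded densities. They serve as the colours in Ramsey's theorem, so
    -- their number must be finite and independent of the graph.
    grid : List ℕ → ℕ → List (List ℕ)
    grid []      K = [] ∷ []
    grid (_ ∷ L) K = cartesianProductWith _∷_ (upTo (suc K)) (grid L K)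

    abstract
      map-∈-grid : ∀ L {K} (f : ℕ → ℕ) → (∀ a → a ∈ L → f a ℕ.≤ K) → map f L ∈ grid L K
      map-∈-grid [] f h = here ≡.refl
      map-∈-grid (a ∷ L) f h = ∈-cartesianProductWith⁺ _∷_ (∈-upTo⁺ (ℕ.s≤s (h a (here ≡.refl))))
        (map-∈-grid L f (λ b i → h b (there i)))

      map-injective : ∀ (L : List ℕ) (f g : ℕ → ℕ) → map f L ≡ map g L → ∀ a → a ∈ L → f a ≡ g a
      map-injective (b ∷ L) f g e a (here ≡.refl) = List.∷-injectiveˡ e
      map-injective (b ∷ L) f g e a (there i) = map-injective L f g (List.∷-injectiveʳ e) a i

  open RegularFamilies

  -- Indicator kernels as test sets

  module TestSets where

    private
      variable
        n : ℕ

    subset-of : Vector n → Subset n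
    subset-of A = Vec.tabulate λ v → ⌊ em {A v ≈ 1#} ⌋

    -- At most one direction of each pair is present. Forgetting directions then loses nothing: the
    -- indicator of the unordered pairs is the sum of both directions.
    record Oriented (K : Kernel n) : Set where
      field
        K-ind : IndKer K
        asym  : ∀ {u v} → K u v ≈ 1# → ¬ (K v u ≈ 1#)

    open Oriented public

    loopless : {K : Kernel n} → Oriented K → ∀ {u v} → K u v ≈ 1# → u ≢ v
    loopless o k ≡.refl = o .asym k k

    pairs-of : (K : Kernel n) → Oriented K → UniformSet 2 n
    pairs-of {n} K o .member e = ⌊ em {Σ[ u ∈ Fin n ] Σ[ v ∈ Fin n ] (K u v ≈ 1# × e ≡ pair u v)} ⌋
    pairs-of K o .uniform e i = let u , v , k , e≡ = toWitness i in
      ≡.trans (≡.cong ∣_∣ e≡) (∣pair∣ (loopless o k))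

    abstract
      ind-subset-of : {A : Vector n} → IndVec A → ∀ v → ind (subset-of A) v ≈ A v
      ind-subset-of {A = A} A-ind v = go (A-ind v)
        where
        go : Ind (A v) → ind (subset-of A) v ≈ A v
        go (inj₂ e) = ≈-trans (𝟙-yes (v ∈? subset-of A)
          (Vec.lookup⇒[]= v _ (≡.trans (Vec.lookup∘tabulate _ v) (isTrue em e)))) (≈-sym e)
          where
          isTrue : {P : Set} (d : Dec P) → P → ⌊ d ⌋ ≡ true
          isTrue (yes _) p = ≡.refl
          isTrue (no ¬p) p = contradiction p ¬p
        go (inj₁ e) = ≈-trans (𝟙-no (v ∈? subset-of A)
          (λ i → isFalse em (λ e′ → 1≉0 (≈-trans (≈-sym e′) e))
          (≡.trans (≡.sym (Vec.lookup∘tabulate _ v)) (Vec.[]=⇒lookup i)))) (≈-sym e)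
          where
          isFalse : {P : Set} (d : Dec P) → ¬ P → ⌊ d ⌋ ≢ true
          isFalse (yes p) ¬p = contradiction p ¬p
          isFalse (no _) ¬p ()

      linked-pairs-of : (K : Kernel n) (o : Oriented K) → ∀ u v → linked (pairs-of K o) u v ≈ K u v + K v u
      linked-pairs-of {n} K o u v = go (o .K-ind u v) (o .K-ind v u)
        where
        P : UniformSet 2 n
        P = pairs-of K o
        go : Ind (K u v) → Ind (K v u) → linked P u v ≈ K u v + K v u
        go (inj₂ e) (inj₂ f) = contradiction f (o .asym e)
        go (inj₂ e) (inj₁ f) = ≈-trans (𝟙-yes (P ∋? pair u v) (fromWitness (u , v , e , ≡.refl)))
          (≈-sym (≈-trans (+-cong e f) (+-identityʳ 1#)))
        go (inj₁ e) (inj₂ f) = ≈-trans (𝟙-yes (P ∋? pair u v) (fromWitness (v , u , f , pair-comm u v)))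
          (≈-sym (≈-trans (+-cong e f) (+-identityˡ 1#)))
        go (inj₁ e) (inj₁ f) = ≈-trans (𝟙-no (P ∋? pair u v) (λ i → none (toWitness i)))
          (≈-sym (≈-trans (+-cong e f) (+-identityˡ 0#)))
          where
          none : ¬ (Σ[ x ∈ Fin n ] Σ[ y ∈ Fin n ] (K x y ≈ 1# × pair u v ≡ pair x y))
          none (x , y , k , p) with pair-injective p
          ... | inj₁ (≡.refl , ≡.refl) = 1≉0 (≈-trans (≈-sym k) e)
          ... | inj₂ (≡.refl , ≡.refl) = 1≉0 (≈-trans (≈-sym k) f)

    record Symmetric₃ (F : Kernel₃ n) : Set where
      field
        swap₁₂ : ∀ x y z → F x y z ≈ F y x z
        swap₂₃ : ∀ x y z → F x y z ≈ F x z y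

    open Symmetric₃ public

    -- Tests are only evaluated against symmetric kernels (1 and the edge indicator), so their coordinates may be permuted.
    _≃_ : Kernel₃ n → Kernel₃ n → Set
    T ≃ T′ = ∀ F → Symmetric₃ F → ∑₃ (λ x y z → T x y z * F x y z) ≈ ∑₃ (λ x y z → T′ x y z * F x y z)

    abstract
      pointwise-≃ : {T T′ : Kernel₃ n} → (∀ x y z → T x y z ≈ T′ x y z) → T ≃ T′
      pointwise-≃ {n} h F s = ∑₃-cong {n} (λ x y z → *-congʳ (h x y z))

      ≃-trans : {T T′ T″ : Kernel₃ n} → T ≃ T′ → T′ ≃ T″ → T ≃ T″
      ≃-trans p q F s = ≈-trans (p F s) (q F s)

      swap₁₂-≃ : (T : Kernel₃ n) → T ≃ (λ y x z → T x y z)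
      swap₁₂-≃ {n} T F s = ≈-trans (∑₃-swap₁₂ {n} _) (∑₃-cong {n} (λ y x z → *-congˡ (s .swap₁₂ x y z)))

      swap₂₃-≃ : (T : Kernel₃ n) → T ≃ (λ x z y → T x y z)
      swap₂₃-≃ {n} T F s = ≈-trans (∑₃-swap₂₃ {n} _) (∑₃-cong {n} (λ x z y → *-congˡ (s .swap₂₃ x y z)))

      edge-symmetric : ∀ H → Symmetric₃ (edge H)
      edge-symmetric H .swap₁₂ = edge-swap₁₂ H
      edge-symmetric H .swap₂₃ = edge-swap₂₃ H

      one-symmetric : Symmetric₃ {n} (λ _ _ _ → 1#)
      one-symmetric .swap₁₂ _ _ _ = ≈-refl
      one-symmetric .swap₂₃ _ _ _ = ≈-refl

      dense-≃ : ∀ {d η H T T′} → T ≃ T′ → DenseFor d η H T → DenseFor d η H T′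
      dense-≃ {d} {η} {H} {T} {T′} p h = ≤-respˡ
        (+-congʳ (*-congˡ (≈-trans (≈-sym (drop T)) (≈-trans (p _ one-symmetric) (drop T′)))))
        (≤-respʳ (p (edge H) (edge-symmetric H)) h)
        where
        drop : (T : Kernel₃ (order H)) → ∑₃ (λ x y z → T x y z * 1#) ≈ ∑₃ T
        drop T = ∑₃-cong {order H} (λ x y z → *-identityʳ (T x y z))

      vvv-test : {X Y Z : Vector n} → IndVec X → IndVec Y → IndVec Z →
        test-vvv (subset-of X) (subset-of Y) (subset-of Z) ≃ (λ x y z → X x * (Y y * Z z))
      vvv-test i j k = pointwise-≃ (λ x y z → *-cong (ind-subset-of i x) (*-cong (ind-subset-of j y) (ind-subset-of k z)))

      -- Pairs are counted through y < z, and each may stem from either direction of `K`.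
      -- Transposing the reversed half completes the condition y < z to y ≠ z, and `K` vanishes on
      -- the diagonal.
      ev-test : {A : Vector n} {K : Kernel n} → IndVec A → (o : Oriented K) →
        test-ev (subset-of A) (pairs-of K o) ≃ (λ x y z → A x * K y z)
      ev-test {n} {A} {K} i o F s = ∑-cong (allFin n) (λ x → ≈-trans
        (∑₂-cong {n} (λ y z → ≈-trans (*-congʳ (*-cong (ind-subset-of i x) (*-congˡ (linked-pairs-of K o y z))))
          (expand (A x) (below? y z) (K y z) (K z y) (F x y z))))
        (≈-trans (∑₂-+ (λ y z → A x * (below? y z * K y z) * F x y z) (λ y z → A x * (below? y z * K z y) * F x y z))
          (≈-trans (+-congˡ (≈-trans (∑-comm (allFin n) (allFin n) _) (∑₂-cong {n} (λ z y → *-congˡ (s .swap₂₃ x y z)))))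
          (≈-trans (≈-sym (∑₂-+ (λ y z → A x * (below? y z * K y z) * F x y z)
            (λ y z → A x * (below? z y * K y z) * F x y z)))
            (∑₂-cong {n} (λ y z → ≈-trans (merge (A x) (below? y z) (below? z y) (K y z) (F x y z))
            (*-congʳ (*-congˡ (≈-trans (*-congʳ (comparable y z)) (off-diagonal y z))))))))))
        where
        expand : ∀ a b k k′ f → a * (b * (k + k′)) * f ≈ a * (b * k) * f + a * (b * k′) * f
        expand = solve 5 (λ a b k k′ f → a :* (b :* (k :+ k′)) :* f := a :* (b :* k) :* f :+ a :* (b :* k′) :* f) ≈-refl
        merge : ∀ a b b′ k f → a * (b * k) * f + a * (b′ * k) * f ≈ a * ((b + b′) * k) * f
        merge = solve 5 (λ a b b′ k f → a :* (b :* k) :* f :+ a :* (b′ :* k) :* f := a :* ((b :+ b′) :* k) :* f) ≈-refl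
        off-diagonal : ∀ y z → (1# - 𝟙 (y Fin.≟ z)) * K y z ≈ K y z
        off-diagonal y z = go (y Fin.≟ z) (o .K-ind y z)
          where
          go : Dec (y ≡ z) → Ind (K y z) → (1# - 𝟙 (y Fin.≟ z)) * K y z ≈ K y z
          go _ (inj₁ e) = ≈-trans (*-congˡ e) (≈-trans (zeroʳ _) (≈-sym e))
          go (yes ≡.refl) (inj₂ e) = contradiction e (o .asym e)
          go (no ne) (inj₂ e) = ≈-trans (*-congʳ (≈-trans (+-congˡ (-‿cong (𝟙-no (y Fin.≟ z) ne)))
            (solve 0 (:1 :- :0 := :1) ≈-refl))) (*-identityˡ _)

      -- In a pair of linked pairs the common vertex lies in the common part.
      ee-test : {A B C : Vector n} {K L : Kernel n} (k : Oriented K) (l : Oriented L) → IndVec A → IndVec B → IndVec C →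
        (∀ v → A v * B v ≈ 0#) → (∀ v → A v * C v ≈ 0#) → (∀ v → B v * C v ≈ 0#) →
        (∀ u v → K u v ≈ A u * B v * K u v) → (∀ u v → L u v ≈ A u * C v * L u v) →
        test-ee (pairs-of K k) (pairs-of L l) ≃ (λ x y z → K y x * L y z)
      ee-test {n} {A} {B} {C} {K} {L} k l a b c AB AC BC K-on L-on = pointwise-≃ (λ x y z →
        ≈-trans (*-cong (linked-pairs-of K k x y) (linked-pairs-of L l y z))
          (≈-trans (expand (K x y) (K y x) (L y z) (L z y))
            (≈-trans (+-congˡ (≈-trans (+-cong (+-cong (BA x y z) (BC′ x y z)) (AC′ x y z)) zeros)) (+-identityʳ _))))
        where
        zeros : 0# + 0# + 0# ≈ 0#
        zeros = ≈-trans (+-congʳ (+-identityˡ 0#)) (+-identityˡ 0#)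
        expand : ∀ p q r s → (p + q) * (r + s) ≈ q * r + (p * r + p * s + q * s)
        expand = solve 4 (λ p q r s → (p :+ q) :* (r :+ s) := q :* r :+ (p :* r :+ p :* s :+ q :* s)) ≈-refl
        vanish : ∀ {p q} → p * q ≈ 0# → ∀ r s → p * q * (r * s) ≈ 0#
        vanish e r s = ≈-trans (*-congʳ e) (zeroˡ _)
        BA : ∀ x y z → K x y * L y z ≈ 0#
        BA x y z = ≈-trans (*-cong (K-on x y) (L-on y z)) (≈-trans
          (solve 6 (λ a b k a′ c l → a :* b :* k :* (a′ :* c :* l) := a′ :* b :* (a :* k :* (c :* l))) ≈-refl (A x)
            (B y) (K x y) (A y) (C z) (L y z)) (vanish (AB y) _ _))
        BC′ : ∀ x y z → K x y * L z y ≈ 0#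
        BC′ x y z = ≈-trans (*-cong (K-on x y) (L-on z y)) (≈-trans
          (solve 6 (λ a b k a′ c l → a :* b :* k :* (a′ :* c :* l) := b :* c :* (a :* k :* (a′ :* l))) ≈-refl (A x)
            (B y) (K x y) (A z) (C y) (L z y)) (vanish (BC y) _ _))
        AC′ : ∀ x y z → K y x * L z y ≈ 0#
        AC′ x y z = ≈-trans (*-cong (K-on y x) (L-on z y)) (≈-trans
          (solve 6 (λ a b k a′ c l → a :* b :* k :* (a′ :* c :* l) := a :* c :* (b :* k :* (a′ :* l))) ≈-refl (A y)
            (B x) (K y x) (A z) (C y) (L z y)) (vanish (AC y) _ _))

      dense-vvv-vectors : ∀ {d η} H {X Y Z : Vector (order H)} → Dense ℝ vvv d η H → IndVec X → IndVec Y → IndVec Z →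
        DenseFor d η H (λ x y z → X x * (Y y * Z z))
      dense-vvv-vectors H {X} {Y} {Z} D i j k = dense-≃ {H = H} (vvv-test i j k)
        (dense-vvv⁻ {H = H} D (subset-of X) (subset-of Y) (subset-of Z))

      dense-ev-oriented : ∀ {d η} H {A : Vector (order H)} {K : Kernel (order H)} → Dense ℝ ev d η H → IndVec A → Oriented K →
        DenseFor d η H (λ x y z → A x * K y z)
      dense-ev-oriented H {A} {K} D i o = dense-≃ {H = H} (ev-test i o) (dense-ev⁻ {H = H} D (subset-of A) (pairs-of K o))

      dense-ee-oriented : ∀ {d η} H {A B C : Vector (order H)} {K L : Kernel (order H)} → Dense ℝ ee d η H →
        Oriented K → Oriented L →
        IndVec A → IndVec B → IndVec C →
        (∀ v → A v * B v ≈ 0#) → (∀ v → A v * C v ≈ 0#) → (∀ v → B v * C v ≈ 0#) →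
        (∀ u v → K u v ≈ A u * B v * K u v) → (∀ u v → L u v ≈ A u * C v * L u v) →
        DenseFor d η H (λ x y z → K y x * L y z)
      dense-ee-oriented H {K = K} {L} D k l a b c AB AC BC K-on L-on = dense-≃ {H = H} (ee-test k l a b c AB AC BC K-on L-on)
        (dense-ee⁻ {H = H} D (pairs-of K k) (pairs-of L l))

  open TestSets

  -- Edges between three regular parts of a coloured graph

  module UpperBounds where

    module UpperBound (𝓟 : Palette) (H : 3Graph) (C : Colouring 𝓟 H) {X Y Z : Vector (order H)} (X-ind : IndVec X)
      (Y-ind : IndVec Y) (Z-ind : IndVec Z)
      (X<Y : ∀ {u v} → X u ≈ 1# → Y v ≈ 1# → Colouring.rank C u ℕ.< Colouring.rank C v)
      (Y<Z : ∀ {u v} → Y u ≈ 1# → Z v ≈ 1# → Colouring.rank C u ℕ.< Colouring.rank C v) where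

      open Colouring C using (rank; coloured) renaming (colour to φ; colour-∈ to φ-∈)

      private
        n : ℕ
        n = order H
        g : ℕ → Kernel n
        g = colour-kernel φ
        e : Kernel₃ n
        e = edge H

      mark : Slot → Kernel n
      mark nothing  u v = 1#
      mark (just a) u v = g a u v

      tripod : Kernel₃ n
      tripod u v w = X u * Y v * Z w

      marked : Pattern → Kernel₃ n
      marked ⟨ m₁ , m₂ , m₃ ⟩ u v w = tripod u v w * (mark m₁ u v * mark m₂ u w * mark m₃ v w)

      abstract
        private
          mark-ind : ∀ m → IndKer (mark m)
          mark-ind nothing u v = ind-1
          mark-ind (just a) u v = 𝟙-ind (φ u v ℕ.≟ a)

          ind-one : ∀ {p q} → Ind p → Ind q → p * q ≈ 1# → p ≈ 1# × q ≈ 1#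
          ind-one (inj₂ e) (inj₂ f) _ = e , f
          ind-one (inj₁ e) j h = contradiction (≈-trans (≈-sym h) (≈-trans (*-congʳ e) (zeroˡ _))) 1≉0
          ind-one (inj₂ e) (inj₁ f) h = contradiction (≈-trans (≈-sym h) (≈-trans (*-congˡ f) (zeroʳ _))) 1≉0

          X<Z : (∃[ v ] Y v ≈ 1#) → ∀ {u v} → X u ≈ 1# → Z v ≈ 1# → rank u ℕ.< rank v
          X<Z (w , y) x z = ℕ.<-trans (X<Y x y) (Y<Z y z)

          disjoint : {A B : Vector n} → IndVec A → IndVec B → (∀ {v} → A v ≈ 1# → B v ≈ 1# → rank v ℕ.< rank v) →
            ∀ v → A v * B v ≈ 0#
          disjoint i j lt v with ind-* (i v) (j v)
          ... | inj₁ z = z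
          ... | inj₂ o = let p , q = ind-one (i v) (j v) o in contradiction (lt p q) (ℕ.<-irrefl ≡.refl)

          oriented : {A B : Vector n} → IndVec A → IndVec B → (∀ v → A v * B v ≈ 0#) → {k : Kernel n} → IndKer k →
            Oriented (λ u v → A u * B v * k u v)
          oriented i j d k .K-ind u v = ind-* (ind-* (i u) (j v)) (k u v)
          oriented i j d k .asym {u} {v} p q =
            let uA , _ = ind-one (i u) (j v) (proj₁ (ind-one (ind-* (i u) (j v)) (k u v) p))
                _ , uB = ind-one (i v) (j u) (proj₁ (ind-one (ind-* (i v) (j u)) (k v u) q))
            in 1≉0 (≈-trans (≈-sym (≈-trans (*-cong uA uB) (*-identityˡ 1#))) (d u))

          on-box : {A B : Vector n} → IndVec A → IndVec B → {k : Kernel n} → ∀ u v → A u * B v * k u v ≈ A u * B v *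
            (A u * B v * k u v)
          on-box i j u v = ≈-sym (≈-trans (≈-sym (*-assoc _ _ _)) (*-congʳ (ind-idem (ind-* (i u) (j v)))))

          XY : ∀ v → X v * Y v ≈ 0#
          XY = disjoint X-ind Y-ind X<Y
          YZ : ∀ v → Y v * Z v ≈ 0#
          YZ = disjoint Y-ind Z-ind Y<Z
          comm₀ : ∀ {p q} → p * q ≈ 0# → q * p ≈ 0#
          comm₀ e = ≈-trans (*-comm _ _) e

          -- If Y is empty, nothing is known about X and Z, but then there is nothing to prove.
          module Nonempty (y : ∃[ v ] Y v ≈ 1#) where
            XZ : ∀ v → X v * Z v ≈ 0#
            XZ = disjoint X-ind Z-ind (X<Z y)

            transposed : {k : Kernel n} → IndKer k → IndKer (λ u v → k v u)
            transposed k u v = k v u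

            -- Colour classes between disjoint parts are oriented kernels and hence legal tests. The
            -- coordinates are permuted until the vertex opposite the pinned pair in mode `ev`, or
            -- common to both pinned pairs in mode `ee`, stands where the mode expects it.
            marked-dense : ∀ ⋆ {d η} → Dense ℝ ⋆ d η H → ∀ m → Admissible 𝓟 ⋆ m → DenseFor d η H (marked m)
            marked-dense vvv D _ vvv₀ = dense-≃ {H = H} (pointwise-≃ (λ u v w →
                solve 3 (λ x y z → x :* (y :* z) := x :* y :* z :* (:1 :* :1 :* :1)) ≈-refl (X u) (Y v) (Z w)))
              (dense-vvv-vectors H D X-ind Y-ind Z-ind)
            marked-dense ev D _ (ev₃ {a} i) = dense-≃ {H = H} (pointwise-≃ (λ u v w →
                solve 4 (λ x y z g → x :* (y :* z :* g) := x :* y :* z :* (:1 :* :1 :* g)) ≈-refl (X u) (Y v) (Z w) (g a v w)))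
              (dense-ev-oriented H D X-ind (oriented Y-ind Z-ind YZ (mark-ind (just a))))
            marked-dense ev D _ (ev₂ {a} i) = dense-≃ {H = H} (≃-trans (swap₁₂-≃ _) (pointwise-≃ (λ u v w →
                solve 4 (λ x y z g → y :* (x :* z :* g) := x :* y :* z :* (:1 :* g :* :1)) ≈-refl (X u) (Y v) (Z w) (g a u w))))
              (dense-ev-oriented H D Y-ind (oriented X-ind Z-ind XZ (mark-ind (just a))))
            marked-dense ev D _ (ev₁ {a} i) = dense-≃ {H = H} (≃-trans (swap₁₂-≃ _) (≃-trans (swap₂₃-≃ _) (pointwise-≃ (λ u v w →
                solve 4 (λ x y z g → z :* (x :* y :* g) := x :* y :* z :* (g :* :1 :* :1)) ≈-refl (X u) (Y v) (Z w) (g a u v)))))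
              (dense-ev-oriented H D Z-ind (oriented X-ind Y-ind XY (mark-ind (just a))))
            marked-dense ee D _ (ee₁₂ {a} {b} i j) = dense-≃ {H = H} 
                (≃-trans (swap₁₂-≃ _) (pointwise-≃ (λ u v w → ≈-trans
                  (solve 5 (λ x y z g h → x :* y :* g :* (x :* z :* h) := x :* x :* (y :* z :* (g :* h :* :1))) ≈-refl
                    (X u) (Y v) (Z w) (g a u v) (g b u w))
                  (≈-trans (*-congʳ (ind-idem (X-ind u))) (solve 5
                    (λ x y z g h → x :* (y :* z :* (g :* h :* :1)) := x :* y :* z :* (g :* h :* :1)) ≈-refl (X u)
                    (Y v) (Z w) (g a u v) (g b u w))))))
              (dense-ee-oriented H D (oriented X-ind Y-ind XY (mark-ind (just a)))
                (oriented X-ind Z-ind XZ (mark-ind (just b))) X-ind Y-ind Z-ind XY XZ YZ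
                  (on-box X-ind Y-ind {g a}) (on-box X-ind Z-ind {g b}))
            marked-dense ee D _ (ee₁₃ {a} {b} i j) = dense-≃ {H = H} 
                (pointwise-≃ (λ u v w → ≈-trans
                  (solve 5 (λ x y z g h → y :* x :* g :* (y :* z :* h) := y :* y :* (x :* z :* (g :* :1 :* h))) ≈-refl
                    (X u) (Y v) (Z w) (g a u v) (g b v w))
                  (≈-trans (*-congʳ (ind-idem (Y-ind v))) (solve 5
                    (λ x y z g h → y :* (x :* z :* (g :* :1 :* h)) := x :* y :* z :* (g :* :1 :* h)) ≈-refl (X u)
                    (Y v) (Z w) (g a u v) (g b v w)))))
              (dense-ee-oriented H D (oriented Y-ind X-ind (λ v → comm₀ (XY v)) (transposed (mark-ind (just a))))
                (oriented Y-ind Z-ind YZ (mark-ind (just b))) Y-ind X-ind Z-ind (λ v → comm₀ (XY v)) YZ XZ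
                  (on-box Y-ind X-ind {λ u v → g a v u}) (on-box Y-ind Z-ind {g b}))
            marked-dense ee D _ (ee₂₃ {a} {b} i j) = dense-≃ {H = H} 
                (≃-trans (swap₂₃-≃ _) (pointwise-≃ (λ u v w → ≈-trans
                  (solve 5 (λ x y z g h → z :* x :* g :* (z :* y :* h) := z :* z :* (x :* y :* (:1 :* g :* h))) ≈-refl
                    (X u) (Y v) (Z w) (g a u w) (g b v w))
                  (≈-trans (*-congʳ (ind-idem (Z-ind w))) (solve 5
                    (λ x y z g h → z :* (x :* y :* (:1 :* g :* h)) := x :* y :* z :* (:1 :* g :* h)) ≈-refl (X u)
                    (Y v) (Z w) (g a u w) (g b v w))))))
              (dense-ee-oriented H D (oriented Z-ind X-ind (λ v → comm₀ (XZ v)) (transposed (mark-ind (just a))))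
                (oriented Z-ind Y-ind (λ v → comm₀ (YZ v)) (transposed (mark-ind (just b)))) Z-ind X-ind Y-ind
                  (λ v → comm₀ (XZ v)) (λ v → comm₀ (YZ v)) XY
                  (on-box Z-ind X-ind {λ u v → g a v u}) (on-box Z-ind Y-ind {λ u v → g b v u}))

      open Nonempty public using (marked-dense)

      volume : Carrier
      volume = size X * size Y * size Z

      module _ {x : ℕ → Carrier} (boxed : Boxed (Φ 𝓟) x) {ε : Carrier} (ε≥0 : 0# ≤ ε)
        (cut-XY : ∀ c → c ∈ Φ 𝓟 → Cut (ε * (size X * size Y)) (λ u v → box X Y u v * g c u v) (λ u v → x c * box X Y u v))
        (cut-XZ : ∀ c → c ∈ Φ 𝓟 → Cut (ε * (size X * size Z)) (λ u v → box X Z u v * g c u v) (λ u v → x c * box X Z u v))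
        (cut-YZ : ∀ c → c ∈ Φ 𝓟 → Cut (ε * (size Y * size Z)) (λ u v → box Y Z u v * g c u v) (λ u v → x c * box Y Z u v)) where

        error : Carrier
        error = ε * volume + ε * volume + ε * volume

        abstract
          private
            mark-ind′ : ∀ m → IndKer (mark m)
            mark-ind′ nothing u v = ind-1
            mark-ind′ (just a) u v = 𝟙-ind (φ u v ℕ.≟ a)

            sizes≥0 : 0# ≤ size X × 0# ≤ size Y × 0# ≤ size Z
            sizes≥0 = size-≥0 X-ind , size-≥0 Y-ind , size-≥0 Z-ind

            volume≥0 : 0# ≤ volume
            volume≥0 = let p , q , r = sizes≥0 in *-nonNeg (*-nonNeg p q) r

            error₁≥0 : 0# ≤ ε * volume
            error₁≥0 = *-nonNeg ε≥0 volume≥0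

            box-ind : {A B : Vector n} → IndVec A → IndVec B → IndKer (box A B)
            box-ind i j u v = ind-* (i u) (j v)

            absorb : ∀ {t} p → Ind t → p * t ≈ p * t * t
            absorb p i = ≈-trans (*-congˡ (≈-sym (ind-idem i))) (≈-sym (*-assoc p _ _))

            separable₁₂ : Separable tripod
            separable₁₂ = record { coef = 1# ; coef-≥0 = 0≤1 ; coef-≤1 = ≤-refl ; left = λ u w → X u * Z w ; right = λ v w → Y v
              ; left-ind = λ u w → ind-* (X-ind u) (Z-ind w) ; right-ind = λ v w → Y-ind v ; domain = Z ; domain-ind = Z-ind
              ; splits = λ u v w → solve 3 (λ x y z → x :* y :* z := :1 :* (x :* z :* y)) ≈-refl (X u) (Y v) (Z w)
              ; supported = λ u w → absorb (X u) (Z-ind w) }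

            separable₁₃ : Separable (λ u w v → tripod u v w)
            separable₁₃ = record { coef = 1# ; coef-≥0 = 0≤1 ; coef-≤1 = ≤-refl ; left = λ u v → X u * Y v ; right = λ w v → Z w
              ; left-ind = λ u v → ind-* (X-ind u) (Y-ind v) ; right-ind = λ w v → Z-ind w ; domain = Y ; domain-ind = Y-ind
              ; splits = λ u w v → ≈-sym (*-identityˡ _)
              ; supported = λ u v → absorb (X u) (Y-ind v) }

            separable₂₃ : Separable (λ v w u → tripod u v w)
            separable₂₃ = record { coef = 1# ; coef-≥0 = 0≤1 ; coef-≤1 = ≤-refl ; left = λ v u → Y v * X u ; right = λ w u → Z w
              ; left-ind = λ v u → ind-* (Y-ind v) (X-ind u) ; right-ind = λ w u → Z-ind w ; domain = X ; domain-ind = X-ind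
              ; splits = λ v w u → solve 3 (λ x y z → x :* y :* z := :1 :* (y :* x :* z)) ≈-refl (X u) (Y v) (Z w)
              ; supported = λ v u → absorb (Y v) (X-ind u) }

            replace₁₂ : ∀ {m} → Coloured 𝓟 m → Replace (ε * volume) tripod (λ u v → box X Y u v * mark m u v) (ω x m) (box X Y)
            replace₁₂ free = exact error₁≥0 (λ u v → *-comm _ _)
            replace₁₂ (pinned i) = let p , q , r = sizes≥0 in close separable₁₂ ≈-refl (*-nonNeg ε≥0 (*-nonNeg p q))
              (≤-reflexive (solve 4 (λ e x y z → z :* (e :* (x :* y)) := e :* (x :* y :* z)) ≈-refl ε (size X)
                (size Y) (size Z))) (cut-XY _ i)

            replace₁₃ : ∀ {m} → Coloured 𝓟 m → Replace (ε * volume) (λ u w v → tripod u v w)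
              (λ u w → box X Z u w * mark m u w) (ω x m) (box X Z)
            replace₁₃ free = exact error₁≥0 (λ u v → *-comm _ _)
            replace₁₃ (pinned i) = let p , q , r = sizes≥0 in close separable₁₃ ≈-refl (*-nonNeg ε≥0 (*-nonNeg p r))
              (≤-reflexive (solve 4 (λ e x y z → y :* (e :* (x :* z)) := e :* (x :* y :* z)) ≈-refl ε (size X)
                (size Y) (size Z))) (cut-XZ _ i)

            replace₂₃ : ∀ {m} → Coloured 𝓟 m → Replace (ε * volume) (λ v w u → tripod u v w)
              (λ v w → box Y Z v w * mark m v w) (ω x m) (box Y Z)
            replace₂₃ free = exact error₁≥0 (λ u v → *-comm _ _)
            replace₂₃ (pinned i) = let p , q , r = sizes≥0 in close separable₂₃ ≈-refl (*-nonNeg ε≥0 (*-nonNeg q r))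
              (≤-reflexive (solve 4 (λ e x y z → x :* (e :* (y :* z)) := e :* (x :* y :* z)) ≈-refl ε (size X)
                (size Y) (size Z))) (cut-YZ _ i)

            cube : ∀ {t} → Ind t → t * t * t ≈ t
            cube i = ≈-trans (*-congʳ (ind-idem i)) (ind-idem i)

            -- Every part occurs three times and indicators are idempotent. The boxes in which the
            -- cut bounds are stated can therefore be inserted without changing the sum.
            tripod-boxes : ∀ p q r u v w → tripod u v w *
              ((box X Y u v * p) * (box X Z u w * q) * (box Y Z v w * r)) ≈ tripod u v w * (p * q * r)
            tripod-boxes p q r u v w = ≈-trans shuffle
              (*-congʳ (*-cong (*-cong (cube (X-ind u)) (cube (Y-ind v))) (cube (Z-ind w))))
              where
              group : ∀ a b c p q r → (a * b * p) * (a * c * q) * (b * c * r) ≈ (a * b) * (a * c) * (b * c) * (p * q * r)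
              group = solve 6 (λ a b c p q r → (a :* b :* p) :* (a :* c :* q) :* (b :* c :* r) := (a :* b) :*
                (a :* c) :* (b :* c) :* (p :* q :* r)) ≈-refl
              regroup : ∀ a b c k → a * b * c * ((a * b) * (a * c) * (b * c) * k) ≈ (a * a * a) * (b * b * b) * (c * c * c) * k
              regroup = solve 4 (λ a b c k → a :* b :* c :* ((a :* b) :* (a :* c) :* (b :* c) :* k) :=
                (a :* a :* a) :* (b :* b :* b) :* (c :* c :* c) :* k) ≈-refl
              shuffle : tripod u v w * ((box X Y u v * p) * (box X Z u w * q) * (box Y Z v w * r)) ≈
                (X u * X u * X u) * (Y v * Y v * Y v) * (Z w * Z w * Z w) * (p * q * r)
              shuffle = ≈-trans (*-congˡ (group (X u) (Y v) (Z w) p q r)) (regroup (X u) (Y v) (Z w) (p * q * r))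

            ∑-tripod : ∑₃ tripod ≈ volume
            ∑-tripod = ≈-trans (∑₂-cong {n} (λ u v → ∑-*ˡ (allFin n) (X u * Y v) Z))
              (≈-trans (∑-cong (allFin n) (λ u → ∑-*ʳ (allFin n) (size Z) _))
              (≈-trans (∑-*ʳ (allFin n) (size Z) _) (*-congʳ (≈-sym (size-box X Y)))))

          -- In each replacement the third part is the domain, so the error of a cut between two
          -- parts becomes ε times the volume of all three.
          counted : ∀ {m₁ m₂ m₃} → Coloured 𝓟 m₁ → Coloured 𝓟 m₂ → Coloured 𝓟 m₃ →
            Near error (∑₃ (marked ⟨ m₁ , m₂ , m₃ ⟩)) (weight x ⟨ m₁ , m₂ , m₃ ⟩ * volume)
          counted {m₁} {m₂} {m₃} i j k = near-cong
            (∑₃-cong {n} (λ u v w → tripod-boxes (mark m₁ u v) (mark m₂ u w) (mark m₃ v w) u v w))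
            (≈-trans (∑₃-cong {n} (λ u v w → ≈-trans (*-congˡ (*-cong (*-cong (*-comm _ _) (*-comm _ _)) (*-comm _ _)))
                (≈-trans (tripod-boxes (ω x m₁) (ω x m₂) (ω x m₃) u v w) (*-comm _ _))))
              (≈-trans (∑₃-*ˡ {n} (weight x ⟨ m₁ , m₂ , m₃ ⟩) tripod) (*-congˡ ∑-tripod)))
            (counting tripod
              (λ u v → ind-* (box-ind X-ind Y-ind u v) (mark-ind′ m₁ u v))
                (λ u v → ind-* (box-ind X-ind Z-ind u v) (mark-ind′ m₂ u v))
                (λ u v → ind-* (box-ind Y-ind Z-ind u v) (mark-ind′ m₃ u v))
              (box-ind X-ind Y-ind) (box-ind X-ind Z-ind) (box-ind Y-ind Z-ind)
              (ω-≥0 𝓟 boxed i) (ω-≤1 𝓟 boxed i) (ω-≥0 𝓟 boxed j) (ω-≤1 𝓟 boxed j) (replace₁₂ i) (replace₁₃ j) (replace₂₃ k))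

          private
            -- On the colour class of p, the pin of a pair is the same as a condition on p. This
            -- moves the pins from the vertices to the patterns, where they reproduce the terms of
            -- `deg`.
            match : Slot → ℕ → Carrier
            match nothing  p = 1#
            match (just a) p = 𝟙 (p ℕ.≟ a)

            match-ind : ∀ m p → Ind (match m p)
            match-ind nothing p = ind-1
            match-ind (just a) p = 𝟙-ind (p ℕ.≟ a)

            match-mark : ∀ m p u v → mark m u v * g p u v ≈ match m p * g p u v
            match-mark nothing p u v = ≈-refl
            match-mark (just a) p u v = ≈-trans (≈-sym (𝟙-× (φ u v ℕ.≟ a) (φ u v ℕ.≟ p))) (≈-trans
              (𝟙-cong ((φ u v ℕ.≟ a) ×-dec (φ u v ℕ.≟ p)) ((p ℕ.≟ a) ×-dec (φ u v ℕ.≟ p))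
                (λ { (≡.refl , ≡.refl) → ≡.refl , ≡.refl }) (λ { (≡.refl , ≡.refl) → ≡.refl , ≡.refl }))
              (𝟙-× (p ℕ.≟ a) (φ u v ℕ.≟ p)))

            match-ω : ∀ m p → match m p * x p ≈ ω x m * σ x m p
            match-ω nothing p = ≈-refl
            match-ω (just a) p = go (p ℕ.≟ a)
              where
              go : Dec (p ≡ a) → 𝟙 (p ℕ.≟ a) * x p ≈ x a * 𝟙 (p ℕ.≟ a)
              go (yes ≡.refl) = *-comm _ _
              go (no p≢a) = ≈-trans (*-congʳ (𝟙-no (p ℕ.≟ a) p≢a))
                (≈-trans (zeroˡ _) (≈-sym (≈-trans (*-congˡ (𝟙-no (p ℕ.≟ a) p≢a)) (zeroʳ _))))

            edge-pattern : ∀ u v w → tripod u v w * e u v w ≤ tripod u v w * ∑[ patterns 𝓟 ]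
              (λ (p , q , r) → g p u v * g q u w * g r v w)
            edge-pattern u v w = go (X-ind u) (Y-ind v) (Z-ind w)
              where
              S : Carrier
              S = ∑[ patterns 𝓟 ] (λ (p , q , r) → g p u v * g q u w * g r v w)
              term≥0 : ∀ ((p , q , r) : Triple) → 0# ≤ g p u v * g q u w * g r v w
              term≥0 (p , q , r) = ind-≥0 (ind-* (ind-* (𝟙-ind (φ u v ℕ.≟ p)) (𝟙-ind (φ u w ℕ.≟ q))) (𝟙-ind (φ v w ℕ.≟ r)))
              zero-case : tripod u v w ≈ 0# → tripod u v w * e u v w ≤ tripod u v w * S
              zero-case z = ≤-reflexive (≈-trans (*-congʳ z) (≈-trans (zeroˡ _) (≈-sym (≈-trans (*-congʳ z) (zeroˡ _)))))
              edge-case : Dec (edges H ∋ triple u v w) → rank u ℕ.< rank v → rank v ℕ.< rank w → e u v w ≤ S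
              edge-case (no ¬i) _ _ = ≤-respˡ (≈-sym (𝟙-no (edges H ∋? triple u v w) ¬i)) (∑-≥0 (patterns 𝓟) term≥0)
              edge-case (yes i) p q = ≤-trans (ind-≤1 (𝟙-ind (edges H ∋? triple u v w))) (≤-respˡ
                (≈-trans (*-cong (*-cong (𝟙-yes (φ u v ℕ.≟ φ u v) ≡.refl) (𝟙-yes (φ u w ℕ.≟ φ u w) ≡.refl))
                  (𝟙-yes (φ v w ℕ.≟ φ v w) ≡.refl)) (≈-trans (*-identityʳ _) (*-identityʳ _)))
                (∑-term-≤ (patterns 𝓟) term≥0 (coloured u v w p q i)))
              go : Ind (X u) → Ind (Y v) → Ind (Z w) → tripod u v w * e u v w ≤ tripod u v w * S
              go (inj₁ z) _ _ = zero-case (≈-trans (*-congʳ (≈-trans (*-congʳ z) (zeroˡ _))) (zeroˡ _))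
              go (inj₂ _) (inj₁ z) _ = zero-case (≈-trans (*-congʳ (≈-trans (*-congˡ z) (zeroʳ _))) (zeroˡ _))
              go (inj₂ _) (inj₂ _) (inj₁ z) = zero-case (≈-trans (*-congˡ z) (zeroʳ _))
              go (inj₂ a) (inj₂ b) (inj₂ c) = *-monoˡ-≤ (ind-≥0 (ind-* (ind-* (X-ind u) (Y-ind v)) (Z-ind w)))
                (edge-case (edges H ∋? triple u v w) (X<Y a b) (Y<Z b c))

          -- Edges between the ordered parts carry a pattern of the palette, so they can be counted
          -- pattern by pattern. A pattern that agrees with the pins contributes the product of its
          -- three densities, which is the weight times its term of the degree.
          edges-counted : ∀ {m₁ m₂ m₃} → ∑₃ (λ u v w → marked ⟨ m₁ , m₂ , m₃ ⟩ u v w * e u v w) ≤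
            weight x ⟨ m₁ , m₂ , m₃ ⟩ * deg 𝓟 x ⟨ m₁ , m₂ , m₃ ⟩ * volume + fromℕ (length (patterns 𝓟)) * error
          edges-counted {m₁} {m₂} {m₃} = begin
            ∑₃ (λ u v w → marked ⟨ m₁ , m₂ , m₃ ⟩ u v w * e u v w)
              ≤⟨ ∑₃-mono {n} (λ u v w → ≤-trans (≤-reflexive (rearrange (tripod u v w) (μ u v w) (e u v w)))
                   (≤-trans (*-monoˡ-≤ (ind-≥0 (ind-* (ind-* (mark-ind′ m₁ u v) (mark-ind′ m₂ u w))
                     (mark-ind′ m₃ v w))) (edge-pattern u v w))
                     (≤-reflexive (≈-trans (≈-trans (≈-sym (*-assoc _ _ _))
                       (≈-sym (∑-*ˡ (patterns 𝓟) (μ u v w * tripod u v w) _))) (∑-cong (patterns 𝓟) (matched u v w)))))) ⟩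
            ∑₃ (λ u v w → ∑[ patterns 𝓟 ] (λ t → F t u v w)) ≈⟨ ∑₃-∑ {n = n} (patterns 𝓟) F ⟩
            ∑[ patterns 𝓟 ] (λ t → ∑₃ (F t))                 ≤⟨ ∑-mono-∈ (patterns 𝓟) bound ⟩
            ∑[ patterns 𝓟 ] (λ t → W * D t * volume + error)  ≈⟨ ≈-trans (∑-+ (patterns 𝓟) _ _) (+-cong
                (≈-trans (∑-*ʳ (patterns 𝓟) volume _) (*-congʳ (∑-*ˡ (patterns 𝓟) W D))) (∑-const (patterns 𝓟) error)) ⟩
            W * deg 𝓟 x ⟨ m₁ , m₂ , m₃ ⟩ * volume + fromℕ (length (patterns 𝓟)) * error ∎
            where
            open ≤R
            W : Carrier
            W = weight x ⟨ m₁ , m₂ , m₃ ⟩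
            D M : Triple → Carrier
            D (p , q , r) = σ x m₁ p * σ x m₂ q * σ x m₃ r
            M (p , q , r) = match m₁ p * match m₂ q * match m₃ r
            μ : Kernel₃ n
            μ u v w = mark m₁ u v * mark m₂ u w * mark m₃ v w
            F : Triple → Kernel₃ n
            F t@(p , q , r) u v w = M t * marked ⟨ just p , just q , just r ⟩ u v w
            rearrange : ∀ t m e → t * m * e ≈ m * (t * e)
            rearrange = solve 3 (λ t m e → t :* m :* e := m :* (t :* e)) ≈-refl
            matched : ∀ u v w ((p , q , r) : Triple) → μ u v w * tripod u v w * (g p u v * g q u w * g r v w) ≈ F
              (p , q , r) u v w
            matched u v w (p , q , r) = ≈-trans (gather (mark m₁ u v) (mark m₂ u w) (mark m₃ v w) (tripod u v w)
              (g p u v) (g q u w) (g r v w))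
              (≈-trans (*-congˡ (*-cong (*-cong (match-mark m₁ p u v) (match-mark m₂ q u w)) (match-mark m₃ r v w)))
                (scatter (match m₁ p) (match m₂ q) (match m₃ r) (tripod u v w) (g p u v) (g q u w) (g r v w)))
              where
              gather : ∀ a b c t p q r → a * b * c * t * (p * q * r) ≈ t * ((a * p) * (b * q) * (c * r))
              gather = solve 7 (λ a b c t p q r → a :* b :* c :* t :* (p :* q :* r) := t :*
                ((a :* p) :* (b :* q) :* (c :* r))) ≈-refl
              scatter : ∀ a b c t p q r → t * ((a * p) * (b * q) * (c * r)) ≈ a * b * c * (t * (p * q * r))
              scatter = solve 7 (λ a b c t p q r → t :* ((a :* p) :* (b :* q) :* (c :* r)) := a :* b :* c :*
                (t :* (p :* q :* r))) ≈-refl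
            bound : ∀ t → t ∈ patterns 𝓟 → ∑₃ (F t) ≤ W * D t * volume + error
            bound t@(p , q , r) t∈ = let i , j , k = patterns⊆Φ 𝓟 t∈ in begin
              ∑₃ (F t)                                                ≈⟨ ∑₃-*ˡ {n} (M t) _ ⟩
              M t * ∑₃ (marked ⟨ just p , just q , just r ⟩)          ≤⟨ *-monoˡ-≤ (ind-≥0 M-ind)
                (below (counted (pinned i) (pinned j) (pinned k))) ⟩
              M t * (x p * x q * x r * volume + error)                ≈⟨ distribˡ _ _ _ ⟩
              M t * (x p * x q * x r * volume) + M t * error
                ≤⟨ +-mono-≤ (≤-reflexive weights) (≤-respʳ (*-identityˡ error)
                  (*-monoʳ-≤ (0≤-+ (0≤-+ error₁≥0 error₁≥0) error₁≥0) (ind-≤1 M-ind))) ⟩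
              W * D t * volume + error                                ∎
              where
              M-ind : Ind (M t)
              M-ind = ind-* (ind-* (match-ind m₁ p) (match-ind m₂ q)) (match-ind m₃ r)
              pairwise : ∀ a b c p q r s → a * b * c * (p * q * r * s) ≈ (a * p) * (b * q) * (c * r) * s
              pairwise = solve 7 (λ a b c p q r s → a :* b :* c :* (p :* q :* r :* s) := (a :* p) :* (b :* q) :*
                (c :* r) :* s) ≈-refl
              unpair : ∀ a b c p q r s → (a * p) * (b * q) * (c * r) * s ≈ a * b * c * (p * q * r) * s
              unpair = solve 7 (λ a b c p q r s → (a :* p) :* (b :* q) :* (c :* r) :* s := a :* b :* c :*
                (p :* q :* r) :* s) ≈-refl
              weights : M t * (x p * x q * x r * volume) ≈ W * D t * volume
              weights = ≈-trans (pairwise (match m₁ p) (match m₂ q) (match m₃ r) (x p) (x q) (x r) volume)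
                (≈-trans (*-congʳ (*-cong (*-cong (match-ω m₁ p) (match-ω m₂ q)) (match-ω m₃ r)))
                  (unpair (ω x m₁) (ω x m₂) (ω x m₃) (σ x m₁ p) (σ x m₂ q) (σ x m₃ r) volume))

          -- The density hypothesis is compared with both counts and divided by the volume. Each
          -- pattern contributes one counting error and the size of the test another, the latter
          -- with factor d ≤ 1; ζ pays for the slack η n³.
          almost-good : ∀ ⋆ {d η ζ} → 0# ≤ d → d ≤ 1# → 0# < volume → η * fromℕ (n ℕ.^ 3) ≤ ζ * volume → Dense ℝ ⋆ d η H →
            ∀ m → Admissible 𝓟 ⋆ m → d * weight x m ≤ weight x m * deg 𝓟 x m + ((1# + fromℕ (length (patterns 𝓟))) * (3# * ε) + ζ)
          almost-good ⋆ {d} {η} {ζ} d≥0 d≤1 volume>0 small D m@(⟨ m₁ , m₂ , m₃ ⟩) adm = *-cancel-≤ volume>0 (≤-by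
              (0≤-+ (0≤-+ (0≤-+ (x≤y⇒0≤y-x (≤-trans dense (edges-counted {m₁} {m₂} {m₃}))) (*-nonNeg d≥0 (x≤y⇒0≤y-x (above (let i , j , k = slots 𝓟 adm in counted i j k)))))
                (x≤y⇒0≤y-x small)) (*-nonNeg (x≤y⇒0≤y-x d≤1) (0≤-+ (0≤-+ error₁≥0 error₁≥0) error₁≥0)))
              (certificate volume d (weight x m) (weight x m * deg 𝓟 x m) (fromℕ (length (patterns 𝓟))) ε ζ
                (∑₃ (marked m)) (η * fromℕ (n ℕ.^ 3))))
            where
            dense : d * ∑₃ (marked m) - η * fromℕ (n ℕ.^ 3) ≤ ∑₃ (λ u v w → marked m u v w * e u v w)
            dense = marked-dense witness ⋆ D m adm
              where
              witness : ∃[ v ] Y v ≈ 1#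
              witness with em {∃[ v ] Y v ≈ 1#}
              ... | yes p = p
              ... | no none = contradiction (≈-sym (≈-trans (*-congʳ (≈-trans (*-congˡ empty) (zeroʳ _))) (zeroˡ _)))
                (proj₂ volume>0)
                where
                empty : size Y ≈ 0#
                empty = ≈-trans (∑-cong (allFin n) (λ v → outside v (Y-ind v))) (∑-zero (allFin n))
                  where
                  outside : ∀ v → Ind (Y v) → Y v ≈ 0#
                  outside v (inj₁ z) = z
                  outside v (inj₂ o) = contradiction (v , o) none
            certificate : ∀ V d w wd P ε ζ S E → let er = ε * V + ε * V + ε * V in
              V * (wd + ((1# + P) * (3# * ε) + ζ)) ≈ V * (d * w) +
                (((wd * V + P * er) - (d * S - E)) + d * (S + er - w * V) + (ζ * V - E) + (1# - d) * er)
            certificate V d w wd P ε ζ S E = ≈-trans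
              (solve 5 (λ V wd P ε ζ → V :* (wd :+ ((:1 :+ P) :* (:3 :* ε) :+ ζ)) := wd :* V :+ (:1 :+ P) :*
                (ε :* V :+ ε :* V :+ ε :* V) :+ ζ :* V) ≈-refl V wd P ε ζ)
              (≈-trans (regroup (wd * V) P (ε * V + ε * V + ε * V) (ζ * V) d S E (w * V))
                (+-congʳ (solve 3 (λ d w V → d :* (w :* V) := V :* (d :* w)) ≈-refl d w V)))
              where
              regroup : ∀ a P r z d S E wV → a + (1# + P) * r + z ≈ d * wV +
                (((a + P * r) - (d * S - E)) + d * (S + r - wV) + (z - E) + (1# - d) * r)
              regroup a P r z d S E wV = ≈-trans
                (solve 4 (λ a P r z → a :+ (:1 :+ P) :* r :+ z := (a :+ P :* r) :+ (r :+ z)) ≈-refl a P r z)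
                (core (a + P * r) r z d S E wV)
                where
                core : ∀ A r z d S E wV → A + (r + z) ≈ d * wV + ((A - (d * S - E)) + d * (S + r - wV) + (z - E) + (1# - d) * r)
                core = solve 7 (λ A r z d S E wV → A :+ (r :+ z) := d :* wV :+
                  ((A :- (d :* S :- E)) :+ d :* (S :+ r :- wV) :+ (z :- E) :+ (:1 :- d) :* r)) ≈-refl

  open UpperBounds

  -- Three parts with common colour densities

  module Triads where

    private
      variable
        n : ℕ

    module Selection (𝓟 : Palette) {θ : Carrier} (θ>0 : 0# < θ) where

      private
        L : List ℕ
        L = Φ 𝓟
        -- Rounding to multiples of 1/K loses at most θ.
        fine : ∃[ K ] 1# ≤ fromℕ K * θ
        fine = let i , θi≈1 , _ = inverse>0 θ>0; K , le = archimedean i in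
          K , ≤-respˡ θi≈1 (≤-respʳ (*-comm _ _) (*-monoˡ-≤ (<⇒≤ θ>0) le))
        K : ℕ
        K = proj₁ fine

      -- This number depends on the palette and θ only, which allows η to be chosen after it.
      parts : ℕ
      parts = ramsey-number (length (grid L K))

      tasks : List (Task parts)
      tasks = filter (λ (i , j , c) → i Fin.<? j) (cartesianProduct (allFin parts) (cartesianProduct (allFin parts) L))

      abstract
        parts>0 : 0 ℕ.< parts
        parts>0 = positive (length (grid L K))
          where
          positive : ∀ q → 0 ℕ.< ramsey-number q
          positive zero = ℕ.s≤s ℕ.z≤n
          positive (suc q) = ℕ.s≤s ℕ.z≤n

        task-∈ : ∀ {i j c} → i Fin.< j → c ∈ L → (i , j , c) ∈ tasks
        task-∈ {i} {j} {c} i<j c∈ = ∈-filter⁺ (λ (i , j , c) → i Fin.<? j)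
          (∈-cartesianProduct⁺ (∈-allFin i) (∈-cartesianProduct⁺ (∈-allFin j) c∈)) i<j

        task-distinct : ∀ i j c → (i , j , c) ∈ tasks → i ≢ j
        task-distinct i j c t∈ = Fin.<⇒≢ (proj₂ (∈-filter⁻ (λ (i , j , c) → i Fin.<? j)
          {xs = cartesianProduct (allFin parts) (cartesianProduct (allFin parts) L)} t∈))

      regularity : ∃[ δ ] (0# < δ × (∀ {n} (φ : Fin n → Fin n → ℕ) (U : Fin parts → Vector n) → (∀ i → IndVec (U i)) →
        Σ[ S ∈ Subfamily δ U ] (∀ t → t ∈ tasks → RegularFor θ φ (S .sub) t)))
      regularity = regular-family tasks task-distinct θ>0

      δ : Carrier
      δ = proj₁ regularity

      δ>0 : 0# < δ
      δ>0 = proj₁ (proj₂ regularity)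

      -- The densities x of the pair (X , Y) serve all three pairs; hence the doubled error for the other two.
      record Triad {n} (φ : Fin n → Fin n → ℕ) (U : Fin parts → Vector n) : Set where
        field
          i j l : Fin parts
          i<j : i Fin.< j
          j<l : j Fin.< l
          X Y Z : Vector n
          X-ind : IndVec X
          Y-ind : IndVec Y
          Z-ind : IndVec Z
          X⊆ : X ⊆ᵛ U i
          Y⊆ : Y ⊆ᵛ U j
          Z⊆ : Z ⊆ᵛ U l
          X-large : δ * size (U i) ≤ size X
          Y-large : δ * size (U j) ≤ size Y
          Z-large : δ * size (U l) ≤ size Z
          x : ℕ → Carrier
          x-boxed : Boxed L x
          cut-XY : ∀ c → c ∈ L → Cut (θ * (size X * size Y)) (λ u v → box X Y u v * colour-kernel φ c u v)
            (λ u v → x c * box X Y u v)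
          cut-XZ : ∀ c → c ∈ L → Cut (2# * θ * (size X * size Z)) (λ u v → box X Z u v * colour-kernel φ c u v)
            (λ u v → x c * box X Z u v)
          cut-YZ : ∀ c → c ∈ L → Cut (2# * θ * (size Y * size Z)) (λ u v → box Y Z u v * colour-kernel φ c u v)
            (λ u v → x c * box Y Z u v)

      abstract
        private
          change-density : ∀ {ε d d′} {F : Kernel n} {A B : Vector n} → IndVec A → IndVec B → Near θ d d′ →
            Cut (ε * (size A * size B)) F (λ u v → d * box A B u v) → Cut ((ε + θ) * (size A * size B)) F
              (λ u v → d′ * box A B u v)
          change-density {n} {ε} {d} {d′} {F} {A} {B} i j (p & q) C = mkCut (λ a b ia ib →
            near-mono (≤-reflexive (≈-sym (distribʳ _ ε θ))) (near-trans (C .cut a b ia ib) (shift a b ia ib)))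
            where
            shift : ∀ a b → IndVec a → IndVec b → Near (θ * (size A * size B))
              (∑₂ λ u v → a u * b v * (d * box A B u v)) (∑₂ λ u v → a u * b v * (d′ * box A B u v))
            shift a b ia ib = one-way p & one-way q
              where
              S : Carrier
              S = ∑₂ λ u v → a u * b v * box A B u v
              S≥0 : 0# ≤ S
              S≥0 = ∑₂-≥0 (λ u v → ind-≥0 (ind-* (ind-* (ia u) (ib v)) (ind-* (i u) (j v))))
              S≤ : S ≤ size A * size B
              S≤ = ≤-respʳ (≈-sym (size-box A B)) (∑₂-mono
                (λ u v → ≤-respʳ (*-identityˡ _) (*-monoʳ-≤ (ind-≥0 (ind-* (i u) (j v))) (ind-≤1 (ind-* (ia u) (ib v))))))
              pull : ∀ d → ∑₂ (λ u v → a u * b v * (d * box A B u v)) ≈ d * S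
              pull d = ≈-trans (∑₂-cong {n} (λ u v → move (a u * b v) d (box A B u v))) (∑₂-*ˡ {n} d _)
                where
                move : ∀ r d k → r * (d * k) ≈ d * (r * k)
                move = solve 3 (λ r d k → r :* (d :* k) := d :* (r :* k)) ≈-refl
              one-way : ∀ {d d′} → d ≤ d′ + θ → ∑₂ (λ u v → a u * b v * (d * box A B u v)) ≤ ∑₂
                (λ u v → a u * b v * (d′ * box A B u v)) + θ * (size A * size B)
              one-way {d} {d′} le = ≤-respˡ (≈-sym (pull d)) (≤-respʳ (+-congʳ (≈-sym (pull d′))) (≤-trans (*-monoʳ-≤ S≥0 le)
                (≤-respˡ (≈-sym (distribʳ S d′ θ)) (+-monoʳ-≤ _ (*-monoˡ-≤ (<⇒≤ θ>0) S≤)))))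

          same-cell : ∀ {y z m} → fromℕ m ≤ fromℕ K * y → fromℕ K * y ≤ fromℕ m + 1# → fromℕ m ≤ fromℕ K * z →
            fromℕ K * z ≤ fromℕ m + 1# → Near θ y z
          same-cell {y} {z} {m} p q r s = one-way q r & one-way s p
            where
            K>0 : 0# < fromℕ K
            K>0 = 0≤fromℕ K , λ e → 1≉0 (≤-antisym (≤-respʳ (≈-trans (*-congʳ (≈-sym e)) (zeroˡ θ)) (proj₂ fine)) 0≤1)
            one-way : ∀ {y z} → fromℕ K * y ≤ fromℕ m + 1# → fromℕ m ≤ fromℕ K * z → y ≤ z + θ
            one-way {y} {z} q r = *-cancel-≤ K>0 (≤-trans q
              (≤-trans (+-mono-≤ r (proj₂ fine)) (≤-reflexive (≈-sym (distribˡ (fromℕ K) z θ)))))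

        -- Pairs of parts are coloured by their rounded density vectors. In a monochromatic triangle
        -- the three vectors agree up to θ in every colour, so the vector of the first pair can
        -- serve all three.
        triad : ∀ {n} (φ : Fin n → Fin n → ℕ) (U : Fin parts → Vector n) → (∀ i → IndVec (U i)) → Triad φ U
        triad {n} φ U U-ind = assemble (ramsey Fin._<_ χ (length (grid L K)) (grid L K) ℕ.≤-refl (allFin parts)
          (AllPairs.tabulate⁺-< (λ p → p))
            (ℕ.≤-reflexive (≡.sym (length-allFin parts)))
              (λ i j _ _ _ → map-∈-grid L (cell i j) (λ c _ → proj₁ (proj₂ (round i j c)))))
          where
          family : Σ[ S ∈ Subfamily δ U ] (∀ t → t ∈ tasks → RegularFor θ φ (S .sub) t)
          family = proj₂ (proj₂ regularity) φ U U-ind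
          S : Subfamily δ U
          S = proj₁ family
          -- Ramsey's theorem takes a colouring of all pairs of indices, hence the default 0 off the
          -- tasks; in a triangle all pairs have i < j and are tasks.
          dens : Fin parts → Fin parts → ℕ → Σ[ d ∈ Carrier ] (0# ≤ d × d ≤ 1#)
          dens i j c with em {(i , j , c) ∈ tasks}
          ... | yes t = let R = proj₂ family (i , j , c) t in R .density , R .density-≥0 , R .density-≤1
          ... | no _ = 0# , ≤-refl , 0≤1
          D : Fin parts → Fin parts → ℕ → Carrier
          D i j c = proj₁ (dens i j c)
          D-cut : ∀ i j c → (i , j , c) ∈ tasks → Cut (θ * (size (S .sub i) * size (S .sub j)))
            (λ u v → box (S .sub i) (S .sub j) u v * colour-kernel φ c u v) (λ u v → D i j c * box (S .sub i) (S .sub j) u v)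
          D-cut i j c t∈ with em {(i , j , c) ∈ tasks}
          ... | yes t = proj₂ family (i , j , c) t .regular
          ... | no ∉ = contradiction t∈ ∉
          round : ∀ i j c → ∃[ m ] (m ℕ.≤ K × fromℕ m ≤ fromℕ K * D i j c × fromℕ K * D i j c ≤ fromℕ m + 1#)
          round i j c = let _ , p , q = dens i j c in rounding K (*-nonNeg (0≤fromℕ K) p) (≤-respʳ (*-identityʳ _) (*-monoˡ-≤ (0≤fromℕ K) q))
          cell : Fin parts → Fin parts → ℕ → ℕ
          cell i j c = proj₁ (round i j c)
          χ : Fin parts → Fin parts → List ℕ
          χ i j = map (cell i j) L
          assemble : MonochromaticTriangle Fin._<_ χ (allFin parts) → Triad φ U
          assemble M = record
            { i = i ; j = j ; l = l ; i<j = i≺j ; j<l = j≺l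
            ; X = S .sub i ; Y = S .sub j ; Z = S .sub l ; X-ind = S .sub-ind i ; Y-ind = S .sub-ind j ; Z-ind = S .sub-ind l
            ; X⊆ = S .sub-⊆ i ; Y⊆ = S .sub-⊆ j ; Z⊆ = S .sub-⊆ l ; X-large = S .sub-large i ; Y-large =
              S .sub-large j ; Z-large = S .sub-large l
            ; x = D i j ; x-boxed = λ c _ → proj₂ (dens i j c)
            ; cut-XY = λ c c∈ → D-cut i j c (task-∈ i≺j c∈)
            ; cut-XZ = λ c c∈ → transfer i l i≺l ij≡il c c∈
            ; cut-YZ = λ c c∈ → transfer j l j≺l ij≡jl c c∈
            }
            where
            open MonochromaticTriangle M
            transfer : ∀ i′ j′ → i′ Fin.< j′ → χ i j ≡ χ i′ j′ → ∀ c → c ∈ L →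
              Cut (2# * θ * (size (S .sub i′) * size (S .sub j′)))
                (λ u v → box (S .sub i′) (S .sub j′) u v * colour-kernel φ c u v)
                (λ u v → D i j c * box (S .sub i′) (S .sub j′) u v)
            transfer i′ j′ lt e c c∈ = mkCut (λ a b ia ib → near-mono
              (≤-reflexive (*-congʳ (solve 1 (λ t → t :+ t := :2 :* t) ≈-refl θ)))
              (change-density (S .sub-ind i′) (S .sub-ind j′) close-densities (D-cut i′ j′ c (task-∈ lt c∈)) .cut a b ia ib))
              where
              same : cell i j c ≡ cell i′ j′ c
              same = map-injective L (cell i j) (cell i′ j′) e c c∈
              close-densities : Near θ (D i′ j′ c) (D i j c)
              close-densities = let _ , _ , p , q = round i′ j′ c; _ , _ , r , s = round i j c in
                same-cell {m = cell i′ j′ c} p q (≡.subst (λ m → fromℕ m ≤ fromℕ K * D i j c) same r)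
                  (≡.subst (λ m → fromℕ K * D i j c ≤ fromℕ m + 1#) same s)

  open Triads

  -- The Turán density of the uncolourable graphs

  module TuranDensity where

    module _ (𝓟 : Palette) where

      private
        L : List ℕ
        L = Φ 𝓟

      abstract
        -- Each cut bound is tested on the full rectangle. The colour classes partition it, so the
        -- densities add up to 1 with an error of θ for every colour.
        densities-sum : ∀ {n θ} {φ : Fin n → Fin n → ℕ} → (∀ u v → φ u v ∈ L) → {X Y : Vector n} {x : ℕ → Carrier} →
          0# < size X * size Y →
          (∀ c → c ∈ L → Cut (θ * (size X * size Y)) (λ u v → box X Y u v * colour-kernel φ c u v) (λ u v → x c * box X Y u v)) →
          Near (fromℕ (length L) * θ) (∑[ L ] x) 1#
        densities-sum {n} {θ} {φ} φ-∈ {X} {Y} {x} B>0 cuts = near-sym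
          (cancel (near-cong left-side right-side (near-∑-∈ L
          (λ c i → cuts c i .cut (λ _ → 1#) (λ _ → 1#) (λ _ → ind-1) (λ _ → ind-1)))))
          where
          B κ : Carrier
          B = size X * size Y
          κ = θ * B
          one : ∀ k → 1# * 1# * k ≈ k
          one k = ≈-trans (*-congʳ (*-identityˡ 1#)) (*-identityˡ k)
          near-∑-∈ : ∀ is {f g : ℕ → Carrier} → (∀ i → i ∈ is → Near κ (f i) (g i)) → Near (fromℕ (length is) * κ)
            (∑[ is ] f) (∑[ is ] g)
          near-∑-∈ is {f} {g} h =
            ≤-respʳ (≈-trans (∑-+ is g (λ _ → κ)) (+-congˡ (∑-const is κ))) (∑-mono-∈ is (λ i p → below (h i p))) &
            ≤-respʳ (≈-trans (∑-+ is f (λ _ → κ)) (+-congˡ (∑-const is κ))) (∑-mono-∈ is (λ i p → above (h i p)))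
          all-colours : ∀ u v → ∑[ L ] (λ c → colour-kernel φ c u v) ≈ 1#
          all-colours u v = ≈-trans (∑-cong L (λ c → ≈-trans (𝟙-cong (φ u v ℕ.≟ c) (c ℕ.≟ φ u v) ≡.sym ≡.sym)
            (≈-sym (*-identityʳ _))))
            (∑-dirac ℕ._≟_ (λ _ → 1#) (Φ-unique 𝓟) (φ-∈ u v))
          left-side : ∑[ L ] (λ c → ∑₂ λ u v → 1# * 1# * (box X Y u v * colour-kernel φ c u v)) ≈ B
          left-side = ≈-trans (∑-comm L (allFin n) _)
            (≈-trans (∑-cong (allFin n) (λ u → ≈-trans (∑-comm L (allFin n) _) (∑-cong (allFin n) (λ v →
            ≈-trans (∑-cong L (λ c → one _)) (≈-trans (∑-*ˡ L (box X Y u v) _)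
              (≈-trans (*-congˡ (all-colours u v)) (*-identityʳ _))))))) (≈-sym (size-box X Y)))
          right-side : ∑[ L ] (λ c → ∑₂ λ u v → 1# * 1# * (x c * box X Y u v)) ≈ ∑[ L ] x * B
          right-side = ≈-trans (∑-cong L (λ c → ≈-trans (∑₂-cong {n} (λ u v → one _))
            (≈-trans (∑₂-*ˡ {n} (x c) _) (*-congˡ (≈-sym (size-box X Y)))))) (∑-*ʳ L B x)
          cancel : Near (fromℕ (length L) * κ) B (∑[ L ] x * B) → Near (fromℕ (length L) * θ) 1# (∑[ L ] x)
          cancel (p & q) =
            *-cancel-≤ B>0 (≤-respˡ (≈-sym (*-identityʳ B))
              (≤-respʳ (solve 4 (λ s B l t → s :* B :+ l :* (t :* B) := B :* (s :+ l :* t)) ≈-refl (∑[ L ] x) B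
              (fromℕ (length L)) θ) p)) &
            *-cancel-≤ B>0 (≤-respˡ (*-comm _ _) (≤-respʳ
              (solve 3 (λ B l t → B :+ l :* (t :* B) := B :* (:1 :+ l :* t)) ≈-refl B (fromℕ (length L)) θ) q))

        -- The constants are chosen in the order θ, number of parts, δ, η. Intervals of equal length
        -- in the order of a colouring then contain a triad whose volume is a fixed share of n³,
        -- against which η n³ is negligible.
        dense⇒almost-good : ∀ ⋆ {d} → 0# ≤ d → d ≤ 1# →
          (∀ η → 0# < η → ∀ n → ∃[ H ] (H FreeOf uncolourable 𝓟 × n ℕ.≤ order H × Dense ℝ ⋆ d η H)) →
          ∀ ε → 0# < ε → ∃[ x ] AlmostGood 𝓟 ⋆ d ε x
        dense⇒almost-good ⋆ {d} d≥0 d≤1 graphs ε ε>0 = T.x , record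
          { boxed = T.x-boxed
          ; total-≈1 = near-mono total-error (densities-sum C.colour-∈ {X = T.X} {T.Y} (0<-* X>0 Y>0) T.cut-XY)
          ; good = λ m adm → ≤-trans (UpperBound.almost-good 𝓟 H colouring T.X-ind T.Y-ind T.Z-ind X<Y Y<Z T.x-boxed 2θ≥0
                     (λ c i → mkCut (λ a b ia ib → near-mono widen (T.cut-XY c i .cut a b ia ib))) T.cut-XZ T.cut-YZ
                     ⋆ d≥0 d≤1 volume>0 small dense m adm) (+-monoʳ-≤ _ count-error)
          }
          where
          p l D : Carrier
          p = fromℕ (length (patterns 𝓟))
          l = fromℕ (length L)
          -- The coefficients of θ in all errors: 6 (1 + p) from counting with cut error 2 θ, 1 from
          -- the slack ζ = θ, and one for each colour from the sum of the densities.
          D = (1# + p) * (3# * 2#) + 1# + l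
          p≥0 : 0# ≤ p
          p≥0 = 0≤fromℕ (length (patterns 𝓟))
          l≥0 : 0# ≤ l
          l≥0 = 0≤fromℕ (length L)
          A≥0 : 0# ≤ (1# + p) * (3# * 2#)
          A≥0 = *-nonNeg (0≤-+ 0≤1 p≥0) (*-nonNeg 0≤3 0≤2)
          margin : ∃[ θ ] (0# < θ × D * θ ≈ ε)
          margin = shrink (<-≤-trans 0<1 (≤-by (0≤-+ A≥0 l≥0)
            (solve 2 (λ a l → a :+ :1 :+ l := :1 :+ (a :+ l)) ≈-refl ((1# + p) * (3# * 2#)) l))) ε>0
          θ : Carrier
          θ = proj₁ margin
          θ>0 : 0# < θ
          θ>0 = proj₁ (proj₂ margin)
          2θ≥0 : 0# ≤ 2# * θ
          2θ≥0 = *-nonNeg 0≤2 (<⇒≤ θ>0)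
          total-error : l * θ ≤ ε
          total-error = ≤-respʳ (proj₂ (proj₂ margin)) (≤-by (*-nonNeg (0≤-+ A≥0 0≤1) (<⇒≤ θ>0))
            (solve 3 (λ a l t → (a :+ :1 :+ l) :* t := l :* t :+ (a :+ :1) :* t) ≈-refl ((1# + p) * (3# * 2#)) l θ))
          count-error : (1# + p) * (3# * (2# * θ)) + θ ≤ ε
          count-error = ≤-respʳ (proj₂ (proj₂ margin)) (≤-by (*-nonNeg l≥0 (<⇒≤ θ>0))
            (solve 3 (λ p l t → ((:1 :+ p) :* (:3 :* :2) :+ :1 :+ l) :* t := (:1 :+ p) :*
              (:3 :* (:2 :* t)) :+ t :+ l :* t) ≈-refl p l θ))
          open Selection 𝓟 θ>0
          k : Carrier
          k = fromℕ parts
          2k>0 : 0# < 2# * k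
          2k>0 = 0<-* 0<2 (<-≤-trans 0<1 (≤-respˡ (+-identityʳ 1#) (fromℕ-mono parts>0)))
          -- The choice (2k)³ η = θ δ³ is dictated by n ≤ 2 k s and by parts of at least δ s
          -- vertices, where s is the length of an interval.
          scale : ∃[ η ] (0# < η × (2# * k * (2# * k * (2# * k))) * η ≈ θ * (δ * δ * δ))
          scale = shrink (0<-* 2k>0 (0<-* 2k>0 2k>0)) (0<-* θ>0 (0<-* (0<-* δ>0 δ>0) δ>0))
          η : Carrier
          η = proj₁ scale
          chosen : ∃[ H ] (H FreeOf uncolourable 𝓟 × parts ℕ.≤ order H × Dense ℝ ⋆ d η H)
          chosen = graphs η (proj₁ (proj₂ scale)) parts
          H : 3Graph
          H = proj₁ chosen
          n : ℕ
          n = order H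
          N : Carrier
          N = fromℕ n
          dense : Dense ℝ ⋆ d η H
          dense = proj₂ (proj₂ (proj₂ chosen))
          colouring : Colouring 𝓟 H
          colouring = free⇒colouring 𝓟 (proj₁ (proj₂ chosen))
          module C = Colouring colouring
          module I = Intervals C.rank C.rank-injective
          instance
            parts-nonZero : ℕ.NonZero parts
            parts-nonZero = ℕ.>-nonZero parts>0
          s : ℕ
          s = n ℕ./ parts
          s>0 : 0 ℕ.< s
          s>0 = ℕ.m≥n⇒m/n>0 (proj₁ (proj₂ (proj₂ chosen)))
          fits : ∀ {i} → i ℕ.≤ parts → i ℕ.* s ℕ.≤ n
          fits i≤ = ℕ.≤-trans (ℕ.*-monoˡ-≤ s i≤) (≡.subst (ℕ._≤ n) (ℕ.*-comm s parts) (ℕ.m/n*n≤m n parts))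
          U : Fin parts → Vector n
          U i = I.interval s (Fin.toℕ i)
          U-ind : ∀ i → IndVec (U i)
          U-ind i = I.interval-ind s (Fin.toℕ i)
          module T = Triad (triad C.colour U U-ind)
          inside : {V W : Vector n} → V ⊆ᵛ W → ∀ {u} → V u ≈ 1# → W u ≈ 1#
          inside V⊆W {u} e = ≈-trans (≈-sym (*-identityʳ _)) (≈-trans (≈-sym (*-congˡ e)) (≈-trans (≈-sym (V⊆W u)) e))
          X<Y : ∀ {u v} → T.X u ≈ 1# → T.Y v ≈ 1# → C.rank u ℕ.< C.rank v
          X<Y a b = I.interval-order s (Fin.toℕ T.i) (Fin.toℕ T.j) s>0 T.i<j (fits (ℕ.<⇒≤ (Fin.toℕ<n T.j)))
            (inside T.X⊆ a) (inside T.Y⊆ b)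
          Y<Z : ∀ {u v} → T.Y u ≈ 1# → T.Z v ≈ 1# → C.rank u ℕ.< C.rank v
          Y<Z a b = I.interval-order s (Fin.toℕ T.j) (Fin.toℕ T.l) s>0 T.j<l (fits (ℕ.<⇒≤ (Fin.toℕ<n T.l)))
            (inside T.Y⊆ a) (inside T.Z⊆ b)
          q : Carrier
          q = δ * fromℕ s
          q>0 : 0# < q
          q>0 = 0<-* δ>0 (<-≤-trans 0<1 (≤-respˡ (+-identityʳ 1#) (fromℕ-mono s>0)))
          large : ∀ i {V : Vector n} → δ * size (U i) ≤ size V → q ≤ size V
          large i h = ≤-trans (*-monoˡ-≤ (<⇒≤ δ>0) (I.interval-size s (Fin.toℕ i) (fits (Fin.toℕ<n i)))) h
          X≥q : q ≤ size T.X
          X≥q = large T.i T.X-large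
          Y≥q : q ≤ size T.Y
          Y≥q = large T.j T.Y-large
          Z≥q : q ≤ size T.Z
          Z≥q = large T.l T.Z-large
          X>0 : 0# < size T.X
          X>0 = <-≤-trans q>0 X≥q
          Y>0 : 0# < size T.Y
          Y>0 = <-≤-trans q>0 Y≥q
          volume>0 : 0# < size T.X * size T.Y * size T.Z
          volume>0 = 0<-* (0<-* X>0 Y>0) (<-≤-trans q>0 Z≥q)
          widen : θ * (size T.X * size T.Y) ≤ 2# * θ * (size T.X * size T.Y)
          widen = *-monoʳ-≤ (<⇒≤ (0<-* X>0 Y>0)) (≤-by (<⇒≤ θ>0) (solve 1 (λ t → :2 :* t := t :+ t) ≈-refl θ))
          -- The remainder of the division is below k, hence at most s k because s ≥ 1; this
          -- accounts for the factor 2.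
          N≤ : N ≤ 2# * k * fromℕ s
          N≤ = ≤-trans (fromℕ-mono n≤) (≤-reflexive
            (≈-trans (fromℕ-+ (s ℕ.* parts) (s ℕ.* parts)) (≈-trans (+-cong (fromℕ-* s parts) (fromℕ-* s parts))
            (solve 2 (λ s k → s :* k :+ s :* k := :2 :* k :* s) ≈-refl (fromℕ s) k))))
            where
            n≤ : n ℕ.≤ s ℕ.* parts ℕ.+ s ℕ.* parts
            n≤ = ≡.subst (ℕ._≤ s ℕ.* parts ℕ.+ s ℕ.* parts) (≡.sym (ℕ.m≡m%n+[m/n]*n n parts)) (ℕ.+-monoˡ-≤ (s ℕ.* parts)
              (ℕ.≤-trans (ℕ.<⇒≤ (ℕ.m%n<n n parts)) (ℕ.m≤n*m parts s {{ℕ.>-nonZero s>0}})))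
          small : η * fromℕ (n ℕ.^ 3) ≤ θ * (size T.X * size T.Y * size T.Z)
          small = begin
            η * fromℕ (n ℕ.^ 3)                            ≈⟨ *-congˡ (fromℕ-cube 𝓟 n) ⟩
            η * (N * (N * N))                              ≤⟨ *-monoˡ-≤ (<⇒≤ (proj₁ (proj₂ scale)))
              (*-mono-≤ N²≥0 (0≤fromℕ n) N≤ (*-mono-≤ (0≤fromℕ n) (0≤fromℕ n) N≤ N≤)) ⟩
            η * (M * (M * M))                              ≈⟨ solve 3
              (λ e K s → e :* (K :* s :* (K :* s :* (K :* s))) := K :* (K :* K) :* e :* (s :* s :* s)) ≈-refl η
              (2# * k) (fromℕ s) ⟩
            2# * k * (2# * k * (2# * k)) * η * (fromℕ s * fromℕ s * fromℕ s) ≈⟨ *-congʳ (proj₂ (proj₂ scale)) ⟩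
            θ * (δ * δ * δ) * (fromℕ s * fromℕ s * fromℕ s) ≈⟨ solve 3
              (λ t d s → t :* (d :* d :* d) :* (s :* s :* s) := t :* ((d :* s) :* (d :* s) :* (d :* s))) ≈-refl θ δ (fromℕ s) ⟩
            θ * (q * q * q)                                ≤⟨ *-monoˡ-≤ (<⇒≤ θ>0)
              (*-mono-≤ q≥0 (*-nonNeg q≥0 q≥0) (*-mono-≤ q≥0 q≥0 X≥q Y≥q) Z≥q) ⟩
            θ * (size T.X * size T.Y * size T.Z)           ∎
            where
            open ≤R
            M : Carrier
            M = 2# * k * fromℕ s
            N²≥0 : 0# ≤ N * N
            N²≥0 = 0≤x² N
            q≥0 : 0# ≤ q
            q≥0 = <⇒≤ q>0

        -- The supremum is attained, since r itself is realised by dense colourable graphs.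
        -- Conversely every d in the set is feasible by compactness, hence at most r.
        turán-density : ∀ ⋆ {r} → Feasible 𝓟 ⋆ r → (∀ d → Feasible 𝓟 ⋆ d → d ≤ r) → IsTuránDensity ℝ ⋆ (uncolourable 𝓟) r
        turán-density ⋆ {r} feasible@(x , simplex , good) top =
          (λ d (d≥0 , d≤1 , graphs) → top d (feasible-limit 𝓟 ⋆ d≥0 (dense⇒almost-good ⋆ d≥0 d≤1 graphs))) ,
          (λ u bound → bound r (r≥0 , r≤1 , dense-graphs 𝓟 ⋆ r≥0 r≤1 simplex good))
          where
          r≥0 : 0# ≤ r
          r≥0 = top 0# (feasible-0 𝓟 ⋆)
          r≤1 : r ≤ 1#
          r≤1 = feasible-≤1 𝓟 ⋆ feasible

        palette-realised : ∀ ⋆ → ∃[ 𝓕 ] ∃[ r ] (IsLagrangian ℝ ⋆ 𝓟 r × IsTuránDensity ℝ ⋆ 𝓕 r)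
        palette-realised ⋆ = let r , lag , feasible , top = lagrangian 𝓟 ⋆ in uncolourable 𝓟 , r , lag , turán-density ⋆ feasible top

theorem3p5 : ExcludedMiddle 0ℓ → (ℝ : CompleteOrderedField) →
    ∀ (⋆ : Mode) (𝓟 : Palette) →
    ∃[ 𝓕 ] ∃[ r ] (IsLagrangian ℝ ⋆ 𝓟 r × IsTuránDensity ℝ ⋆ 𝓕 r)
theorem3p5 em ℝ ⋆ 𝓟 = TuranDensity.palette-realised em ℝ 𝓟 ⋆
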